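{- For a graph $G$ the following are equivalent: (i) $G\in\mathcal{G}_{\rm COM}$, i.e. $G$ is (isomorphic to) the tope graph of a complex of oriented matroids; (ii) $G$ is a partial cube and every antipodal subgraph of $G$ is gated (i.e. $G\in\mathrm{AG}$); (iii) $G\in\mathcal{F}(\mathcal{Q}^-)$, i.e. $G$ is a partial cube none of whose pc-minors is isomorphic to a member of $\mathcal{Q}^-$.
   Context: A graph is a partial cube if it is isomorphic to an isometric subgraph of a hypercube. In a partial cube the Djoković–Winkler relation $\Theta$ on edges is an equivalence relation; its classes $E_f$ are the $\Theta$-classes (they correspond to the coordinates of an isometric hypercube embedding). Removing the edges of $E_f$ leaves two convex subgraphs, the halfspaces $E_f^+$, $E_f^-$. A subgraph is convex if it contains every shortest path between any two of its vertices; $\mathrm{conv}(S)$ is the smallest convex subgraph containing $S$. A restriction of $G$ is a subgraph induced by an intersection of halfspaces of distinct $\Theta$-classes; the contraction $\pi_f(G)$ is obtained by contracting all edges of $E_f$. A pc-minor of $G$ is any graph obtained from $G$ by a sequence of restrictions and contractions. For a set $X$ of partial cubes, $\mathcal F(X)$ denotes the class of partial cubes having no pc-minor isomorphic to a member of $X$. For a subgraph $H$ and $x\in H$, a vertex $-_Hx\in H$ with $\mathrm{conv}(x,-_Hx)=H$ is the antipode of $x$ in $H$; $H$ is antipodal if every vertex of $H$ has an antipode in $H$. A subgraph $H$ of $G$ is gated if for each vertex $x$ of $G$ there is $x'\in H$ such that for every $y\in H$ some shortest $x$–$y$ path passes through $x'$. $\mathrm{AG}$ is the class of partial cubes all of whose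 antipodal subgraphs are gated. The family $\mathcal Q^-$: for $n\ge 4$, let $v$ be a vertex of the hypercube $Q_n$ and $-v$ its antipodal vertex; $Q_n^-:=Q_n-\{ -v\}$; $Q_n^{ -*}$ is obtained from $Q_n^-$ by deleting exactly one neighbor of $v$; $Q_n^{ -- }(m)$ ($1\le m\le n$) is obtained from $Q_n^-$ by deleting $v$ and $m$ neighbors of $v$. $\mathcal{Q}^-=\{Q_n^{ -*},Q_n^{ -- }(m)\mid n\ge 4,\ 1\le m\le n\}$. Sign vectors: $E$ a finite nonempty set, $\emptyset\neq\mathcal L\subseteq\{+,-,0\}^E$. For $X,Y$: $S(X,Y)=\{e: X_eY_e=-\}$; $(X\circ Y)_e=X_e$ if $X_e\ne 0$, else $Y_e$; $(-X)_e=-X_e$. (FS): $X\circ -Y\in\mathcal L$ for all $X,Y\in\mathcal L$. (SE): for all $X,Y\in\mathcal L$ and $e\in S(X,Y)$ there is $Z\in\mathcal L$ with $Z_e=0$ and $Z_f=(X\circ Y)_f$ for all $f\in E\setminus S(X,Y)$. $(E,\mathcal L)$ is a COM (complex of oriented matroids) if it satisfies (FS) and (SE). It is simple if for each $e$, $\{X_e: X\in\mathcal L\}=\{+,-,0\}$, and for each $e\ne f$ there are $X,Y\in\mathcal L$ with $\{X_eX_f,Y_eY_f\}=\{+,-\}$. The topes are $\mathcal T=\mathcal L\cap\{+,-\}^E$; the tope graph of a simple system is the subgraph of the hypercube on $\{+,-\}^E$ induced by $\mathcal T$; the tope graph of a non-simple system is that of its simplification (delete coordinates violating the first simplicity condition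 and all but one coordinate from each class of mutually parallel coordinates). $\mathcal G_{\rm COM}$ is the class of graphs isomorphic to tope graphs of COMs. -}

module Defs where

open import Data.Fin.Base using (Fin)
open import Data.List.Base using (List)
open import Data.List.Relation.Unary.All using (All)
open import Data.List.Relation.Unary.AllPairs using (AllPairs)
open import Data.Maybe.Base as Maybe using (Maybe; just; nothing; _<∣>_)
open import Data.Nat.Base using (ℕ; zero; suc; _+_; _≤_)
open import Data.Product.Base using (Σ; ∃; ∃-syntax; _×_; _,_)
open import Data.Product using (∃!)
open import Data.Refinement.Base using (Refinement-syntax; value)
open import Data.Sign.Base using (Sign; opposite) renaming (+ to plus; - to minus; _*_ to _*ₛ_)
open import Data.Sum.Base using (_⊎_; inj₁; inj₂)
open import Data.Vec.Base using (Vec; lookup; map; zipWith; tabulate)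
open import Data.Vec.Membership.Propositional using (_∉_)
import Data.Vec.Relation.Unary.All as VecAll
open import Data.Vec.Relation.Unary.Unique.Propositional using (Unique)
open import Function.Base using (_∘_)
open import Function.Bundles using (_⇔_; _↔_; Inverse)
open import Level using (Level; 0ℓ; _⊔_) renaming (suc to lsuc)
open import Relation.Binary.Construct.Closure.ReflexiveTransitive using (Star; ε; _◅_)
open import Relation.Binary.Core using (Rel)
open import Relation.Binary.Definitions using (Symmetric; Irreflexive)
open import Relation.Binary.PropositionalEquality using (_≡_; _≢_; refl; ≢-sym)
open import Relation.Nullary.Negation using (¬_)
open import Relation.Unary using (Pred; Decidable; _∈_; _⊆_; _≐_)

------------------------------------------------------------------------
-- Graphs

record Graph : Set₁ where
  infix 4 _~_
  field
    Vertex : Set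
    _~_    : Rel Vertex 0ℓ
    ~-sym  : Symmetric _~_
    ~-irr  : Irreflexive _≡_ _~_

open Graph using (Vertex)

Finite : Graph → Set
Finite G = ∃[ n ] (Vertex G ↔ Fin n)

Nonempty : Graph → Set
Nonempty G = Vertex G

infix 4 _≅_

record _≅_ (G H : Graph) : Set where
  private
    module G = Graph G
    module H = Graph H
  field
    bijection : G.Vertex ↔ H.Vertex
  open Inverse bijection public using (to; from)
  field
    adjacency : ∀ {x y} → (x G.~ y) ⇔ (to x H.~ to y)

-- The subgraph induced by a vertex set.  The membership proof of a vertex is
-- irrelevant, so each vertex of G gives rise to at most one vertex of G [ P ].

_[_] : (G : Graph) → Pred (Vertex G) 0ℓ → Graph
G [ P ] = record
  { Vertex = [ x ∈ G.Vertex ∣ P x ]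
  ; _~_    = λ x y → value x G.~ value y
  ; ~-sym  = G.~-sym
  ; ~-irr  = λ { refl → G.~-irr refl }
  }
  where module G = Graph G

------------------------------------------------------------------------
-- Distances, convexity, gates, antipodes

module Metric (G : Graph) where
  open Graph G public using (_~_)

  private
    V : Set
    V = Vertex G

  Walk : Rel V 0ℓ
  Walk = Star _~_

  length : ∀ {x y} → Walk x y → ℕ
  length ε       = 0
  length (_ ◅ p) = suc (length p)

  infix 4 _On_

  _On_ : ∀ {x y} → V → Walk x y → Set
  _On_ {x} z ε       = z ≡ x
  _On_ {x} z (_ ◅ p) = z ≡ x ⊎ z On p

  -- A walk of minimal length does not repeat vertices, so these are exactly
  -- the shortest paths.

  Shortest : ∀ {x y} → Walk x y → Set
  Shortest {x} {y} p = (q : Walk x y) → length p ≤ length q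

  Dist : V → V → ℕ → Set
  Dist x y k = Σ (Walk x y) λ p → Shortest p × length p ≡ k

  -- Convex, gated and antipodal subgraphs are all induced subgraphs, so they
  -- are represented by their vertex sets.

  Convex : Pred V 0ℓ → Set
  Convex C = ∀ {x y} → x ∈ C → y ∈ C →
             (p : Walk x y) → Shortest p → ∀ {z} → z On p → z ∈ C

  record IsConvexHull (S C : Pred V 0ℓ) : Set₁ where
    field
      convex   : Convex C
      contains : S ⊆ C
      smallest : (D : Pred V 0ℓ) → Convex D → S ⊆ D → C ⊆ D

  IsAntipode : Pred V 0ℓ → V → V → Set₁
  IsAntipode H x y = y ∈ H × IsConvexHull (λ z → z ≡ x ⊎ z ≡ y) H

  -- Subgraphs are nonempty; the empty vertex set would be vacuously antipodal
  -- but not gated.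

  record Antipodal (H : Pred V 0ℓ) : Set₁ where
    field
      nonempty : ∃[ x ] x ∈ H
      antipode : ∀ {x} → x ∈ H → ∃[ y ] IsAntipode H x y

  Gated : Pred V 0ℓ → Set
  Gated H = ∀ x → ∃[ x′ ] (x′ ∈ H ×
            (∀ {y} → y ∈ H → Σ (Walk x y) λ p → Shortest p × x′ On p))

------------------------------------------------------------------------
-- Hypercubes and partial cubes

-- Adjacent vertices differ in exactly one coordinate.

Q : ℕ → Graph
Q n = record
  { Vertex = Vec Sign n
  ; _~_    = λ x y → ∃! _≡_ λ i → lookup x i ≢ lookup y i
  ; ~-sym  = λ { (i , x≢y , uniq) → i , ≢-sym x≢y , λ y≢x → uniq (≢-sym y≢x) }
  ; ~-irr  = λ { refl (_ , x≢x , _) → x≢x refl }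
  }

-- An isometric map into Q n is an isomorphism onto an isometric subgraph.

IsPartialCube : Graph → Set
IsPartialCube G =
  ∃[ n ] Σ (Vertex G → Vertex (Q n)) λ φ →
    ∀ x y k → Metric.Dist G x y k ⇔ Metric.Dist (Q n) (φ x) (φ y) k

AG : Graph → Set₁
AG G = IsPartialCube G × (∀ H → Antipodal H → Gated H)
  where open Metric G

------------------------------------------------------------------------
-- Θ-classes, halfspaces, pc-minors

module Theta (G : Graph) where
  open Metric G

  -- Edges carry an orientation, which the Θ-relation ignores but which
  -- selects one of the two halfspaces.

  record Edge : Set where
    constructor edge
    field
      {tail head} : Vertex G
      adjacent    : tail ~ head

  -- xy Θ uv  iff  d(x,u) + d(y,v) ≠ d(x,v) + d(y,u).

  infix 4 _Θ_

  _Θ_ : Rel Edge 0ℓ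
  edge {x} {y} _ Θ edge {u} {v} _ =
    ∃[ a ] ∃[ b ] ∃[ c ] ∃[ d ]
      (Dist x u a × Dist y v b × Dist x v c × Dist y u d × a + b ≢ c + d)

  InClass NotInClass : Edge → Rel (Vertex G) 0ℓ
  InClass    f x y = Σ (x ~ y) λ e → f Θ edge e
  NotInClass f x y = Σ (x ~ y) λ e → ¬ (f Θ edge e)

  -- The component of the tail of f in G minus the edges of the class of f.
  -- The complementary halfspace belongs to the reversed edge.

  Halfspace : Edge → Pred (Vertex G) 0ℓ
  Halfspace f x = Star (NotInClass f) (Edge.tail f) x

  Intersection : List Edge → Pred (Vertex G) 0ℓ
  Intersection fs x = All (λ f → x ∈ Halfspace f) fs

  IsRestriction : Graph → Set
  IsRestriction H =
    ∃[ fs ] (AllPairs (λ f g → ¬ (f Θ g)) fs × H ≅ G [ Intersection fs ])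

  -- H is, up to isomorphism, the quotient graph of G in which the endpoints
  -- of every edge in the class of f are identified and loops are dropped.

  record IsContraction (f : Edge) (H : Graph) : Set where
    module H = Graph H
    field
      π          : Vertex G → H.Vertex
      surjective : ∀ a → ∃[ x ] π x ≡ a
      identifies : ∀ {x y} → (π x ≡ π y) ⇔ Star (InClass f) x y
      adjacency  : ∀ {a b} → (a H.~ b) ⇔
                   (a ≢ b × ∃[ x ] ∃[ y ] (π x ≡ a × π y ≡ b × x ~ y))

PcStep : Graph → Graph → Set
PcStep G H = IsRestriction H ⊎ ∃[ f ] IsContraction f H
  where open Theta G

PcMinor : Graph → Graph → Set₁
PcMinor G H = Star PcStep G H

𝓕 : Pred Graph 0ℓ → Pred Graph (lsuc 0ℓ)
𝓕 𝓧 G = IsPartialCube G ×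
        (∀ X → X ∈ 𝓧 → ¬ (∃[ H ] (PcMinor G H × H ≅ X)))

------------------------------------------------------------------------
-- The family 𝓠⁻

-_ : ∀ {n} → Vec Sign n → Vec Sign n
- v = map opposite v

Q⁻* : ∀ n → (v u : Vertex (Q n)) → Graph
Q⁻* n v u = Q n [ (λ x → x ≢ - v × x ≢ u) ]

Q⁻⁻ : ∀ n {m} → (v : Vertex (Q n)) → Vec (Vertex (Q n)) m → Graph
Q⁻⁻ n v us = Q n [ (λ x → x ≢ - v × x ≢ v × x ∉ us) ]

-- All choices of v and of the deleted neighbours are included; for fixed n
-- (and m) the resulting graphs are isomorphic.

data 𝓠⁻ : Pred Graph 0ℓ where
  q⁻* : ∀ {n} → 4 ≤ n → (v u : Vertex (Q n)) → Graph._~_ (Q n) v u →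
        𝓠⁻ (Q⁻* n v u)
  q⁻⁻ : ∀ {n m} → 4 ≤ n → 1 ≤ m → m ≤ n →
        (v : Vertex (Q n)) (us : Vec (Vertex (Q n)) m) →
        Unique us → VecAll.All (Graph._~_ (Q n) v) us →
        𝓠⁻ (Q⁻⁻ n v us)

------------------------------------------------------------------------
-- Complexes of oriented matroids

-- The signs +, -, 0 are just plus, just minus, nothing.

SignVector : ℕ → Set
SignVector n = Vec (Maybe Sign) n

infixl 7 _·_

_·_ : Maybe Sign → Maybe Sign → Maybe Sign
_·_ = Maybe.zipWith _*ₛ_

neg : ∀ {n} → SignVector n → SignVector n
neg = map (Maybe.map opposite)

infixl 6 _⊙_

-- Composition: _<∣>_ returns its first argument unless that is nothing.

_⊙_ : ∀ {n} → SignVector n → SignVector n → SignVector n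
_⊙_ = zipWith _<∣>_

Sep : ∀ {n} → SignVector n → SignVector n → Pred (Fin n) 0ℓ
Sep X Y e = lookup X e · lookup Y e ≡ just minus

record IsCOM {n} (L : Pred (SignVector n) 0ℓ) : Set where
  field
    nonempty : ∃[ X ] X ∈ L
    FS : ∀ {X Y} → X ∈ L → Y ∈ L → X ⊙ neg Y ∈ L
    SE : ∀ {X Y} → X ∈ L → Y ∈ L → ∀ {e} → e ∈ Sep X Y →
         ∃[ Z ] (Z ∈ L × lookup Z e ≡ nothing ×
                 (∀ {f} → ¬ (f ∈ Sep X Y) → lookup Z f ≡ lookup (X ⊙ Y) f))

module _ {n} (L : Pred (SignVector n) 0ℓ) where

  -- The two simplicity conditions, for one and for two coordinates.

  TakesAllSigns : Pred (Fin n) 0ℓ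
  TakesAllSigns e = ∀ s → ∃[ X ] (X ∈ L × lookup X e ≡ s)

  NonParallel : Rel (Fin n) 0ℓ
  NonParallel e f = ∃[ X ] ∃[ Y ] (X ∈ L × Y ∈ L ×
    lookup X e · lookup X f ≡ just plus × lookup Y e · lookup Y f ≡ just minus)

  -- A choice ι of the coordinates surviving simplification: one from each
  -- parallel class of coordinates satisfying the first simplicity condition.
  -- No coordinate is NonParallel to itself, so ι is injective.

  record Representatives (m : ℕ) : Set where
    field
      ι        : Fin m → Fin n
      allSigns : ∀ i → TakesAllSigns (ι i)
      distinct : ∀ {i j} → i ≢ j → NonParallel (ι i) (ι j)
      complete : ∀ {e} → TakesAllSigns e → ∃[ i ] ¬ NonParallel (ι i) e

  simplification : ∀ {m} → Representatives m → Pred (SignVector m) 0ℓ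
  simplification R Y = ∃[ X ] (X ∈ L × Y ≡ tabulate (lookup X ∘ ι))
    where open Representatives R

-- Vertices of Q n are the sign vectors without zeros.

topeGraph : ∀ {n} → Pred (SignVector n) 0ℓ → Graph
topeGraph {n} L = Q n [ (λ T → map just T ∈ L) ]

-- Different choices of representatives give isomorphic tope graphs, and for a
-- simple system all coordinates are representatives.

𝓖-COM : Graph → Set₁
𝓖-COM G =
  ∃[ n ] Σ (Pred (SignVector (suc n)) 0ℓ) λ L →
    Decidable L × IsCOM L ×
    (∃[ m ] Σ (Representatives L m) λ R → G ≅ topeGraph (simplification L R))

-- An isometric embedding turns a partial cube into a set 𝒯 of sign vectors (topes).  Its antipodal
-- subgraphs are the faces {T ∈ 𝒯 ∣ X ≼ T} closed under flipping all zero coordinates of X, and such a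
-- face is gated iff X ▷ T ∈ 𝒯 for all T ∈ 𝒯.
--
-- In a COM every symmetric face comes from a covector, and composing with it is the gate map.
-- Conversely, for 𝒯 in AG take as covectors all X with X ▷ T, X ▷ - T ∈ 𝒯.  Face symmetry is immediate.
-- Strong elimination between X and Y goes by induction on the number of free coordinates: if X and Y
-- agree on one, restrict to it; otherwise eliminate in the contractions, whose covectors lift back
-- unless the whole contraction is symmetric.  If all contractions are symmetric, then 𝒯 is symmetric or
-- a cube without one vertex.  The induction also shows that AG is closed under contraction.
--
-- If 𝒯 is not in AG but all its proper minors are, a non-gated antipodal subgraph is a halfspace, and
-- contracting each of its coordinates shows that it is a cube without an antipodal pair; gatedness in
-- the restrictions then determines the other halfspace up to neighbours of one vertex.  So 𝒯 is in 𝓠⁻.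
-- The members of 𝓠⁻ in turn have a facet that is antipodal but not gated.

module Submission where

open import Defs
open import Data.Empty using (⊥; ⊥-elim)
open import Data.Fin.Base using (Fin; zero; suc)
import Data.Fin.Properties as Fin
open import Data.Irrelevant using () renaming ([_] to irr)
open import Data.List.Base using (List; []; _∷_)
open import Data.List.Relation.Unary.All as All using (All; []; _∷_)
open import Data.List.Relation.Unary.AllPairs using ([]; _∷_)
open import Data.Maybe.Base as Maybe using (Maybe; just; nothing; fromMaybe; _<∣>_)
import Data.Maybe.Properties as Maybe
open import Data.Maybe.Properties using (just-injective)
open import Data.Nat.Base using (ℕ; zero; suc; _+_; _≤_; _<_; z≤n; s≤s)
open import Data.Nat.Induction using (<-wellFounded)
import Data.Nat.Properties as ℕ
open import Data.Nat.Solver using (module +-*-Solver)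
open import Data.Product.Base using (Σ; ∃; ∃-syntax; _×_; _,_; proj₁; proj₂)
open import Data.Refinement.Base using (value; _,_)
open import Data.Refinement.Properties using (value-injective)
open import Data.Sign.Base using (Sign; opposite) renaming (+ to plus; - to minus; _*_ to _*ₛ_)
import Data.Sign.Properties as Sign
open import Data.Sum.Base as Sum using (_⊎_; inj₁; inj₂)
open import Data.Unit.Base using (⊤; tt)
open import Data.Vec.Base using (Vec; []; _∷_; map; zipWith; tabulate; replicate; _[_]≔_; _[_]%=_) renaming (lookup to infixl 9 _!_)
import Data.Vec.Membership.DecPropositional as DecMembership
open import Data.Vec.Membership.Propositional using (_∉_) renaming (_∈_ to _∈ᵥ_)
open import Data.Vec.Membership.Propositional.Properties using (∈-lookup; ∈-tabulate⁺)
open import Data.Vec.Properties using (≡-dec; lookup-zipWith; lookup-map; lookup-replicate; lookup∘tabulate; lookup∘update; lookup∘update′; lookup∘updateAt; lookup∘updateAt′; tabulate∘lookup; tabulate-cong; updateAt-commutes; ∷-injectiveʳ)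
import Data.Vec.Relation.Unary.All as VecAll
import Data.Vec.Relation.Unary.All.Properties as VecAll
import Data.Vec.Relation.Unary.AllPairs as VecAllPairs
import Data.Vec.Relation.Unary.Any as VecAny
import Data.Vec.Relation.Unary.Any.Properties as VecAny
open import Data.Vec.Relation.Unary.Unique.Propositional using (Unique)
import Data.Vec.Relation.Unary.Unique.Propositional.Properties as Unique
open import Function.Base using (_∘_)
open import Function.Bundles using (_⇔_; mk⇔; mk↔ₛ′; Equivalence; Inverse)
open import Induction.WellFounded using (Acc; acc)
open import Level using (0ℓ)
open import Relation.Binary.Construct.Closure.ReflexiveTransitive using (Star; ε; _◅_; _◅◅_)
open import Relation.Binary.PropositionalEquality hiding ([_])
open import Relation.Nullary.Decidable using (Dec; yes; no; map′; _×-dec_; ¬?; decidable-stable; recompute)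
open import Relation.Nullary.Negation using (¬_; contradiction)
open import Relation.Unary using (Pred; Decidable; _∩_)
open Graph using (Vertex)

-- Sign vectors

-- The obstacle in strong elimination is circularity: by `lift`, symmetric faces of a contraction
-- come from covectors of 𝒯 once 𝒯 has strong elimination. The way out is that a sign vector with a
-- nonzero entry at a free coordinate f lives on one side of f, a restriction with fewer free
-- coordinates, and covectors of a convex side are covectors of 𝒯. Only a vector that vanishes on
-- all free coordinates but the contracted one has no such f, and its symmetry is that of the whole
-- contraction. So eliminating in a contraction yields a covector of 𝒯 or `SymmetricUpTo`, and the
-- case analysis collects the latter for every coordinate. The bound n ≥ 4 arises because a cube
-- without an antipodal pair is nonempty and connected only from dimension three on, and one more
-- coordinate leads from this cube to the vertex without a gate. Restrictions and contractions stay
-- in the same `Vec Sign n`, with the fixed coordinates recorded in c, so that the two inductions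
-- never reindex.

≢⇒opposite : ∀ {s t} → s ≢ t → t ≡ opposite s
≢⇒opposite {plus}  {plus}  s≢t = contradiction refl s≢t
≢⇒opposite {plus}  {minus} s≢t = refl
≢⇒opposite {minus} {plus}  s≢t = refl
≢⇒opposite {minus} {minus} s≢t = contradiction refl s≢t

opposite≢ : ∀ {s} → opposite s ≢ s
opposite≢ {plus}  ()
opposite≢ {minus} ()

opposite-involutive : ∀ s → opposite (opposite s) ≡ s
opposite-involutive plus  = refl
opposite-involutive minus = refl

opposite-pair : ∀ {r s t} → r ≢ s → r ≢ t → s ≡ t
opposite-pair r≢s r≢t = trans (≢⇒opposite r≢s) (sym (≢⇒opposite r≢t))

lookup-ext : ∀ {A : Set} {n} {u v : Vec A n} → (∀ i → u ! i ≡ v ! i) → u ≡ v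
lookup-ext {u = u} {v} eq =
  trans (sym (tabulate∘lookup u)) (trans (tabulate-cong eq) (tabulate∘lookup v))

differ : ∀ {n} {S T : Vec Sign n} → S ≢ T → ∃[ i ] S ! i ≢ T ! i
differ {n} {S} {T} S≢T = Fin.¬∀⟶∃¬ n _ (λ i → S ! i Sign.≟ T ! i) (S≢T ∘ lookup-ext)

infix 4 _≟ᵛ_
_≟ᵛ_ : ∀ {n} (S T : Vec Sign n) → Dec (S ≡ T)
_≟ᵛ_ = ≡-dec Sign._≟_

flip : ∀ {n} → Fin n → Vec Sign n → Vec Sign n
flip i T = T [ i ]%= opposite

flip-≡ : ∀ {n} (i : Fin n) T → flip i T ! i ≡ opposite (T ! i)
flip-≡ i T = lookup∘updateAt i T

flip-≢ : ∀ {n} {i j : Fin n} → j ≢ i → ∀ T → flip i T ! j ≡ T ! j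
flip-≢ j≢i T = lookup∘updateAt′ _ _ j≢i T

flip-involutive : ∀ {n} (i : Fin n) T → flip i (flip i T) ≡ T
flip-involutive zero    (s ∷ T) = cong (_∷ T) (opposite-involutive s)
flip-involutive (suc i) (s ∷ T) = cong (s ∷_) (flip-involutive i T)

≡-or-flip : ∀ {n} {g : Fin n} {S T} → (∀ i → i ≢ g → S ! i ≡ T ! i) → S ≡ T ⊎ S ≡ flip g T
≡-or-flip {g = g} {S} {T} off with S ! g Sign.≟ T ! g
... | yes eq = inj₁ (lookup-ext at)
  where
  at : ∀ i → S ! i ≡ T ! i
  at i with i Fin.≟ g
  ... | yes refl = eq
  ... | no  i≢g  = off i i≢g
... | no  ≢  = inj₂ (lookup-ext at)
  where
  at : ∀ i → S ! i ≡ flip g T ! i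
  at i with i Fin.≟ g
  ... | yes refl = trans (≢⇒opposite (≢ ∘ sym)) (sym (flip-≡ g T))
  ... | no  i≢g  = trans (off i i≢g) (sym (flip-≢ i≢g T))

infixr 6 _▷_

-- The composition X ∘ T with a tope has no zeros, so it is typed as a tope. It is the vertex of the
-- cube face of X nearest to T, the only candidate for a gate; for T in the face, `X ▷ - T` is the
-- antipode of T in it.
_▷_ : ∀ {n} → SignVector n → Vec Sign n → Vec Sign n
_▷_ = zipWith (λ x t → fromMaybe t x)

▷-⊙ : ∀ {n} (X Y : SignVector n) T → (X ⊙ Y) ▷ T ≡ X ▷ Y ▷ T
▷-⊙ []             []      []      = refl
▷-⊙ (just x ∷ X)  (y ∷ Y) (t ∷ T) = cong (x ∷_) (▷-⊙ X Y T)
▷-⊙ (nothing ∷ X) (y ∷ Y) (t ∷ T) = cong (_ ∷_) (▷-⊙ X Y T)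

▷-neg : ∀ {n} (X : SignVector n) T → neg X ▷ - T ≡ - (X ▷ T)
▷-neg []            []      = refl
▷-neg (just x ∷ X)  (t ∷ T) = cong (_ ∷_) (▷-neg X T)
▷-neg (nothing ∷ X) (t ∷ T) = cong (_ ∷_) (▷-neg X T)

-‿involutive : ∀ {n} (T : Vec Sign n) → - - T ≡ T
-‿involutive []      = refl
-‿involutive (t ∷ T) = cong₂ _∷_ (opposite-involutive t) (-‿involutive T)

▷-neg▷ : ∀ {n} (X Y : SignVector n) T → (X ⊙ neg Y) ▷ T ≡ X ▷ - (Y ▷ - T)
▷-neg▷ X Y T = begin
  (X ⊙ neg Y) ▷ T      ≡⟨ ▷-⊙ X (neg Y) T ⟩
  X ▷ neg Y ▷ T        ≡⟨ cong (λ U → X ▷ neg Y ▷ U) (-‿involutive T) ⟨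
  X ▷ neg Y ▷ - - T    ≡⟨ cong (X ▷_) (▷-neg Y (- T)) ⟩
  X ▷ - (Y ▷ - T)      ∎
  where open ≡-Reasoning

▷-neg▷- : ∀ {n} (X Y : SignVector n) T → (X ⊙ neg Y) ▷ - T ≡ X ▷ - (Y ▷ T)
▷-neg▷- X Y T = trans (▷-⊙ X (neg Y) (- T)) (cong (X ▷_) (▷-neg Y T))

▷-idem- : ∀ {n} (X : SignVector n) T → X ▷ - (X ▷ T) ≡ X ▷ - T
▷-idem- []            []      = refl
▷-idem- (just x ∷ X)  (t ∷ T) = cong (_ ∷_) (▷-idem- X T)
▷-idem- (nothing ∷ X) (t ∷ T) = cong (_ ∷_) (▷-idem- X T)

▷-involutive : ∀ {n} (X : SignVector n) T → X ▷ - (X ▷ - T) ≡ X ▷ T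
▷-involutive X T = trans (▷-idem- X (- T)) (cong (X ▷_) (-‿involutive T))

map-just-▷ : ∀ {n} (X : SignVector n) T → map just (X ▷ T) ≡ X ⊙ map just T
map-just-▷ []            []      = refl
map-just-▷ (just x ∷ X)  (t ∷ T) = cong (_ ∷_) (map-just-▷ X T)
map-just-▷ (nothing ∷ X) (t ∷ T) = cong (_ ∷_) (map-just-▷ X T)

neg-map-just : ∀ {n} (T : Vec Sign n) → neg (map just T) ≡ map just (- T)
neg-map-just []      = refl
neg-map-just (t ∷ T) = cong (_ ∷_) (neg-map-just T)

⊙-neg-⊙-neg : ∀ {n} (X Y : SignVector n) → X ⊙ neg (X ⊙ neg Y) ≡ X ⊙ Y
⊙-neg-⊙-neg []            []             = refl
⊙-neg-⊙-neg (just x ∷ X)  (y ∷ Y)        = cong (_ ∷_) (⊙-neg-⊙-neg X Y)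
⊙-neg-⊙-neg (nothing ∷ X) (nothing ∷ Y)  = cong (_ ∷_) (⊙-neg-⊙-neg X Y)
⊙-neg-⊙-neg (nothing ∷ X) (just y ∷ Y)   =
  cong₂ _∷_ (cong just (opposite-involutive y)) (⊙-neg-⊙-neg X Y)

▷-just : ∀ {n} (X : SignVector n) {T i s} → X ! i ≡ just s → (X ▷ T) ! i ≡ s
▷-just X {T} {i} eq = trans (lookup-zipWith _ i X T) (cong (fromMaybe (T ! i)) eq)

▷-nothing : ∀ {n} (X : SignVector n) {T i} → X ! i ≡ nothing → (X ▷ T) ! i ≡ T ! i
▷-nothing X {T} {i} eq = trans (lookup-zipWith _ i X T) (cong (fromMaybe (T ! i)) eq)

⊙-just : ∀ {n} (X Y : SignVector n) {i s} → X ! i ≡ just s → (X ⊙ Y) ! i ≡ just s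
⊙-just X Y {i} eq = trans (lookup-zipWith _ i X Y) (cong (_<∣> (Y ! i)) eq)

⊙-nothing : ∀ {n} (X Y : SignVector n) {i} → X ! i ≡ nothing → (X ⊙ Y) ! i ≡ Y ! i
⊙-nothing X Y {i} eq = trans (lookup-zipWith _ i X Y) (cong (_<∣> (Y ! i)) eq)

neg-just : ∀ {n} (X : SignVector n) {i s} → X ! i ≡ just s → neg X ! i ≡ just (opposite s)
neg-just X {i} eq = trans (lookup-map i _ X) (cong (Maybe.map opposite) eq)

neg-nothing : ∀ {n} (X : SignVector n) {i} → X ! i ≡ nothing → neg X ! i ≡ nothing
neg-nothing X {i} eq = trans (lookup-map i _ X) (cong (Maybe.map opposite) eq)

lookup-- : ∀ {n} (T : Vec Sign n) i → (- T) ! i ≡ opposite (T ! i)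
lookup-- T i = lookup-map i opposite T

zero? : ∀ {n} (X : SignVector n) i → X ! i ≡ nothing ⊎ ∃[ s ] X ! i ≡ just s
zero? X i with X ! i
... | nothing = inj₁ refl
... | just s  = inj₂ (s , refl)

nothing≢just : ∀ {s : Sign} {m : Maybe Sign} → m ≡ nothing → m ≡ just s → ⊥
nothing≢just refl ()

≢nothing : ∀ {m : Maybe Sign} → m ≢ nothing → ∃[ s ] m ≡ just s
≢nothing {nothing} m≢ = contradiction refl m≢
≢nothing {just s}  _  = s , refl

just≢nothing : ∀ {s : Sign} {m : Maybe Sign} → m ≡ just s → m ≢ nothing
just≢nothing p q = nothing≢just q p

is-nothing? : (m : Maybe Sign) → Dec (m ≡ nothing)
is-nothing? nothing  = yes refl
is-nothing? (just _) = no λ ()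

-- X ≼ T: the tope T lies in the face of X.

infix 4 _≼_

_≼_ : ∀ {n} → SignVector n → Vec Sign n → Set
X ≼ T = ∀ {i s} → X ! i ≡ just s → T ! i ≡ s

≼-▷ : ∀ {n} (X : SignVector n) T → X ≼ X ▷ T
≼-▷ X T = ▷-just X

≼⇒▷≡ : ∀ {n} (X : SignVector n) {T} → X ≼ T → X ▷ T ≡ T
≼⇒▷≡ X {T} X≼T = lookup-ext at
  where
  at : ∀ i → (X ▷ T) ! i ≡ T ! i
  at i with zero? X i
  ... | inj₁ eq       = ▷-nothing X eq
  ... | inj₂ (s , eq) = trans (▷-just X eq) (sym (X≼T eq))

Sep-intro : ∀ {n} {X Y : SignVector n} {e s} →
            X ! e ≡ just s → Y ! e ≡ just (opposite s) → Sep X Y e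
Sep-intro {s = plus}  p q rewrite p | q = refl
Sep-intro {s = minus} p q rewrite p | q = refl

Sep-elim : ∀ {n} (X Y : SignVector n) {e} → Sep X Y e →
           ∃[ s ] (X ! e ≡ just s × Y ! e ≡ just (opposite s))
Sep-elim X Y {e} sep with X ! e | Y ! e
... | just plus  | just minus = plus  , refl , refl
... | just minus | just plus  = minus , refl , refl

¬Sep-nothingˡ : ∀ {n} (X Y : SignVector n) {e} → X ! e ≡ nothing → ¬ Sep X Y e
¬Sep-nothingˡ X Y eq sep with Sep-elim X Y sep
... | _ , p , _ = nothing≢just eq p

¬Sep-nothingʳ : ∀ {n} (X Y : SignVector n) {e} → Y ! e ≡ nothing → ¬ Sep X Y e
¬Sep-nothingʳ X Y eq sep with Sep-elim X Y sep
... | _ , _ , q = nothing≢just eq q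

¬Sep-≡ : ∀ {n} (X Y : SignVector n) {e} → X ! e ≡ Y ! e → ¬ Sep X Y e
¬Sep-≡ X Y eq sep with Sep-elim X Y sep
... | s , p , q = opposite≢ (just-injective (trans (sym q) (trans (sym eq) p)))

⊙-zero : ∀ {n} (X Y : SignVector n) {i} → (X ⊙ Y) ! i ≡ nothing → X ! i ≡ nothing × Y ! i ≡ nothing
⊙-zero X Y {i} eq with zero? X i
... | inj₁ p       = p , trans (sym (⊙-nothing X Y p)) eq
... | inj₂ (_ , p) = contradiction (⊙-just X Y p) (nothing≢just eq)

⊙-idem : ∀ {n} (X Y : SignVector n) {i} → X ! i ≡ Y ! i → (X ⊙ Y) ! i ≡ X ! i
⊙-idem X Y {i} eq with zero? X i
... | inj₁ p       = trans (⊙-nothing X Y p) (sym eq)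
... | inj₂ (_ , p) = trans (⊙-just X Y p) (sym p)

⊙-comm : ∀ {n} (X Y : SignVector n) {i} → ¬ Sep X Y i → (X ⊙ Y) ! i ≡ (Y ⊙ X) ! i
⊙-comm X Y {i} ¬sep with zero? X i | zero? Y i
... | inj₁ p       | inj₁ q       = trans (⊙-nothing X Y p) (trans q (sym (trans (⊙-nothing Y X q) p)))
... | inj₁ p       | inj₂ (_ , q) = trans (⊙-nothing X Y p) (trans q (sym (⊙-just Y X q)))
... | inj₂ (_ , p) | inj₁ q       = trans (⊙-just X Y p) (sym (trans (⊙-nothing Y X q) p))
... | inj₂ (r , p) | inj₂ (t , q) with r Sign.≟ t
... | yes refl = trans (⊙-just X Y p) (sym (⊙-just Y X q))
... | no r≢t   = contradiction (Sep-intro {X = X} {Y} p (trans q (cong just (≢⇒opposite r≢t)))) ¬sep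

-- Hamming distance and number of zeros

ham : ∀ {n} → Vec Sign n → Vec Sign n → ℕ
ham []      []      = 0
ham (s ∷ S) (t ∷ T) with s Sign.≟ t
... | yes _ = ham S T
... | no  _ = suc (ham S T)

ham-refl : ∀ {n} (T : Vec Sign n) → ham T T ≡ 0
ham-refl []      = refl
ham-refl (t ∷ T) with t Sign.≟ t
... | yes _  = ham-refl T
... | no t≢t = contradiction refl t≢t

ham≡0 : ∀ {n} (S T : Vec Sign n) → ham S T ≡ 0 → S ≡ T
ham≡0 []      []      _  = refl
ham≡0 (s ∷ S) (t ∷ T) eq with s Sign.≟ t
... | yes refl = cong (s ∷_) (ham≡0 S T eq)

ham-mono-≤ : ∀ {n} (S T U : Vec Sign n) → (∀ i → S ! i ≡ T ! i → S ! i ≡ U ! i) →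
             ham S U ≤ ham S T
ham-mono-≤ []      []      []      _ = z≤n
ham-mono-≤ (s ∷ S) (t ∷ T) (u ∷ U) h with s Sign.≟ t | s Sign.≟ u | ham-mono-≤ S T U (h ∘ suc)
... | yes p | no q  | _  = contradiction (h zero p) q
... | yes p | yes q | le = le
... | no p  | yes q | le = ℕ.m≤n⇒m≤1+n le
... | no p  | no q  | le = s≤s le

ham-mono-< : ∀ {n} (S T U : Vec Sign n) → (∀ i → S ! i ≡ T ! i → S ! i ≡ U ! i) →
             ∀ j → S ! j ≢ T ! j → S ! j ≡ U ! j → ham S U < ham S T
ham-mono-< (s ∷ S) (t ∷ T) (u ∷ U) h zero p q with s Sign.≟ t | s Sign.≟ u
... | yes s≡t | _      = contradiction s≡t p
... | no _    | no s≢u = contradiction q s≢u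
... | no _    | yes _  = s≤s (ham-mono-≤ S T U (h ∘ suc))
ham-mono-< (s ∷ S) (t ∷ T) (u ∷ U) h (suc j) p q
  with s Sign.≟ t | s Sign.≟ u | ham-mono-< S T U (h ∘ suc) j p q
... | yes a | no b  | _  = contradiction (h zero a) b
... | yes a | yes b | lt = lt
... | no a  | yes b | lt = ℕ.m≤n⇒m≤1+n lt
... | no a  | no b  | lt = s≤s lt

ham-flip : ∀ {n} (i : Fin n) (S T : Vec Sign n) → S ! i ≢ T ! i → suc (ham (flip i S) T) ≡ ham S T
ham-flip zero (s ∷ S) (t ∷ T) s≢t with s Sign.≟ t | opposite s Sign.≟ t
... | yes eq | _     = contradiction eq s≢t
... | no _   | yes _ = refl
... | no _   | no ≢  = contradiction (sym (≢⇒opposite s≢t)) ≢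
ham-flip (suc i) (s ∷ S) (t ∷ T) ≢ with s Sign.≟ t
... | yes _ = ham-flip i S T ≢
... | no _  = cong suc (ham-flip i S T ≢)

ham-flip′ : ∀ {n} (i : Fin n) (S T : Vec Sign n) → S ! i ≡ T ! i → ham (flip i S) T ≡ suc (ham S T)
ham-flip′ i S T eq = sym (subst (λ U → suc (ham U T) ≡ ham (flip i S) T) (flip-involutive i S)
  (ham-flip i (flip i S) T λ eq′ → opposite≢ (trans (sym (flip-≡ i S)) (trans eq′ (sym eq)))))

zeros : ∀ {n} → SignVector n → ℕ
zeros []            = 0
zeros (nothing ∷ X) = suc (zeros X)
zeros (just _ ∷ X)  = zeros X

zeros-mono-≤ : ∀ {n} (X Y : SignVector n) → (∀ i → X ! i ≡ nothing → Y ! i ≡ nothing) →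
               zeros X ≤ zeros Y
zeros-mono-≤ []            []            _ = z≤n
zeros-mono-≤ (nothing ∷ X) (nothing ∷ Y) h = s≤s (zeros-mono-≤ X Y (h ∘ suc))
zeros-mono-≤ (nothing ∷ X) (just _ ∷ Y)  h = contradiction (h zero refl) λ ()
zeros-mono-≤ (just _ ∷ X)  (nothing ∷ Y) h = ℕ.m≤n⇒m≤1+n (zeros-mono-≤ X Y (h ∘ suc))
zeros-mono-≤ (just _ ∷ X)  (just _ ∷ Y)  h = zeros-mono-≤ X Y (h ∘ suc)

zeros-mono-< : ∀ {n} (X Y : SignVector n) → (∀ i → X ! i ≡ nothing → Y ! i ≡ nothing) →
               ∀ j → X ! j ≢ nothing → Y ! j ≡ nothing → zeros X < zeros Y
zeros-mono-< (nothing ∷ X) (y ∷ Y)       h zero    p q = contradiction refl p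
zeros-mono-< (just _ ∷ X)  (nothing ∷ Y) h zero    p q = s≤s (zeros-mono-≤ X Y (h ∘ suc))
zeros-mono-< (nothing ∷ X) (nothing ∷ Y) h (suc j) p q = s≤s (zeros-mono-< X Y (h ∘ suc) j p q)
zeros-mono-< (nothing ∷ X) (just _ ∷ Y)  h (suc j) p q = contradiction (h zero refl) λ ()
zeros-mono-< (just _ ∷ X)  (nothing ∷ Y) h (suc j) p q = ℕ.m≤n⇒m≤1+n (zeros-mono-< X Y (h ∘ suc) j p q)
zeros-mono-< (just _ ∷ X)  (just _ ∷ Y)  h (suc j) p q = zeros-mono-< X Y (h ∘ suc) j p q

-- Finite search over vectors

module _ {A : Set} (search : ∀ {P : Pred A 0ℓ} → Decidable P → Dec (∃ P)) where

  anyVec? : ∀ {n} {P : Pred (Vec A n) 0ℓ} → Decidable P → Dec (∃ P)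
  anyVec? {zero} P? with P? []
  ... | yes p = yes ([] , p)
  ... | no ¬p = no λ { ([] , p) → ¬p p }
  anyVec? {suc n} P? with search (λ a → anyVec? (λ v → P? (a ∷ v)))
  ... | yes (a , v , p) = yes (a ∷ v , p)
  ... | no ¬p           = no λ { (a ∷ v , p) → ¬p (a , v , p) }

anySign? : ∀ {P : Pred Sign 0ℓ} → Decidable P → Dec (∃ P)
anySign? P? with P? plus | P? minus
... | yes p | _     = yes (plus , p)
... | no _  | yes p = yes (minus , p)
... | no ¬p | no ¬q = no λ { (plus , p) → ¬p p ; (minus , q) → ¬q q }

anyMaybeSign? : ∀ {P : Pred (Maybe Sign) 0ℓ} → Decidable P → Dec (∃ P)
anyMaybeSign? P? with P? nothing | anySign? (P? ∘ just)
... | yes p | _           = yes (nothing , p)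
... | no _  | yes (s , p) = yes (just s , p)
... | no ¬p | no ¬q       = no λ { (nothing , p) → ¬p p ; (just s , p) → ¬q (s , p) }

anyTope? : ∀ {n} {P : Pred (Vec Sign n) 0ℓ} → Decidable P → Dec (∃ P)
anyTope? = anyVec? anySign?

anySignVector? : ∀ {n} {P : Pred (SignVector n) 0ℓ} → Decidable P → Dec (∃ P)
anySignVector? = anyVec? anyMaybeSign?

-- Strong elimination

Eliminates : ∀ {n} → Pred (SignVector n) 0ℓ → SignVector n → SignVector n → Fin n → Set
Eliminates L X Y e =
  ∃[ Z ] (L Z × Z ! e ≡ nothing × (∀ {f} → ¬ Sep X Y f → Z ! f ≡ (X ⊙ Y) ! f))

SE : ∀ {n} → Pred (SignVector n) 0ℓ → Set
SE L = ∀ {X Y} → L X → L Y → ∀ {e} → Sep X Y e → Eliminates L X Y e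

FS : ∀ {n} → Pred (SignVector n) 0ℓ → Set
FS L = ∀ {X Y} → L X → L Y → L (X ⊙ neg Y)

-- (FS) used twice: X ∘ -(X ∘ -Y) = X ∘ Y, since the inner composition shows -Y on the zeros of X.
FS⇒⊙ : ∀ {n} {L : Pred (SignVector n) 0ℓ} → FS L → ∀ {X Y} → L X → L Y → L (X ⊙ Y)
FS⇒⊙ {L = L} fs {X} {Y} x y = subst L (⊙-neg-⊙-neg X Y) (fs x (fs x y))

-- The vector X ⊙ neg Z on the support of Z ≥ X has a smaller symmetric fibre, so
-- it lies in L by induction; eliminating between it and Z enlarges the zero set of Z.

module SymmetricFibre {n} {L : Pred (SignVector n) 0ℓ} (fs : FS L) (se : SE L) where

  private
    Claim : SignVector n → Set
    Claim X = ∀ {T₀} → L (map just T₀) → X ≼ T₀ →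
              (∀ T → L (map just T) → X ≼ T → L (map just (X ▷ - T))) → L X

    tope-▷ : ∀ {Z T} → L Z → L (map just T) → L (map just (Z ▷ T))
    tope-▷ {Z} {T} z t = subst L (sym (map-just-▷ Z T)) (FS⇒⊙ {L = L} fs z t)

    step : ∀ X → (∀ Y → zeros Y < zeros X → Claim Y) → Claim X
    step X rec {T₀} t₀ X≼T₀ flips = descend {zeros X} (map just T₀) (ℕ.m≤m+n (zeros X) _) t₀
      (λ {i} {s} p → trans (lookup-map i just T₀) (cong just (X≼T₀ p)))
      where
      -- m bounds the number of zeros that Z still lacks. Each elimination adds at least one, and at
      -- m = 0 a coordinate where X is zero and Z is not would contradict the bound.
      descend : ∀ {m} Z → zeros X ≤ m + zeros Z → L Z →
                (∀ {i s} → X ! i ≡ just s → Z ! i ≡ just s) → L X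
      descend {m} Z bound z X≤Z
        with Fin.any? (λ i → is-nothing? (X ! i) ×-dec ¬? (is-nothing? (Z ! i)))
      ... | no none = subst L (lookup-ext at) z
        where
        at : ∀ i → Z ! i ≡ X ! i
        at i with zero? X i | zero? Z i
        ... | inj₂ (s , p) | _            = trans (X≤Z p) (sym p)
        ... | inj₁ p       | inj₁ q       = trans q (sym p)
        ... | inj₁ p       | inj₂ (s , q) =
          contradiction (i , p , just≢nothing q) none
      ... | yes (e , p , q) with ≢nothing q
      ... | s , Ze = smaller m bound
        where
        X′ : SignVector n
        X′ = X ⊙ neg Z
        X′e : X′ ! e ≡ just (opposite s)
        X′e = trans (⊙-nothing X (neg Z) p) (neg-just Z Ze)
        fewer : zeros X′ < zeros X
        fewer = zeros-mono-< X′ X (λ i r → proj₁ (⊙-zero X (neg Z) r)) e (just≢nothing X′e) p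
        X≼Z▷ : ∀ T → X ≼ Z ▷ T
        X≼Z▷ T r = ▷-just Z (X≤Z r)
        -- By `▷-neg▷-`, flipping T with `X′` is the same as flipping `Z ▷ T` with X, so the
        -- symmetry of X passes to `X′`; T₀ treated in this way gives the required tope in the face.
        x′ : L X′
        x′ = rec X′ fewer (flips (Z ▷ T₀) (tope-▷ z t₀) (X≼Z▷ T₀))
          (subst (X′ ≼_) (▷-neg▷- X Z T₀) (≼-▷ X′ (- T₀)))
          (λ T t _ → subst (L ∘ map just) (sym (▷-neg▷- X Z T))
            (flips (Z ▷ T) (tope-▷ z t) (X≼Z▷ T)))
        smaller : ∀ m → zeros X ≤ m + zeros Z → L X
        smaller m bound with se z x′ (Sep-intro {X = Z} {X′} Ze X′e)
        ... | W , w , We , W-off = next m bound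
          where
          more : zeros Z < zeros W
          more = zeros-mono-< Z W zero-kept e q We
            where
            zero-kept : ∀ i → Z ! i ≡ nothing → W ! i ≡ nothing
            zero-kept i r with zero? X i
            ... | inj₂ (_ , a) = contradiction (X≤Z a) (nothing≢just r)
            ... | inj₁ a = trans (W-off (¬Sep-nothingˡ Z X′ r))
              (trans (⊙-nothing Z X′ r) (trans (⊙-nothing X (neg Z) a) (neg-nothing Z r)))
          X≤W : ∀ {i s} → X ! i ≡ just s → W ! i ≡ just s
          X≤W {i} r = trans
            (W-off (¬Sep-≡ Z X′ (trans (X≤Z r) (sym (⊙-just X (neg Z) r)))))
            (⊙-just Z X′ (X≤Z r))
          next : ∀ m → zeros X ≤ m + zeros Z → L X
          next zero    b = contradiction
            (zeros-mono-< Z X (λ i r → kept i r) e q p) (ℕ.≤⇒≯ b)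
            where
            kept : ∀ i → Z ! i ≡ nothing → X ! i ≡ nothing
            kept i r with zero? X i
            ... | inj₁ a       = a
            ... | inj₂ (_ , a) = contradiction (X≤Z a) (nothing≢just r)
          next (suc m) b = descend {m} W
            (ℕ.≤-trans b (ℕ.≤-trans (ℕ.≤-reflexive (sym (ℕ.+-suc m (zeros Z)))) (ℕ.+-monoʳ-≤ m more)))
            w X≤W

    go : ∀ X → Acc _<_ (zeros X) → Claim X
    go X (acc rs) = step X (λ Y lt → go Y (rs lt))

  symmetric-fibre : ∀ {X T₀} → L (map just T₀) → X ≼ T₀ →
    (∀ T → L (map just T) → X ≼ T → L (map just (X ▷ - T))) → L X
  symmetric-fibre {X} = go X (<-wellFounded (zeros X))

-- Covectors of a set of topes

Topes : ℕ → Set₁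
Topes n = Pred (Vec Sign n) 0ℓ

Cov : ∀ {n} → Topes n → Pred (SignVector n) 0ℓ
Cov 𝒯 X = ∀ T → 𝒯 T → 𝒯 (X ▷ T) × 𝒯 (X ▷ - T)

-- `point` makes the face nonempty: an empty face is vacuously closed under flips but contains no
-- gate.
record Symmetric {n} (𝒯 : Topes n) (X : SignVector n) : Set where
  constructor symmetric
  field
    {point} : Vec Sign n
    point∈  : 𝒯 point
    point≽  : X ≼ point
    flips   : ∀ {T} → 𝒯 T → X ≼ T → 𝒯 (X ▷ - T)

Gating : ∀ {n} → Topes n → Set
Gating 𝒯 = ∀ {X} → Symmetric 𝒯 X → ∀ {T} → 𝒯 T → 𝒯 (X ▷ T)

-- Gate T into the face, then flip it there: X ▷ -(X ▷ T) = X ▷ -T. With `cov⇒symmetric`, covectors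
-- and symmetric faces of a nonempty gated 𝒯 coincide.
symmetric⇒cov : ∀ {n} {𝒯 : Topes n} → Gating 𝒯 → ∀ {X} → Symmetric 𝒯 X → Cov 𝒯 X
symmetric⇒cov {𝒯 = 𝒯} gate {X} sym-X T t =
  gate sym-X t , subst 𝒯 (▷-idem- X T) (Symmetric.flips sym-X (gate sym-X t) (≼-▷ X T))

cov⇒symmetric : ∀ {n} {𝒯 : Topes n} {X T} → Cov 𝒯 X → 𝒯 T → Symmetric 𝒯 X
cov⇒symmetric {X = X} {T} x t =
  symmetric (proj₁ (x T t)) (≼-▷ X T) (λ {T} t _ → proj₂ (x T t))

cov-FS : ∀ {n} {𝒯 : Topes n} → FS (Cov 𝒯)
cov-FS {𝒯 = 𝒯} {X} {Y} x y T t =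
  subst 𝒯 (sym (▷-neg▷ X Y T)) (proj₂ (x _ (proj₂ (y T t)))) ,
  subst 𝒯 (sym (▷-neg▷- X Y T)) (proj₂ (x _ (proj₁ (y T t))))

cov-⊙ : ∀ {n} {𝒯 : Topes n} {X Y} → Cov 𝒯 X → Cov 𝒯 Y → Cov 𝒯 (X ⊙ Y)
cov-⊙ {𝒯 = 𝒯} = FS⇒⊙ {L = Cov 𝒯} (cov-FS {𝒯 = 𝒯})

map-just▷ : ∀ {n} (S T : Vec Sign n) → map just S ▷ T ≡ S
map-just▷ []      []      = refl
map-just▷ (s ∷ S) (t ∷ T) = cong (s ∷_) (map-just▷ S T)

cov-tope : ∀ {n} {𝒯 : Topes n} {S} → 𝒯 S → Cov 𝒯 (map just S)
cov-tope {𝒯 = 𝒯} {S} s T _ =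
  subst 𝒯 (sym (map-just▷ S T)) s , subst 𝒯 (sym (map-just▷ S (- T))) s

-- If X vanished at g, flipping a tope of the face would change its constant sign there.
symmetric-constant : ∀ {n} {𝒯 : Topes n} {X g s} → (∀ {T} → 𝒯 T → T ! g ≡ s) →
                     Symmetric 𝒯 X → X ! g ≡ just s
symmetric-constant {X = X} {g} {s} const (symmetric {T} t X≼T fl) with zero? X g
... | inj₂ (r , eq) = trans eq (cong just (trans (sym (X≼T eq)) (const t)))
... | inj₁ eq = contradiction
  (trans (sym (lookup-- T g)) (trans (sym (▷-nothing X eq)) (trans (const (fl t X≼T)) (sym (const t)))))
  opposite≢

-- Restriction to a convex set

-- The interval of S and T in the cube; `BetweenClosed` is thus convexity in the cube, written
-- coordinatewise.
Between : ∀ {n} → Vec Sign n → Vec Sign n → Vec Sign n → Set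
Between S T U = ∀ i → S ! i ≡ T ! i → U ! i ≡ S ! i

BetweenClosed : ∀ {n} → Topes n → Set
BetweenClosed C = ∀ S T U → C S → C T → Between S T U → C U

At : ∀ {n} → Fin n → Sign → Topes n
At f s T = T ! f ≡ s

At-closed : ∀ {n} {f : Fin n} {s} → BetweenClosed (At f s)
At-closed {f = f} _ _ _ S≡ T≡ btw = trans (btw f (trans S≡ (sym T≡))) S≡

between-face : ∀ {n} (X : SignVector n) {T U} → X ≼ T → X ≼ U → Between T (X ▷ - T) U
between-face X {T} X≼T X≼U i eq with zero? X i
... | inj₁ p       = contradiction (trans (sym (lookup-- T i)) (trans (sym (▷-nothing X p)) (sym eq))) opposite≢
... | inj₂ (s , p) = trans (X≼U p) (sym (X≼T p))

-- The face of X is the interval between T₀ and its antipode. Both lie in the convex C, hence so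
-- does the whole face, and restricting to C removes none of its topes.
symmetric-∩ : ∀ {n} {𝒯 C : Topes n} → BetweenClosed C → ∀ {X} → Symmetric (𝒯 ∩ C) X → Symmetric 𝒯 X
symmetric-∩ {𝒯 = 𝒯} {C} bc {X} (symmetric {T₀} (t₀ , c₀) X≼T₀ fl) = symmetric t₀ X≼T₀ flips
  where
  flips : ∀ {T} → 𝒯 T → X ≼ T → 𝒯 (X ▷ - T)
  flips {T} t X≼T = proj₁ (fl (t , bc T₀ (X ▷ - T₀) T c₀ (proj₂ (fl (t₀ , c₀) X≼T₀)) btw) X≼T)
    where
    btw : Between T₀ (X ▷ - T₀) T
    btw = between-face X {T₀} {T} X≼T₀ X≼T

gating-∩ : ∀ {n} {𝒯 C : Topes n} → BetweenClosed C → Gating 𝒯 → Gating (𝒯 ∩ C)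
gating-∩ bc gate {X} sym-X@(symmetric {T₀} (t₀ , c₀) X≼T₀ fl) {T} (t , _) =
  gate (symmetric-∩ bc sym-X) t ,
  bc T₀ (X ▷ - T₀) (X ▷ T) c₀ (proj₂ (fl (t₀ , c₀) X≼T₀)) (between-face X {T₀} {X ▷ T} X≼T₀ (≼-▷ X T))

cov-At : ∀ {n} {𝒯 : Topes n} {X f s} → X ! f ≡ just s → Cov 𝒯 X → Cov (𝒯 ∩ At f s) X
cov-At {X = X} eq x T (t , _) = (proj₁ (x T t) , ▷-just X eq) , (proj₂ (x T t) , ▷-just X eq)

-- The way back from an elimination carried out in a restriction: the face of the covector is
-- symmetric in 𝒯 as well, and gating in 𝒯 turns it into a covector.
cov-∩ : ∀ {n} {𝒯 C : Topes n} → Gating 𝒯 → BetweenClosed C → ∀ {X T} → (𝒯 ∩ C) T →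
        Cov (𝒯 ∩ C) X → Cov 𝒯 X
cov-∩ gate bc t x = symmetric⇒cov gate (symmetric-∩ bc (cov⇒symmetric x t))

-- Contraction of the coordinate g, which is kept with the constant value plus

Con : ∀ {n} → Fin n → Topes n → Topes n
Con g 𝒯 T = ∃[ S ] (𝒯 S × S [ g ]≔ plus ≡ T)

Con-intro : ∀ {n} {g : Fin n} {𝒯 S} → 𝒯 S → Con g 𝒯 (S [ g ]≔ plus)
Con-intro {S = S} s = S , s , refl

Con-plus : ∀ {n} {g : Fin n} {𝒯 T} → Con g 𝒯 T → T ! g ≡ plus
Con-plus {g = g} (S , _ , refl) = lookup∘update g S plus

Con-dec : ∀ {n} {g : Fin n} {𝒯 : Topes n} → Decidable 𝒯 → Decidable (Con g 𝒯)
Con-dec 𝒯? T = anyTope? (λ S → 𝒯? S ×-dec (_ ≟ᵛ _))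

AgreeOff : ∀ {A : Set} {n} → Fin n → Vec A n → Vec A n → Set
AgreeOff g u v = ∀ i → i ≢ g → u ! i ≡ v ! i

off-≔ : ∀ {A : Set} {n} (g : Fin n) (v : Vec A n) {a} → AgreeOff g (v [ g ]≔ a) v
off-≔ g v i i≢g = lookup∘update′ i≢g v _

≔-off : ∀ {n} {g : Fin n} (S T : Vec Sign n) → AgreeOff g S T → T ! g ≡ plus → S [ g ]≔ plus ≡ T
≔-off {g = g} S T off eq = lookup-ext at
  where
  at : ∀ i → (S [ g ]≔ plus) ! i ≡ T ! i
  at i with i Fin.≟ g
  ... | yes refl = trans (lookup∘update g S plus) (sym eq)
  ... | no  i≢g  = trans (off-≔ g S i i≢g) (off i i≢g)

▷-cong : ∀ {n} {X Y : SignVector n} {S T i} → X ! i ≡ Y ! i → S ! i ≡ T ! i → (X ▷ S) ! i ≡ (Y ▷ T) ! i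
▷-cong {X = X} {Y} {S} {T} {i} p q = trans (lookup-zipWith _ i X S)
  (trans (cong₂ (λ x t → fromMaybe t x) p q) (sym (lookup-zipWith _ i Y T)))

⊙-cong : ∀ {n} {X Y X′ Y′ : SignVector n} {i} → X ! i ≡ Y ! i → X′ ! i ≡ Y′ ! i →
         (X ⊙ X′) ! i ≡ (Y ⊙ Y′) ! i
⊙-cong {X = X} {Y} {X′} {Y′} {i} p q = trans (lookup-zipWith _ i X X′)
  (trans (cong₂ _<∣>_ p q) (sym (lookup-zipWith _ i Y Y′)))

neg-cong : ∀ {n} {X Y : SignVector n} {i} → X ! i ≡ Y ! i → neg X ! i ≡ neg Y ! i
neg-cong {X = X} {Y} {i} p = trans (lookup-map i _ X) (trans (cong (Maybe.map opposite) p) (sym (lookup-map i _ Y)))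

-‿cong : ∀ {n} {S T : Vec Sign n} {i} → S ! i ≡ T ! i → (- S) ! i ≡ (- T) ! i
-‿cong {S = S} {T} {i} p = trans (lookup-- S i) (trans (cong opposite p) (sym (lookup-- T i)))

▷-≔ : ∀ {n} {g : Fin n} (X Y : SignVector n) S T → AgreeOff g X Y → Y ! g ≡ just plus →
      AgreeOff g S T → (X ▷ S) [ g ]≔ plus ≡ Y ▷ T
▷-≔ X Y S T off Yg off′ =
  ≔-off (X ▷ S) (Y ▷ T) (λ i i≢g → ▷-cong {X = X} {Y} {S} {T} (off i i≢g) (off′ i i≢g)) (▷-just Y Yg)

-‿off : ∀ {n} {g : Fin n} (S T : Vec Sign n) → AgreeOff g S T → AgreeOff g (- S) (- T)
-‿off S T off i i≢g = -‿cong {S = S} {T} (off i i≢g)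

off-≔′ : ∀ {A : Set} {n} (g : Fin n) (v : Vec A n) {a} → AgreeOff g v (v [ g ]≔ a)
off-≔′ g v i i≢g = sym (off-≔ g v i i≢g)

cov-Con : ∀ {n} {g : Fin n} {𝒯 : Topes n} {X Y} → AgreeOff g X Y → Y ! g ≡ just plus → Cov 𝒯 X → Cov (Con g 𝒯) Y
cov-Con {g = g} {𝒯} {X} {Y} off Yg x _ (S , s , refl) =
  subst (Con g 𝒯) (▷-≔ X Y S _ off Yg S-off) (Con-intro {𝒯 = 𝒯} (proj₁ (x S s))) ,
  subst (Con g 𝒯) (▷-≔ X Y (- S) _ off Yg (-‿off S (S [ g ]≔ plus) S-off)) (Con-intro {𝒯 = 𝒯} (proj₂ (x S s)))
  where
  S-off : AgreeOff g S (S [ g ]≔ plus)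
  S-off = off-≔′ g S

module _ {n} {𝒯 : Topes n} (se : SE (Cov 𝒯)) (g : Fin n) where

  private
    L : Pred (SignVector n) 0ℓ
    L Y = Y ! g ≡ just plus × ∃[ W ] (Cov 𝒯 W × AgreeOff g W Y)

    L-FS : FS L
    L-FS {X} {Y} (Xg , V , v , offV) (Yg , W , w , offW) =
      ⊙-just X (neg Y) Xg , V ⊙ neg W , cov-FS {𝒯 = 𝒯} v w ,
      λ i i≢g → ⊙-cong {X = V} {X} {neg W} {neg Y} (offV i i≢g) (neg-cong {X = W} {Y} (offW i i≢g))

    L-SE : SE L
    L-SE {X} {Y} (Xg , V , v , offV) (Yg , W , w , offW) {e} sep with Sep-elim X Y sep
    ... | s , Xe , Ye with se v w (Sep-intro {X = V} {W} (trans (offV e e≢g) Xe) (trans (offW e e≢g) Ye))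
      where
      e≢g : e ≢ g
      e≢g refl = ¬Sep-≡ X Y (trans Xg (sym Yg)) sep
    ... | Z , z , Ze , Z-off = Z [ g ]≔ just plus ,
        (lookup∘update g Z _ , Z , z , off-≔′ g Z) ,
        trans (off-≔ g Z e e≢g) Ze , off
      where
      e≢g : e ≢ g
      e≢g refl = ¬Sep-≡ X Y (trans Xg (sym Yg)) sep
      off : ∀ {f} → ¬ Sep X Y f → (Z [ g ]≔ just plus) ! f ≡ (X ⊙ Y) ! f
      off {f} ¬sep with f Fin.≟ g
      ... | yes refl = trans (lookup∘update g Z _) (sym (⊙-just X Y Xg))
      ... | no  f≢g  = trans (off-≔ g Z f f≢g)
        (trans (Z-off (λ sep′ → ¬sep (trans (sym (cong₂ _·_ (offV f f≢g) (offW f f≢g))) sep′)))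
               (⊙-cong {X = V} {X} {W} {Y} (offV f f≢g) (offW f f≢g)))

    L-tope : ∀ {T} → Con g 𝒯 T → L (map just T)
    L-tope (S , s , refl) =
      trans (lookup-map g just (S [ g ]≔ plus)) (cong just (lookup∘update g S plus)) ,
      map just S , cov-tope {𝒯 = 𝒯} s ,
      λ i i≢g → trans (lookup-map i just S) (trans (cong just (off-≔′ g S i i≢g)) (sym (lookup-map i just (S [ g ]≔ plus))))

    tope-L : ∀ {T₀} → 𝒯 T₀ → ∀ {T} → L (map just T) → Con g 𝒯 T
    -- W has no zeros off g but may vanish at g, where T₀ supplies the sign.
    tope-L {T₀} t₀ {T} (Tg , W , w , off) = W ▷ T₀ , proj₁ (w T₀ t₀) ,
      ≔-off (W ▷ T₀) T (λ i i≢g → ▷-just W (trans (off i i≢g) (lookup-map i just T)))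
            (just-injective (trans (sym (lookup-map g just T)) Tg))

  -- `L` is the contraction of the covectors at g. It inherits (FS) and (SE), its members being
  -- never separated at g, and its topes are those of `Con g 𝒯`; hence `symmetric-fibre` puts every
  -- symmetric face of the contraction into it.
  lift : ∀ {X} → Symmetric (Con g 𝒯) X → ∃[ W ] (Cov 𝒯 W × AgreeOff g W X)
  lift {X} (symmetric {T₀} t₀@(_ , s₀ , _) X≼T₀ fl) = proj₂ (SymmetricFibre.symmetric-fibre {L = L}
    (λ {X} {Y} → L-FS {X} {Y}) (λ {X} {Y} → L-SE {X} {Y}) {X} {T₀} (L-tope t₀) X≼T₀
    (λ T t X≼T → L-tope (fl (tope-L s₀ {T} t) X≼T)))

-- Decidable tope sets over a base sign vector c.  Restrictions and contractions
-- enlarge the support of c, which is the measure of the inductions below.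

record System {n} (c : SignVector n) (𝒯 : Topes n) : Set where
  field
    dec  : Decidable 𝒯
    base : ∀ {T} → 𝒯 T → c ≼ T

symmetric-base : ∀ {n} {c : SignVector n} {𝒯 X} → System c 𝒯 → Symmetric 𝒯 X →
                 ∀ {i s} → c ! i ≡ just s → X ! i ≡ just s
symmetric-base {c = c} {𝒯} {X} sys (symmetric p X≼P flips) ci =
  symmetric-constant {𝒯 = 𝒯 ∩ (c ≼_)} (λ { (_ , c≼T) → c≼T ci })
    (symmetric (p , base p) X≼P (λ { (t , _) X≼T → flips t X≼T , base (flips t X≼T) }))
  where open System sys

zeros-≔ : ∀ {n} (c : SignVector n) {f} s → c ! f ≡ nothing → zeros (c [ f ]≔ just s) < zeros c
zeros-≔ c {f} s cf = zeros-mono-< (c [ f ]≔ just s) c kept f (just≢nothing (lookup∘update f c _)) cf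
  where
  kept : ∀ i → (c [ f ]≔ just s) ! i ≡ nothing → c ! i ≡ nothing
  kept i eq with i Fin.≟ f
  ... | yes refl = contradiction (lookup∘update f c _) (nothing≢just eq)
  ... | no  i≢f  = trans (sym (off-≔ f c i i≢f)) eq

≼-≔ : ∀ {n} (c : SignVector n) {f s T} → c ≼ T → T ! f ≡ s → (c [ f ]≔ just s) ≼ T
≼-≔ c {f} c≼T Tf {i} eq with i Fin.≟ f
... | yes refl = trans Tf (just-injective (trans (sym (lookup∘update f c _)) eq))
... | no  i≢f  = c≼T (trans (sym (off-≔ f c i i≢f)) eq)

≼-≔-≔ : ∀ {n} (X : SignVector n) g {T} → X ≼ T → (X [ g ]≔ just plus) ≼ (T [ g ]≔ plus)
≼-≔-≔ X g {T} X≼T {i} eq with i Fin.≟ g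
... | yes refl = trans (lookup∘update g T plus) (just-injective (trans (sym (lookup∘update g X _)) eq))
... | no  i≢g  = trans (off-≔ g T i i≢g) (X≼T (trans (off-≔′ g X i i≢g) eq))

system-At : ∀ {n} {c : SignVector n} {𝒯 f s} → System c 𝒯 → System (c [ f ]≔ just s) (𝒯 ∩ At f s)
system-At {c = c} {f = f} {s} sys = record
  { dec  = λ T → dec T ×-dec (T ! f Sign.≟ s)
  ; base = λ { {T} (t , Tf) → ≼-≔ c {T = T} (base t) Tf }
  } where open System sys

system-Con : ∀ {n} {c : SignVector n} {𝒯 g} → System c 𝒯 → System (c [ g ]≔ just plus) (Con g 𝒯)
system-Con {c = c} {𝒯} {g} sys = record
  { dec  = Con-dec dec
  ; base = base′
  }
  where
  open System sys
  base′ : ∀ {T} → Con g 𝒯 T → (c [ g ]≔ just plus) ≼ T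
  base′ (S , s , refl) = ≼-≔-≔ c g {S} (base s)

-- Faces spanned by two vertices of the cube

agree : ∀ {n} → Vec Sign n → Vec Sign n → SignVector n
agree = zipWith λ s t → if-same s t
  where
  if-same : Sign → Sign → Maybe Sign
  if-same s t with s Sign.≟ t
  ... | yes _ = just s
  ... | no  _ = nothing

agree-just : ∀ {n} (S T : Vec Sign n) {i} → S ! i ≡ T ! i → agree S T ! i ≡ just (S ! i)
agree-just (s ∷ S) (t ∷ T) {zero} eq with s Sign.≟ t
... | yes _ = refl
... | no ≢  = contradiction eq ≢
agree-just (s ∷ S) (t ∷ T) {suc i} eq = agree-just S T {i} eq

agree-nothing : ∀ {n} (S T : Vec Sign n) {i} → S ! i ≢ T ! i → agree S T ! i ≡ nothing
agree-nothing (s ∷ S) (t ∷ T) {zero} ≢ with s Sign.≟ t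
... | yes eq = contradiction eq ≢
... | no _   = refl
agree-nothing (s ∷ S) (t ∷ T) {suc i} ≢ = agree-nothing S T {i} ≢

agree-≼ : ∀ {n} (S T U : Vec Sign n) → Between S T U → agree S T ≼ U
agree-≼ S T U btw {i} eq with S ! i Sign.≟ T ! i
... | yes p = trans (btw i p) (just-injective (trans (sym (agree-just S T p)) eq))
... | no ¬p = contradiction eq (nothing≢just (agree-nothing S T ¬p))

≼-agree : ∀ {n} (S T U : Vec Sign n) → agree S T ≼ U → Between S T U
≼-agree S T U ≼U i eq = ≼U (agree-just S T eq)

agree-≼ˡ : ∀ {n} (S T : Vec Sign n) → agree S T ≼ S
agree-≼ˡ S T = agree-≼ S T S (λ _ _ → refl)

-- W copies U where U and V agree, and being different from V it shares a further sign with U. This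
-- is the decreasing measure in the arguments with a closest missing vertex.
agree-closer : ∀ {n} (U V W : Vec Sign n) → agree U V ≼ W → W ≢ V → ham U W < ham U V
agree-closer U V W Z≼W W≢V with differ W≢V
... | j , Wj≢Vj = ham-mono-< U V W (λ i eq → sym (Z≼W (agree-just U V eq))) j Uj≢Vj
  (trans (≢⇒opposite (Uj≢Vj ∘ sym)) (sym (≢⇒opposite (Wj≢Vj ∘ sym))))
  where
  Uj≢Vj : U ! j ≢ V ! j
  Uj≢Vj eq = Wj≢Vj (trans (Z≼W (agree-just U V eq)) eq)

agree-antipode : ∀ {n} (U V T : Vec Sign n) → agree U V ≼ T → agree U V ▷ - T ≡ U → T ≡ V
agree-antipode U V T Z≼T eq = lookup-ext at
  where
  at : ∀ i → T ! i ≡ V ! i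
  at i with U ! i Sign.≟ V ! i
  ... | yes p = trans (Z≼T (agree-just U V p)) p
  ... | no ≢  = opposite-pair {r = U ! i} (λ p → opposite≢ (trans (sym (lookup-- T i))
    (trans (sym (▷-nothing (agree U V) (agree-nothing U V ≢))) (trans (cong (_! i) eq) p)))) ≢

agree-comm : ∀ {n} (S T : Vec Sign n) → agree S T ≡ agree T S
agree-comm []      []      = refl
agree-comm (s ∷ S) (t ∷ T) with s Sign.≟ t | t Sign.≟ s | agree-comm S T
... | yes refl | yes _ | eq = cong (just s ∷_) eq
... | yes p    | no ≢  | _  = contradiction (sym p) ≢
... | no ≢     | yes p | _  = contradiction (sym p) ≢
... | no _     | no _  | eq = cong (nothing ∷_) eq

-- Flipping in the spanned face exchanges U and V, so the flip of a present tope is never one of the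
-- two missing vertices. P witnesses that the face is nonempty.
missing-pair-symmetric : ∀ {n} {𝒯 : Topes n} {U V P} → ¬ 𝒯 U → ¬ 𝒯 V → 𝒯 P → agree U V ≼ P →
  (∀ W → agree U V ≼ W → W ≢ U → W ≢ V → 𝒯 W) → Symmetric 𝒯 (agree U V)
missing-pair-symmetric {𝒯 = 𝒯} {U} {V} U∉ V∉ p Z≼P rest = symmetric p Z≼P
  (λ {T} t Z≼T → rest (agree U V ▷ - T) (≼-▷ (agree U V) (- T))
    (λ eq → V∉ (subst 𝒯 (agree-antipode U V T Z≼T eq) t))
    (λ eq → U∉ (subst 𝒯 (agree-antipode V U T (subst (_≼ T) (agree-comm U V) Z≼T)
                          (trans (cong (_▷ - T) (agree-comm V U)) eq)) t)))

agree-gate : ∀ {n} (U V : Vec Sign n) {m} → V ! m ≡ U ! m → agree U V ▷ flip m U ≡ U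
agree-gate U V {m} Vm = lookup-ext at
  where
  at : ∀ i → (agree U V ▷ flip m U) ! i ≡ U ! i
  at i with U ! i Sign.≟ V ! i
  ... | yes p = ≼-▷ (agree U V) (flip m U) (agree-just U V p)
  ... | no ≢  = trans (▷-nothing (agree U V) (agree-nothing U V ≢)) (flip-≢ (λ { refl → ≢ (sym Vm) }) U)

agree-≼-flip : ∀ {n} (U V : Vec Sign n) {i} → U ! i ≢ V ! i → agree U V ≼ flip i U
agree-≼-flip U V {i} ≢ = agree-≼ U V (flip i U) λ j eq → flip-≢ (λ { refl → ≢ eq }) U

≼-agree-≼ : ∀ {n} {c : SignVector n} (U V W : Vec Sign n) → c ≼ U → c ≼ V → agree U V ≼ W → c ≼ W
≼-agree-≼ U V W c≼U c≼V Z≼W eq = trans (Z≼W (agree-just U V (trans (c≼U eq) (sym (c≼V eq))))) (c≼U eq)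

-- A missing tope U all of whose neighbours are present: a second missing tope V closest
-- to U would make the face spanned by U and V symmetric, and the gate in it of any
-- neighbour of U outside that face would be U.

module _ {n} {c : SignVector n} {𝒯 : Topes n} (dec : Decidable 𝒯) (gate : Gating 𝒯)
         {U} (c≼U : c ≼ U) (U∉ : ¬ 𝒯 U) (nbrs : ∀ {g} → c ! g ≡ nothing → 𝒯 (flip g U)) where

  private
    go : ∀ V → Acc _<_ (ham U V) → c ≼ V → V ≢ U → ∀ {m} → c ! m ≡ nothing → V ! m ≡ U ! m → 𝒯 V
    go V (acc rs) c≼V V≢U {m} cm Vm with dec V
    ... | yes v = v
    ... | no V∉ with differ (V≢U ∘ sym)
    ... | a , Ua≢Va = contradiction (subst 𝒯 (agree-gate U V Vm) (gate face (nbrs cm))) U∉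
      where
      ca : c ! a ≡ nothing
      ca with zero? c a
      ... | inj₁ eq       = eq
      ... | inj₂ (s , eq) = contradiction (trans (c≼U eq) (sym (c≼V eq))) Ua≢Va
      face : Symmetric 𝒯 (agree U V)
      face = missing-pair-symmetric U∉ V∉ (nbrs ca) (agree-≼-flip U V Ua≢Va)
        (λ W Z≼W W≢U W≢V → go W (rs (agree-closer U V W Z≼W W≢V))
          (≼-agree-≼ {c = c} U V W c≼U c≼V Z≼W) W≢U cm (Z≼W (agree-just U V (sym Vm))))

  punctured-cube : ∀ {V} → c ≼ V → V ≢ U → ∀ {m} → c ! m ≡ nothing → V ! m ≡ U ! m → 𝒯 V
  punctured-cube {V} = go V (<-wellFounded (ham U V))

-- Strong elimination for covectors

sequence-⊎ : ∀ {n} {P : Fin n → Set} {Q : Set} → (∀ i → P i ⊎ Q) → (∀ i → P i) ⊎ Q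
sequence-⊎ {zero}  f = inj₁ λ ()
sequence-⊎ {suc n} f with f zero | sequence-⊎ (f ∘ suc)
... | inj₂ q | _      = inj₂ q
... | inj₁ _ | inj₂ q = inj₂ q
... | inj₁ p | inj₁ g = inj₁ λ { zero → p ; (suc i) → g i }

module Elimination {n} {c : SignVector n} {𝒯 : Topes n} (sys : System c 𝒯) (gate : Gating 𝒯)
  {T₀} (t₀ : 𝒯 T₀)
  (rec : ∀ {c′ : SignVector n} {𝒯′ : Topes n} {T₁} → zeros c′ < zeros c → System c′ 𝒯′ → Gating 𝒯′ → 𝒯′ T₁ → SE (Cov 𝒯′))
  where

  open System sys

  cov-base : ∀ {X i s} → Cov 𝒯 X → c ! i ≡ just s → X ! i ≡ just s
  cov-base x = symmetric-base sys (cov⇒symmetric x t₀)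

  zero-base : ∀ {X i} → Cov 𝒯 X → X ! i ≡ nothing → c ! i ≡ nothing
  zero-base {X} {i} x eq with zero? c i
  ... | inj₁ p       = p
  ... | inj₂ (s , p) = contradiction (cov-base {X} x p) (nothing≢just eq)

  se-At : ∀ {f s T₁} → c ! f ≡ nothing → (𝒯 ∩ At f s) T₁ → SE (Cov (𝒯 ∩ At f s))
  se-At {f} {s} cf t₁ = rec (zeros-≔ c s cf) (system-At sys) (gating-∩ At-closed gate) t₁

  se-agree : ∀ {X Y f s e} → Cov 𝒯 X → Cov 𝒯 Y → c ! f ≡ nothing →
             X ! f ≡ just s → Y ! f ≡ just s → Sep X Y e → Eliminates (Cov 𝒯) X Y e
  se-agree {X} {Y} {f} {s} x y cf Xf Yf sep
    with se-At cf (proj₁ (x T₀ t₀) , ▷-just X Xf)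
           (cov-At {𝒯 = 𝒯} {X} Xf x) (cov-At {𝒯 = 𝒯} {Y} Yf y) sep
  ... | Z , z , rest =
    Z , cov-∩ gate At-closed (proj₁ (x T₀ t₀) , ▷-just X Xf) z , rest

  -- Lifting in 𝒯 directly would presuppose (SE) for 𝒯, which is being proved. If X is nonzero at a
  -- free f ≠ g, the lift takes place on that side of f, where `rec` provides (SE), and `cov-∩`
  -- returns it to 𝒯.
  lift-off : ∀ {g X} → Symmetric (Con g 𝒯) X →
             ∃[ W ] (Cov 𝒯 W × AgreeOff g W X) ⊎ (∀ f → f ≢ g → c ! f ≡ nothing → X ! f ≡ nothing)
  lift-off {g} {X} sym-X@(symmetric (S₀ , s₀ , refl) X≼ fl)
    with Fin.any? (λ f → ¬? (f Fin.≟ g) ×-dec is-nothing? (c ! f) ×-dec ¬? (is-nothing? (X ! f)))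
  ... | no none = inj₂ central
    where
    central : ∀ f → f ≢ g → c ! f ≡ nothing → X ! f ≡ nothing
    central f f≢g cf with zero? X f
    ... | inj₁ p       = p
    ... | inj₂ (s , p) = contradiction (f , f≢g , cf , just≢nothing p) none
  ... | yes (f , f≢g , cf , Xf≢) with ≢nothing Xf≢
  ... | s , Xf with lift (se-At cf (s₀ , S₀f)) g {X} restricted
    where
    S₀f : S₀ ! f ≡ s
    S₀f = trans (off-≔′ g S₀ f f≢g) (X≼ Xf)
    restricted : Symmetric (Con g (𝒯 ∩ At f s)) X
    restricted = symmetric (S₀ , (s₀ , S₀f) , refl) X≼ flips
      where
      flips : ∀ {T} → Con g (𝒯 ∩ At f s) T → X ≼ T → Con g (𝒯 ∩ At f s) (X ▷ - T)
      flips (S , (s∈ , _) , refl) X≼T with fl (S , s∈ , refl) X≼T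
      ... | R , r∈ , eq = R , (r∈ , trans (off-≔′ g R f f≢g) (trans (cong (_! f) eq) (▷-just X Xf))) , eq
  ... | W , w , off = inj₁ (W , cov-∩ gate At-closed (s₀ , trans (off-≔′ g S₀ f f≢g) (X≼ Xf)) w , off)

  symmetric-plus : ∀ {g X} → Symmetric (Con g 𝒯) X → X ! g ≡ just plus
  symmetric-plus {g} {X} = symmetric-constant {X = X} (Con-plus {𝒯 = 𝒯})

  -- A lifted covector W gates S already in 𝒯. In the other case X fixes no free coordinate but g,
  -- so its face is the whole contraction and every tope is its own gate. Only with this can `rec`
  -- be applied to the contraction.
  gating-Con : ∀ {g} → Gating (Con g 𝒯)
  gating-Con {g} {X} sym-X@(symmetric {P} t X≼P _) (S , s , refl) with lift-off sym-X
  ... | inj₁ (W , w , off) = W ▷ S , proj₁ (w S s) ,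
    ▷-≔ W X S (S [ g ]≔ plus) off (symmetric-plus sym-X) (off-≔′ g S)
  ... | inj₂ central = S , s , sym (≼⇒▷≡ X below)
    where
    below : X ≼ S [ g ]≔ plus
    below {i} eq with i Fin.≟ g
    ... | yes refl = trans (lookup∘update g S plus) (just-injective (trans (sym (symmetric-plus sym-X)) eq))
    ... | no i≢g with zero? c i
    ... | inj₁ ci       = contradiction eq (nothing≢just (central i i≢g ci))
    ... | inj₂ (r , ci) = trans (off-≔ g S i i≢g) (trans (base s ci) (trans (sym P-base) (X≼P eq)))
      where
      P-base : P ! i ≡ r
      P-base = System.base (system-Con sys) t (trans (off-≔ g c i i≢g) ci)

  se-Con : ∀ {g} → c ! g ≡ nothing → SE (Cov (Con g 𝒯))
  se-Con cg = rec (zeros-≔ c plus cg) (system-Con sys) gating-Con (Con-intro {𝒯 = 𝒯} t₀)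

  -- Equivalently, the face c of the contraction of g is symmetric.

  SymmetricUpTo : Fin n → Set
  SymmetricUpTo g = ∀ T → 𝒯 T → 𝒯 (c ▷ - T) ⊎ 𝒯 (flip g (c ▷ - T))

  near-antipode : ∀ {g S T} → c ≼ S → (∀ i → i ≢ g → c ! i ≡ nothing → S ! i ≡ opposite (T ! i)) →
                  𝒯 S → 𝒯 (c ▷ - T) ⊎ 𝒯 (flip g (c ▷ - T))
  near-antipode {g} {S} {T} c≼S opp s with ≡-or-flip {g = g} {S} {c ▷ - T} at
    where
    at : ∀ i → i ≢ g → S ! i ≡ (c ▷ - T) ! i
    at i i≢g with zero? c i
    ... | inj₁ ci       = trans (opp i i≢g ci) (trans (sym (lookup-- T i)) (sym (▷-nothing c ci)))
    ... | inj₂ (r , ci) = trans (c≼S ci) (sym (▷-just c ci))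
  ... | inj₁ refl = inj₁ s
  ... | inj₂ refl = inj₂ s

  central⇒symmetric : ∀ {g Z} → Cov 𝒯 Z → (∀ f → f ≢ g → c ! f ≡ nothing → Z ! f ≡ nothing) →
                      SymmetricUpTo g
  central⇒symmetric {g} {Z} z central T t =
    near-antipode {g} {Z ▷ - T} {T} (base (proj₂ (z T t)))
      (λ i i≢g ci → trans (▷-nothing Z (central i i≢g ci)) (lookup-- T i)) (proj₂ (z T t))

  central-Con⇒symmetric : ∀ {g Z} → Cov (Con g 𝒯) Z →
    (∀ f → f ≢ g → c ! f ≡ nothing → Z ! f ≡ nothing) → SymmetricUpTo g
  central-Con⇒symmetric {g} {Z} z central T t with proj₂ (z _ (Con-intro {𝒯 = 𝒯} t))
  ... | S , s , eq = near-antipode {g} {S} {T} (base s) opp s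
    where
    opp : ∀ i → i ≢ g → c ! i ≡ nothing → S ! i ≡ opposite (T ! i)
    opp i i≢g ci = begin
      S ! i                            ≡⟨ off-≔′ g S i i≢g ⟩
      (S [ g ]≔ plus) ! i              ≡⟨ cong (_! i) eq ⟩
      (Z ▷ - (T [ g ]≔ plus)) ! i      ≡⟨ ▷-nothing Z (central i i≢g ci) ⟩
      (- (T [ g ]≔ plus)) ! i          ≡⟨ lookup-- (T [ g ]≔ plus) i ⟩
      opposite ((T [ g ]≔ plus) ! i)   ≡⟨ cong opposite (off-≔ g T i i≢g) ⟩
      opposite (T ! i)                 ∎
      where open ≡-Reasoning

  EliminatesOff : Fin n → SignVector n → SignVector n → Fin n → Set
  EliminatesOff g X Y h = ∃[ Z ] (Cov 𝒯 Z × Z ! h ≡ nothing ×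
    (∀ {f} → f ≢ g → ¬ Sep X Y f → Z ! f ≡ (X ⊙ Y) ! f))

  -- Elimination takes place in the contraction of g, and the result is lifted. The lift leaves the
  -- sign at g uncontrolled, hence `EliminatesOff`; it fails only if the result is central, and then
  -- the contraction is symmetric.
  se-off : ∀ {g h X Y} → c ! g ≡ nothing → h ≢ g → Cov 𝒯 X → Cov 𝒯 Y → Sep X Y h →
           SymmetricUpTo g ⊎ EliminatesOff g X Y h
  se-off {g} {h} {X} {Y} cg h≢g x y sep =
    finish (se-Con cg (con x) (con y) (trans (at h≢g) sep))
    where
    X′ Y′ : SignVector n
    X′ = X [ g ]≔ just plus
    Y′ = Y [ g ]≔ just plus
    con : ∀ {W} → Cov 𝒯 W → Cov (Con g 𝒯) (W [ g ]≔ just plus)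
    con {W} = cov-Con {𝒯 = 𝒯} {W} {W [ g ]≔ just plus} (off-≔′ g W) (lookup∘update g W _)
    at : ∀ {i} → i ≢ g → X′ ! i · Y′ ! i ≡ X ! i · Y ! i
    at i≢g = cong₂ _·_ (off-≔ g X _ i≢g) (off-≔ g Y _ i≢g)
    finish : Eliminates (Cov (Con g 𝒯)) X′ Y′ h → SymmetricUpTo g ⊎ EliminatesOff g X Y h
    finish (Z , z , Zh , Z-off) with lift-off {X = Z} (cov⇒symmetric z (Con-intro {𝒯 = 𝒯} t₀))
    ... | inj₂ central       = inj₁ (central-Con⇒symmetric {Z = Z} z central)
    ... | inj₁ (W , w , off) = inj₂ (W , w , trans (off h h≢g) Zh , λ {f} f≢g ¬sep →
      trans (off f f≢g) (trans (Z-off (λ s → ¬sep (trans (sym (at f≢g)) s)))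
        (⊙-cong {X = X′} {X} {Y′} {Y} (off-≔ g X f f≢g) (off-≔ g Y f f≢g))))

  -- Symmetry of the contraction of g persists when b is contracted too, so the double contraction
  -- is symmetric with centre `c₂`. The contractions are undone one at a time: g by (SE) in the
  -- contraction of b, then b by `lift-off`, whose exceptional case is symmetry up to b.
  two-coordinates : ∀ {g b} → c ! g ≡ nothing → c ! b ≡ nothing → SymmetricUpTo g →
    SymmetricUpTo b ⊎ ∃[ Z ] (Cov 𝒯 Z × (∀ f → f ≢ g → f ≢ b → c ! f ≡ nothing → Z ! f ≡ nothing))
  two-coordinates {g} {b} cg cb sym-g
    with lift (se-Con cb) g {c₂} sym-c₂
    where
    c₁ c₂ : SignVector n
    c₁ = c [ b ]≔ just plus
    c₂ = c₁ [ g ]≔ just plus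
    sys₂ : System c₂ (Con g (Con b 𝒯))
    sys₂ = system-Con (system-Con sys)
    sym-c₂ : Symmetric (Con g (Con b 𝒯)) c₂
    sym-c₂ = symmetric t₂ (System.base sys₂ t₂) flips
      where
      t₂ = Con-intro {𝒯 = Con b 𝒯} (Con-intro {𝒯 = 𝒯} t₀)
      flips : ∀ {T} → Con g (Con b 𝒯) T → c₂ ≼ T → Con g (Con b 𝒯) (c₂ ▷ - T)
      flips (_ , (S , s , refl) , refl) _ = Sum.[_,_]′ (lifted {c ▷ - S} (λ _ _ → refl))
        (lifted {flip g (c ▷ - S)} (λ i i≢g → flip-≢ i≢g (c ▷ - S))) (sym-g S s)
        where
        S₂ : Vec Sign n
        S₂ = (S [ b ]≔ plus) [ g ]≔ plus
        lifted : ∀ {R} → AgreeOff g R (c ▷ - S) → 𝒯 R → Con g (Con b 𝒯) (c₂ ▷ - S₂)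
        lifted {R} off r = R [ b ]≔ plus , (R , r , refl) ,
          ≔-off (R [ b ]≔ plus) (c₂ ▷ - S₂) at (▷-just c₂ (lookup∘update g c₁ _))
          where
          at : AgreeOff g (R [ b ]≔ plus) (c₂ ▷ - S₂)
          at i i≢g with i Fin.≟ b
          ... | yes refl = trans (lookup∘update b R plus)
            (sym (▷-just c₂ (trans (off-≔ g c₁ b i≢g) (lookup∘update b c _))))
          ... | no i≢b = trans (off-≔ b R i i≢b) (trans (off i i≢g)
            (▷-cong {X = c} {c₂} {S = - S} { - S₂}
              (trans (off-≔′ b c i i≢b) (off-≔′ g c₁ i i≢g))
              (-‿cong {S = S} {S₂}
                (trans (off-≔′ b S i i≢b) (off-≔′ g (S [ b ]≔ plus) i i≢g)))))
  ... | Z′ , z′ , off′ with lift-off {X = Z′} (cov⇒symmetric z′ (Con-intro {𝒯 = 𝒯} t₀))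
  ... | inj₂ central = inj₁ (central-Con⇒symmetric {Z = Z′} z′ central)
  ... | inj₁ (Z , z , off) = inj₂ (Z , z , λ f f≢g f≢b cf →
      trans (off f f≢b) (trans (off′ f f≢g) (trans (off-≔ g (c [ b ]≔ just plus) f f≢g) (trans (off-≔ b c f f≢b) cf))))

  -- X and Y have opposite signs on S and are zero elsewhere off c.  By se-agree they can be
  -- eliminated at every e ∈ S as soon as some covector Z ⊴ X has a zero in S.

  module Opposite {X Y} (x : Cov 𝒯 X) (y : Cov 𝒯 Y)
    (opp : ∀ i → c ! i ≡ nothing → (X ! i ≡ nothing × Y ! i ≡ nothing) ⊎
                                   ∃[ s ] (X ! i ≡ just s × Y ! i ≡ just (opposite s)))
    where

    InS : Fin n → Set
    InS i = c ! i ≡ nothing × X ! i ≢ nothing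

    InS? : ∀ i → Dec (InS i)
    InS? i = is-nothing? (c ! i) ×-dec ¬? (is-nothing? (X ! i))

    _⊴X : SignVector n → Set
    Z ⊴X = ∀ i → X ! i ≡ nothing → Z ! i ≡ nothing

    Goal : Set
    Goal = ∃[ Z ] (Cov 𝒯 Z × Z ⊴X × ∃[ h ] (InS h × Z ! h ≡ nothing))

    S≢B : ∀ {i b} → InS i → X ! b ≡ nothing → b ≢ i
    S≢B (_ , Xi≢) Xb refl = Xi≢ Xb

    Y⊴X : Y ⊴X
    Y⊴X i Xi with opp i (zero-base {X} x Xi)
    ... | inj₁ (_ , Yi)     = Yi
    ... | inj₂ (_ , Xi′ , _) = contradiction Xi′ (nothing≢just Xi)

    Y-full : ∀ {i} → InS i → Y ! i ≢ nothing
    Y-full {i} (ci , Xi≢) with opp i ci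
    ... | inj₁ (Xi , _)     = contradiction Xi Xi≢
    ... | inj₂ (_ , _ , Yi) = just≢nothing Yi

    with-sign : ∀ {i} → InS i → ∀ s →
                ∃[ W ] (Cov 𝒯 W × W ⊴X × W ! i ≡ just s × (∀ {j} → InS j → W ! j ≢ nothing))
    with-sign {i} (ci , Xi≢) s with opp i ci
    ... | inj₁ (Xi , _) = contradiction Xi Xi≢
    ... | inj₂ (r , Xi , Yi) with s Sign.≟ r
    ... | yes refl = X , x , (λ _ p → p) , Xi , proj₂
    ... | no s≢r   = Y , y , Y⊴X , trans Yi (cong just (sym (≢⇒opposite (s≢r ∘ sym)))) , Y-full

    separated : ∀ {i} → InS i → Sep X Y i
    separated {i} (ci , Xi≢) with opp i ci
    ... | inj₁ (Xi , _)      = contradiction Xi Xi≢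
    ... | inj₂ (s , Xi , Yi) = Sep-intro {X = X} {Y} Xi Yi

    reduce : ∀ {e} → InS e → Goal → Eliminates (Cov 𝒯) X Y e
    reduce {e} e∈ (Z , z , Z⊴ , h , h∈ , Zh) = by (zero? Z e)
      where
      finish : ∀ V → Cov 𝒯 V → V ⊴X → V ! e ≡ nothing → Eliminates (Cov 𝒯) X Y e
      finish V v V⊴ Ve = V , v , Ve , off
        where
        off : ∀ {f} → ¬ Sep X Y f → V ! f ≡ (X ⊙ Y) ! f
        off {f} ¬sep with zero? X f
        ... | inj₁ Xf = trans (V⊴ f Xf) (sym (trans (⊙-nothing X Y Xf) (Y⊴X f Xf)))
        ... | inj₂ (s , Xf) with zero? c f
        ... | inj₁ cf       = contradiction (separated (cf , just≢nothing Xf)) ¬sep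
        ... | inj₂ (r , cf) = trans (cov-base {V} v cf) (sym (⊙-just X Y (cov-base {X} x cf)))
      by : Z ! e ≡ nothing ⊎ ∃[ s ] Z ! e ≡ just s → Eliminates (Cov 𝒯) X Y e
      by (inj₁ Ze)       = finish Z z Z⊴ Ze
      by (inj₂ (s , Ze)) =
        -- W is whichever of X and Y is opposite to Z at e. As Z vanishes at h, the vectors Z ∘ W
        -- and W agree at h and can be eliminated on one side of h.
        let (W , w , W⊴ , We , W-full) = with-sign e∈ (opposite s)
            (r , Wh) = ≢nothing (W-full h∈)
            (V , v , Ve , off) = se-agree {Z ⊙ W} {W} (cov-⊙ {X = Z} {W} z w) w (proj₁ h∈)
              (trans (⊙-nothing Z W Zh) Wh) Wh (Sep-intro {X = Z ⊙ W} {W} (⊙-just Z W Ze) We)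
        in finish V v (λ i Xi → trans (off (¬Sep-nothingʳ (Z ⊙ W) W (W⊴ i Xi)))
             (trans (⊙-nothing (Z ⊙ W) W (trans (⊙-nothing Z W (Z⊴ i Xi)) (W⊴ i Xi))) (W⊴ i Xi))) Ve

    -- If S is just e, let W be whichever of X and Y has sign -T at e: then `W ▷ - T` is the full
    -- flip `c ▷ - T`, so c itself is a covector.
    singleton-goal : ∀ {e} → InS e → (∀ {i} → InS i → i ≡ e) → Goal
    singleton-goal {e} e∈ only = c , c-cov , (λ i → zero-base {X} x) , e , e∈ , proj₁ e∈
      where
      c-cov : Cov 𝒯 c
      c-cov T t with with-sign e∈ (opposite (T ! e))
      ... | W , w , W⊴ , We , _ =
        subst 𝒯 (sym (≼⇒▷≡ c (base t))) t , subst 𝒯 (lookup-ext at) (proj₂ (w T t))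
        where
        at : ∀ i → (W ▷ - T) ! i ≡ (c ▷ - T) ! i
        at i with zero? c i
        ... | inj₂ (s , ci) = trans (▷-just W (cov-base {W} w ci)) (sym (▷-just c ci))
        ... | inj₁ ci with zero? X i
        ... | inj₁ Xi = trans (▷-nothing W (W⊴ i Xi)) (sym (▷-nothing c ci))
        ... | inj₂ (_ , Xi) with only (ci , just≢nothing Xi)
        ... | refl = trans (▷-just W We) (sym (trans (▷-nothing c ci) (lookup-- T e)))

    -- The sign that `se-off` leaves open is at g ∈ S, whereas `Goal` constrains only the zeros of X
    -- and h.
    support-symmetric : ∀ {g h} → InS g → InS h → h ≢ g → SymmetricUpTo g ⊎ Goal
    support-symmetric {g} {h} g∈ h∈ h≢g with se-off {g} {h} {X} {Y} (proj₁ g∈) h≢g x y (separated h∈)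
    ... | inj₁ sym-g              = inj₁ sym-g
    ... | inj₂ (Z , z , Zh , off) = inj₂ (Z , z , Z⊴ , h , h∈ , Zh)
      where
      Z⊴ : Z ⊴X
      Z⊴ i Xi = trans (off (S≢B g∈ Xi) (¬Sep-nothingˡ X Y Xi)) (trans (⊙-nothing X Y Xi) (Y⊴X i Xi))

    -- For b outside S, the auxiliary covectors are supported, off c, on S and b. Combining two of
    -- them with opposite signs at b cancels b and leaves a covector below X, which proves `Goal` as
    -- soon as it has a zero in S.
    module ZeroCoordinate {b} (Xb : X ! b ≡ nothing)
                          (sym-S : ∀ {g} → InS g → SymmetricUpTo g) where

      cb : c ! b ≡ nothing
      cb = zero-base {X} x Xb

      record Near (τ : Sign) (Z : SignVector n) : Set where
        field
          cov    : Cov 𝒯 Z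
          sign-b : Z ! b ≡ just τ
          zero-B : ∀ {i} → i ≢ b → X ! i ≡ nothing → Z ! i ≡ nothing

      record Singleton (g : Fin n) : Set where
        field
          {σ τ}  : Sign
          {Z}    : SignVector n
          near   : Near τ Z
          sign-g : Z ! g ≡ just σ
          zero-S : ∀ {i} → i ≢ g → InS i → Z ! i ≡ nothing
        open Near near public

      -- `two-coordinates` yields Z with no nonzero free coordinates but g and b. If it vanishes at
      -- b, it is below X with a zero at h; if it vanishes at g, it is central up to b; otherwise
      -- both remain.
      singleton : ∀ {g h} → InS g → InS h → h ≢ g → SymmetricUpTo b ⊎ Goal ⊎ Singleton g
      singleton {g} {h} g∈ h∈ h≢g with two-coordinates (proj₁ g∈) cb (sym-S g∈)
      ... | inj₁ sym-b = inj₁ sym-b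
      ... | inj₂ (Z , z , off) with zero? Z b
      ... | inj₁ Zb = inj₂ (inj₁ (Z , z , Z⊴ , h , h∈ , off h h≢g (S≢B h∈ Xb ∘ sym) (proj₁ h∈)))
        where
        Z⊴ : Z ⊴X
        Z⊴ i Xi with i Fin.≟ b
        ... | yes refl = Zb
        ... | no i≢b   = off i (S≢B g∈ Xi) i≢b (zero-base {X} x Xi)
      ... | inj₂ (τ , Zb) with zero? Z g
      ... | inj₂ (σ , Zg) = inj₂ (inj₂ record
        { near = record
          { cov = z ; sign-b = Zb
          ; zero-B = λ i≢b Xi → off _ (S≢B g∈ Xi) i≢b (zero-base {X} x Xi) }
        ; sign-g = Zg
        ; zero-S = λ i≢g i∈ → off _ i≢g (S≢B i∈ Xb ∘ sym) (proj₁ i∈) })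
      ... | inj₁ Zg = inj₁ (central⇒symmetric {b} {Z} z central)
        where
        central : ∀ f → f ≢ b → c ! f ≡ nothing → Z ! f ≡ nothing
        central f f≢b cf with f Fin.≟ g
        ... | yes refl = Zg
        ... | no f≢g   = off f f≢g f≢b cf

      -- X ∘ -Z and Y ∘ -Z agree at b, where both are -τ, and are still separated at h, so
      -- `se-agree` eliminates h.
      probe : ∀ {τ Z h} → Near τ Z → InS h →
              ∃[ Q ] (Near (opposite τ) Q × Q ! h ≡ nothing)
      probe {τ} {Z} {h} near h∈ = finish (se-agree {X ⊙ neg Z} {Y ⊙ neg Z} {b}
          (cov-FS {X = X} {Z} x cov) (cov-FS {X = Y} {Z} y cov) cb
          (trans (X⊙ Xb) (neg-just Z sign-b)) (trans (Y⊙ Xb) (neg-just Z sign-b)) separated′)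
        where
        open Near near
        X⊙ : ∀ {i} → X ! i ≡ nothing → (X ⊙ neg Z) ! i ≡ neg Z ! i
        X⊙ Xi = ⊙-nothing X (neg Z) Xi
        Y⊙ : ∀ {i} → X ! i ≡ nothing → (Y ⊙ neg Z) ! i ≡ neg Z ! i
        Y⊙ Xi = ⊙-nothing Y (neg Z) (Y⊴X _ Xi)
        separated′ : Sep (X ⊙ neg Z) (Y ⊙ neg Z) h
        separated′ = let (_ , Xh , Yh) = Sep-elim X Y (separated h∈) in
          Sep-intro {X = X ⊙ neg Z} {Y ⊙ neg Z} (⊙-just X (neg Z) Xh) (⊙-just Y (neg Z) Yh)
        finish : Eliminates (Cov 𝒯) (X ⊙ neg Z) (Y ⊙ neg Z) h →
                 ∃[ Q ] (Near (opposite τ) Q × Q ! h ≡ nothing)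
        finish (Q , q , Qh , off) = Q , record { cov = q ; sign-b = Qb ; zero-B = zeroes } , Qh
          where
          Qb : Q ! b ≡ just (opposite τ)
          Qb = trans (off (¬Sep-≡ (X ⊙ neg Z) (Y ⊙ neg Z) (trans (X⊙ Xb) (sym (Y⊙ Xb)))))
            (⊙-just (X ⊙ neg Z) (Y ⊙ neg Z) (trans (X⊙ Xb) (neg-just Z sign-b)))
          zeroes : ∀ {i} → i ≢ b → X ! i ≡ nothing → Q ! i ≡ nothing
          zeroes i≢b Xi = trans (off (¬Sep-nothingˡ (X ⊙ neg Z) (Y ⊙ neg Z) X⊙i))
            (trans (⊙-nothing (X ⊙ neg Z) (Y ⊙ neg Z) X⊙i) (trans (Y⊙ Xi) (neg-nothing Z (zero-B i≢b Xi))))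
            where X⊙i = trans (X⊙ Xi) (neg-nothing Z (zero-B i≢b Xi))

      -- Z ∘ Q and Q ∘ Z both have sign σ at g, by the assumption on Q, and are opposite at b;
      -- eliminating b leaves a covector below X. On the rest of S the vector Z vanishes, so Q
      -- survives there.
      combine : ∀ {g Q} → InS g → (s : Singleton g) → Near (opposite (Singleton.τ s)) Q →
                Q ! g ≢ just (opposite (Singleton.σ s)) →
                ∃[ V ] (Cov 𝒯 V × V ⊴X × V ! g ≡ just (Singleton.σ s) ×
                        (∀ {i} → i ≢ g → InS i → V ! i ≡ Q ! i))
      combine {g} {Q} g∈ s nearQ Qg≢ = finish (se-agree {Z ⊙ Q} {Q ⊙ Z} {g} (cov-⊙ {X = Z} {Q} cov N.cov) (cov-⊙ {X = Q} {Z} N.cov cov)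
          (proj₁ g∈) ZQg QZg (Sep-intro {X = Z ⊙ Q} {Q ⊙ Z} (⊙-just Z Q sign-b) (⊙-just Q Z N.sign-b)))
        where
        open Singleton s
        module N = Near nearQ
        ZQg : (Z ⊙ Q) ! g ≡ just σ
        ZQg = ⊙-just Z Q sign-g
        QZg : (Q ⊙ Z) ! g ≡ just σ
        QZg with zero? Q g
        ... | inj₁ Qg = trans (⊙-nothing Q Z Qg) sign-g
        ... | inj₂ (r , Qg) with r Sign.≟ σ
        ... | yes refl = ⊙-just Q Z Qg
        ... | no r≢σ   = contradiction (trans Qg (cong just (≢⇒opposite (r≢σ ∘ sym)))) Qg≢
        same : ∀ {i} → Z ! i ≡ nothing → (Z ⊙ Q) ! i ≡ (Q ⊙ Z) ! i
        same Zi = ⊙-comm Z Q (¬Sep-nothingˡ Z Q Zi)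
        finish : Eliminates (Cov 𝒯) (Z ⊙ Q) (Q ⊙ Z) b → _
        finish (V , v , Vb , off) = V , v , V⊴ , Vg , λ {i} → VS {i}
          where
          entry : ∀ {i} → Z ! i ≡ nothing → V ! i ≡ Q ! i
          entry {i} Zi = trans (off (¬Sep-≡ (Z ⊙ Q) (Q ⊙ Z) (same Zi)))
            (trans (⊙-idem (Z ⊙ Q) (Q ⊙ Z) (same Zi)) (⊙-nothing Z Q Zi))
          V⊴ : V ⊴X
          V⊴ i Xi with i Fin.≟ b
          ... | yes refl = Vb
          ... | no i≢b   = trans (entry (zero-B i≢b Xi)) (N.zero-B i≢b Xi)
          Vg : V ! g ≡ just σ
          Vg = trans (off (¬Sep-≡ (Z ⊙ Q) (Q ⊙ Z) (trans ZQg (sym QZg)))) (⊙-just (Z ⊙ Q) (Q ⊙ Z) ZQg)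
          VS : ∀ {i} → i ≢ g → InS i → V ! i ≡ Q ! i
          VS i≢g i∈ = entry (zero-S i≢g i∈)

      is? : ∀ (m : Maybe Sign) s → Dec (m ≡ just s)
      is? nothing  s = no λ ()
      is? (just r) s with r Sign.≟ s
      ... | yes refl = yes refl
      ... | no r≢s   = no λ { refl → r≢s refl }

      opposed : ∀ {g h Q} → InS g → InS h → h ≢ g → (s : Singleton g) →
                Near (opposite (Singleton.τ s)) Q → Q ! h ≡ nothing →
                Q ! g ≡ just (opposite (Singleton.σ s)) ⊎ Goal
      opposed {g} {h} {Q} g∈ h∈ h≢g s near Qh = by (is? (Q ! g) (opposite (Singleton.σ s)))
        where
        by : Dec (Q ! g ≡ just (opposite (Singleton.σ s))) → Q ! g ≡ just (opposite (Singleton.σ s)) ⊎ Goal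
        by (yes Qg) = inj₁ Qg
        by (no Qg≢) = let (V , v , V⊴ , _ , VS) = combine g∈ s near Qg≢ in
                      inj₂ (V , v , V⊴ , h , h∈ , trans (VS h≢g h∈) Qh)

      -- Here S consists of g and h, and both Z and R vanish at h. If R is opposed to Z at g,
      -- eliminating g while ignoring b therefore leaves a vector that is central up to b.
      pair-symmetric : ∀ {g h} → InS g → InS h → h ≢ g → (∀ {i} → InS i → i ≢ g → i ≡ h) →
                       Singleton g → SymmetricUpTo b ⊎ Goal
      pair-symmetric {g} {h} g∈ h∈ h≢g only s = opposed-case (opposed g∈ h∈ h≢g s nearR Rh)
        where
        open Singleton s
        R : SignVector n
        R = proj₁ (probe near h∈)
        nearR : Near (opposite τ) R
        nearR = proj₁ (proj₂ (probe near h∈))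
        Rh : R ! h ≡ nothing
        Rh = proj₂ (proj₂ (probe near h∈))
        central : ∀ W → W ! g ≡ nothing → (∀ {f} → f ≢ b → ¬ Sep Z R f → W ! f ≡ (Z ⊙ R) ! f) →
                  ∀ f → f ≢ b → c ! f ≡ nothing → W ! f ≡ nothing
        central W Wg off f f≢b cf = by (f Fin.≟ g) (zero? X f)
          where
          entry : Z ! f ≡ nothing → R ! f ≡ nothing → W ! f ≡ nothing
          entry Zf Rf = trans (off f≢b (¬Sep-nothingˡ Z R Zf)) (trans (⊙-nothing Z R Zf) Rf)
          by : Dec (f ≡ g) → X ! f ≡ nothing ⊎ ∃[ r ] X ! f ≡ just r → W ! f ≡ nothing
          by (yes refl) _               = Wg
          by (no _)     (inj₁ Xf)       = entry (zero-B f≢b Xf) (Near.zero-B nearR f≢b Xf)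
          by (no f≢g)   (inj₂ (_ , Xf)) = entry (zero-S f≢g (cf , just≢nothing Xf))
            (subst (λ i → R ! i ≡ nothing) (sym (only (cf , just≢nothing Xf) f≢g)) Rh)
        se-case : SymmetricUpTo b ⊎ EliminatesOff b Z R g → SymmetricUpTo b
        se-case (inj₁ sym-b)             = sym-b
        se-case (inj₂ (W , w , Wg , off)) = central⇒symmetric {b} {W} w (central W Wg off)
        opposed-case : R ! g ≡ just (opposite σ) ⊎ Goal → SymmetricUpTo b ⊎ Goal
        opposed-case (inj₂ found) = inj₂ found
        opposed-case (inj₁ Rg)    = inj₁ (se-case (se-off {b} {g} {Z} {R} cb (S≢B g∈ Xb ∘ sym)
          cov (Near.cov nearR) (Sep-intro {X = Z} {R} sign-g Rg)))

      or-goal : ∀ {A : Set} → A ⊎ Goal → (A → Goal) → Goal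
      or-goal (inj₁ a)    f = f a
      or-goal (inj₂ goal) f = goal

      -- The covector of `sh` itself serves as the Q opposite to `sg` at b. It vanishes at k, so
      -- `opposed` applies, and at g, so it cannot be opposed there.
      different-τ : ∀ {g h k} → InS g → InS k → k ≢ g → k ≢ h → h ≢ g → InS h →
                    (sg : Singleton g) (sh : Singleton h) → Singleton.τ sg ≢ Singleton.τ sh → Goal
      different-τ {g} {h} {k} g∈ k∈ k≢g k≢h h≢g h∈ sg sh τ≢ =
        or-goal (opposed g∈ k∈ k≢g sg (subst (λ τ → Near τ (Singleton.Z sh)) (≢⇒opposite τ≢) (Singleton.near sh))
                   (Singleton.zero-S sh k≢h k∈))
          (λ p → contradiction p (nothing≢just (Singleton.zero-S sh (h≢g ∘ sym) g∈)))

      near-τ : ∀ {g h Q} {sg : Singleton g} {sh : Singleton h} → Singleton.τ sg ≡ Singleton.τ sh →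
               Near (opposite (Singleton.τ sg)) Q → Near (opposite (Singleton.τ sh)) Q
      near-τ {Q = Q} eq = subst (λ τ → Near (opposite τ) Q) eq

      -- V is σ_g at g and −σ elsewhere, V′ is σ_h at h and −σ elsewhere; they agree at k.
      same-τ : ∀ {g h k} → InS g → InS h → InS k → h ≢ g → k ≢ g → k ≢ h →
               (sg : Singleton g) (sh : Singleton h) (sk : Singleton k) →
               Singleton.τ sg ≡ Singleton.τ sh → Singleton.τ sg ≡ Singleton.τ sk → Goal
      same-τ {g} {h} {k} g∈ h∈ k∈ h≢g k≢g k≢h sg sh sk τh τk =
        let (Q , nearQ , Qg) = probe (Singleton.near sg) g∈
            (R , nearR , Rh) = probe (Singleton.near sg) h∈
        in
        or-goal (opposed h∈ g∈ (h≢g ∘ sym) sh (near-τ {sg = sg} {sh} τh nearQ) Qg) λ Qh →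
        or-goal (opposed k∈ g∈ (k≢g ∘ sym) sk (near-τ {sg = sg} {sk} τk nearQ) Qg) λ Qk →
        or-goal (opposed g∈ h∈ h≢g sg nearR Rh) λ Rg →
        or-goal (opposed k∈ h∈ (k≢h ∘ sym) sk (near-τ {sg = sg} {sk} τk nearR) Rh) λ Rk →
        let (V  , v  , V⊴  , Vg  , VS)  = combine g∈ sg nearQ (nothing≢just Qg)
            (V′ , v′ , V′⊴ , V′h , V′S) = combine h∈ sh (near-τ {sg = sg} {sh} τh nearR) (nothing≢just Rh)
        in clash {V} {V′} v v′ V⊴ V′⊴ Vg (trans (V′S (h≢g ∘ sym) g∈) Rg) (trans (VS k≢g k∈) Qk) (trans (V′S k≢h k∈) Rk)
        where
        clash : ∀ {V V′ s t} → Cov 𝒯 V → Cov 𝒯 V′ → V ⊴X → V′ ⊴X → V ! g ≡ just s → V′ ! g ≡ just (opposite s) →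
                V ! k ≡ just t → V′ ! k ≡ just t → Goal
        clash {V} {V′} v v′ V⊴ V′⊴ Vg V′g Vk V′k
          with se-agree {V} {V′} v v′ (proj₁ k∈) Vk V′k (Sep-intro {X = V} {V′} Vg V′g)
        ... | W , w , Wg , off = W , w , W⊴ , g , g∈ , Wg
          where
          W⊴ : W ⊴X
          W⊴ i Xi = trans (off (¬Sep-nothingˡ V V′ (V⊴ i Xi))) (trans (⊙-nothing V V′ (V⊴ i Xi)) (V′⊴ i Xi))

      triple-goal : ∀ {g h k} → InS g → InS h → InS k → h ≢ g → k ≢ g → k ≢ h →
                    Singleton g → Singleton h → Singleton k → Goal
      triple-goal {g} {h} {k} g∈ h∈ k∈ h≢g k≢g k≢h sg sh sk =
        by (Singleton.τ sg Sign.≟ Singleton.τ sh) (Singleton.τ sg Sign.≟ Singleton.τ sk)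
        where
        by : Dec (Singleton.τ sg ≡ Singleton.τ sh) → Dec (Singleton.τ sg ≡ Singleton.τ sk) → Goal
        by (no τ≢) _        = different-τ g∈ k∈ k≢g k≢h h≢g h∈ sg sh τ≢
        by (yes _) (no τ≢)  = different-τ g∈ h∈ h≢g (k≢h ∘ sym) k≢g k∈ sg sk τ≢
        by (yes p) (yes q)  = same-τ g∈ h∈ k∈ h≢g k≢g k≢h sg sh sk p q

      zero-symmetric : ∀ {g h} → InS g → InS h → h ≢ g → SymmetricUpTo b ⊎ Goal
      zero-symmetric {g} {h} g∈ h∈ h≢g =
        first (singleton g∈ h∈ h≢g) (Fin.any? λ k → InS? k ×-dec ¬? (k Fin.≟ g) ×-dec ¬? (k Fin.≟ h))
        where
        first : SymmetricUpTo b ⊎ Goal ⊎ Singleton g → Dec (∃[ k ] (InS k × k ≢ g × k ≢ h)) →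
                SymmetricUpTo b ⊎ Goal
        first (inj₁ sym-b)       _ = inj₁ sym-b
        first (inj₂ (inj₁ found)) _ = inj₂ found
        first (inj₂ (inj₂ sg)) (no none) = pair-symmetric g∈ h∈ h≢g
          (λ {i} i∈ i≢g → decidable-stable (i Fin.≟ h) (λ i≢h → none (i , i∈ , i≢g , i≢h))) sg
        first (inj₂ (inj₂ sg)) (yes (k , k∈ , k≢g , k≢h)) =
          others (singleton h∈ g∈ (h≢g ∘ sym)) (singleton k∈ g∈ (k≢g ∘ sym))
          where
          others : SymmetricUpTo b ⊎ Goal ⊎ Singleton h → SymmetricUpTo b ⊎ Goal ⊎ Singleton k →
                   SymmetricUpTo b ⊎ Goal
          others (inj₁ sym-b)        _                   = inj₁ sym-b
          others (inj₂ (inj₁ found)) _                   = inj₂ found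
          others (inj₂ (inj₂ _))     (inj₁ sym-b)        = inj₁ sym-b
          others (inj₂ (inj₂ _))     (inj₂ (inj₁ found)) = inj₂ found
          others (inj₂ (inj₂ sh))    (inj₂ (inj₂ sk))    = inj₂ (triple-goal g∈ h∈ k∈ h≢g k≢g k≢h sg sh sk)

    all-symmetric-goal : ∀ {g h} → InS g → InS h → h ≢ g →
                         (∀ {i} → c ! i ≡ nothing → SymmetricUpTo i) → Goal
    all-symmetric-goal {g} {h} g∈ h∈ h≢g sym-all
      with anyTope? (λ T → dec T ×-dec ¬? (dec (c ▷ - T)))
    ... | no none = c , c-cov , (λ i → zero-base {X} x) , g , g∈ , proj₁ g∈
      where
      c-cov : Cov 𝒯 c
      c-cov T t = subst 𝒯 (sym (≼⇒▷≡ c (base t))) t ,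
        decidable-stable (dec (c ▷ - T)) (λ ¬t′ → none (T , t , ¬t′))
    ... | yes (T , t , U∉) = Z , z , Z⊴ , h , h∈ , trans (off-≔ g c h h≢g) (proj₁ h∈)
      where
      U : Vec Sign n
      U = c ▷ - T
      -- The topes are now the cube of c without U. The facet at g on the side away from U is a full
      -- cube, hence a covector, and it leaves h free.
      Z : SignVector n
      Z = c [ g ]≔ just (T ! g)
      Zg : Z ! g ≡ just (T ! g)
      Zg = lookup∘update g c _
      Ug : U ! g ≡ opposite (T ! g)
      Ug = trans (▷-nothing c (proj₁ g∈)) (lookup-- T g)
      nbrs : ∀ {i} → c ! i ≡ nothing → 𝒯 (flip i U)
      nbrs ci with sym-all ci T t
      ... | inj₁ u = contradiction u U∉
      ... | inj₂ u = u
      present : ∀ {V} → c ≼ V → V ≢ U → 𝒯 V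
      present {V} c≼V V≢U with Fin.any? (λ m → is-nothing? (c ! m) ×-dec (V ! m Sign.≟ U ! m))
      ... | yes (m , cm , Vm) = punctured-cube {c = c} dec gate (≼-▷ c (- T)) U∉ nbrs {V} c≼V V≢U cm Vm
      -- V differs from U at every free coordinate, so it is T.
      ... | no none = subst 𝒯 (lookup-ext at) t
        where
        at : ∀ i → T ! i ≡ V ! i
        at i with zero? c i
        ... | inj₂ (s , ci) = trans (base t ci) (sym (c≼V ci))
        ... | inj₁ ci = opposite-pair {r = U ! i}
          (λ eq → opposite≢ (trans (sym (lookup-- T i)) (trans (sym (▷-nothing c ci)) eq)))
          (λ eq → none (i , ci , sym eq))
      on-face : ∀ {V} → c ≼ V → 𝒯 (Z ▷ V)
      on-face {V} c≼V = present c≼ (λ eq → opposite≢ (trans (sym Ug) (trans (sym (cong (_! g) eq)) (▷-just Z Zg))))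
        where
        c≼ : c ≼ Z ▷ V
        c≼ {i} ci with i Fin.≟ g
        ... | yes refl = contradiction ci (nothing≢just (proj₁ g∈))
        ... | no i≢g   = ▷-just Z (trans (off-≔ g c i i≢g) ci)
      z : Cov 𝒯 Z
      z S s = on-face (base s) , subst 𝒯 (lookup-ext at) (on-face {c ▷ - S} (≼-▷ c (- S)))
        where
        at : ∀ i → (Z ▷ c ▷ - S) ! i ≡ (Z ▷ - S) ! i
        at i with zero? Z i
        ... | inj₂ (s , Zi) = trans (▷-just Z Zi) (sym (▷-just Z Zi))
        ... | inj₁ Zi with i Fin.≟ g
        ... | yes refl = contradiction Zg (nothing≢just Zi)
        ... | no i≢g   = trans (▷-nothing Z Zi)
          (trans (▷-nothing c (trans (off-≔′ g c i i≢g) Zi)) (sym (▷-nothing Z Zi)))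
      Z⊴ : Z ⊴X
      Z⊴ i Xi = trans (off-≔ g c i (S≢B g∈ Xi)) (zero-base {X} x Xi)

    goal : ∀ {e} → InS e → Goal
    goal {e} e∈ with Fin.any? (λ h → InS? h ×-dec ¬? (h Fin.≟ e))
    ... | no none = singleton-goal e∈
            (λ {i} i∈ → decidable-stable (i Fin.≟ e) (λ i≢e → none (i , i∈ , i≢e)))
    ... | yes (h , h∈ , h≢e) with sequence-⊎ {P = λ g → InS g → SymmetricUpTo g} {Goal} on-S
      where
      on-S : ∀ g → (InS g → SymmetricUpTo g) ⊎ Goal
      on-S g with InS? g | g Fin.≟ e
      ... | no g∉  | _        = inj₁ (λ g∈ → contradiction g∈ g∉)
      ... | yes g∈ | yes refl = Sum.map₁ (λ p _ → p) (support-symmetric g∈ h∈ h≢e)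
      ... | yes g∈ | no g≢e   = Sum.map₁ (λ p _ → p) (support-symmetric g∈ e∈ (g≢e ∘ sym))
    ... | inj₂ found = found
    ... | inj₁ sym-S with sequence-⊎ {P = λ b → c ! b ≡ nothing → SymmetricUpTo b} {Goal} everywhere
      where
      everywhere : ∀ b → (c ! b ≡ nothing → SymmetricUpTo b) ⊎ Goal
      everywhere b with zero? X b
      ... | inj₁ Xb       = Sum.map₁ (λ p _ → p)
        (ZeroCoordinate.zero-symmetric Xb (λ {g} → sym-S g) e∈ h∈ h≢e)
      ... | inj₂ (_ , Xb) = inj₁ (λ cb → sym-S b (cb , just≢nothing Xb))
    ... | inj₂ found   = found
    ... | inj₁ sym-all = all-symmetric-goal e∈ h∈ h≢e (λ {i} → sym-all i)

  -- Passing to X ⊙ Y and Y ⊙ X makes the supports equal.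

  strong-elimination : SE (Cov 𝒯)
  strong-elimination {X₀} {Y₀} x₀ y₀ {e} sep₀ with Sep-elim X₀ Y₀ sep₀
  ... | s , X₀e , Y₀e = transfer equal-support
    where
    X Y : SignVector n
    X = X₀ ⊙ Y₀
    Y = Y₀ ⊙ X₀
    x : Cov 𝒯 X
    x = cov-⊙ {X = X₀} {Y₀} x₀ y₀
    y : Cov 𝒯 Y
    y = cov-⊙ {X = Y₀} {X₀} y₀ x₀
    sep : Sep X Y e
    sep = Sep-intro {X = X} {Y} (⊙-just X₀ Y₀ X₀e) (⊙-just Y₀ X₀ Y₀e)
    equal-support : Eliminates (Cov 𝒯) X Y e
    equal-support with Fin.any? (λ f → is-nothing? (c ! f) ×-dec ¬? (is-nothing? (X ! f)) ×-dec
                                       Maybe.≡-dec Sign._≟_ (X ! f) (Y ! f))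
    ... | yes (f , cf , Xf≢ , Xf≡Yf) with ≢nothing Xf≢
    ... | r , Xf = se-agree {X} {Y} x y cf Xf (trans (sym Xf≡Yf) Xf) sep
    equal-support | no none = Opposite.reduce {X} {Y} x y opp e∈ (Opposite.goal {X} {Y} x y opp e∈)
      where
      opp : ∀ i → c ! i ≡ nothing → (X ! i ≡ nothing × Y ! i ≡ nothing) ⊎
                                   ∃[ s ] (X ! i ≡ just s × Y ! i ≡ just (opposite s))
      opp i ci with zero? X i | zero? Y i
      ... | inj₁ p | _ = inj₁ (p , trans (⊙-nothing Y₀ X₀ (proj₂ (⊙-zero X₀ Y₀ p))) (proj₁ (⊙-zero X₀ Y₀ p)))
      ... | inj₂ (_ , p) | inj₁ q = contradiction
        (trans (⊙-nothing X₀ Y₀ (proj₂ (⊙-zero Y₀ X₀ q))) (proj₁ (⊙-zero Y₀ X₀ q))) (just≢nothing p)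
      ... | inj₂ (r , p) | inj₂ (t , q) with r Sign.≟ t
      ... | yes refl = contradiction (i , ci , just≢nothing p , trans p (sym q)) none
      ... | no r≢t   = inj₂ (r , p , trans q (cong just (≢⇒opposite r≢t)))
      e∈ : c ! e ≡ nothing × X ! e ≢ nothing
      e∈ = ce , just≢nothing (⊙-just X₀ Y₀ X₀e)
        where
        ce : c ! e ≡ nothing
        ce with zero? c e
        ... | inj₁ p       = p
        ... | inj₂ (r , p) = contradiction sep (¬Sep-≡ X Y (trans (cov-base {X} x p) (sym (cov-base {Y} y p))))
    transfer : Eliminates (Cov 𝒯) X Y e → Eliminates (Cov 𝒯) X₀ Y₀ e
    transfer (Z , z , Ze , off) = Z , z , Ze , off′
      where
      off′ : ∀ {f} → ¬ Sep X₀ Y₀ f → Z ! f ≡ (X₀ ⊙ Y₀) ! f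
      off′ ¬sep = trans (off (¬Sep-≡ X Y (⊙-comm X₀ Y₀ ¬sep))) (⊙-idem X Y (⊙-comm X₀ Y₀ ¬sep))

gating⇒SE : ∀ {n} {c : SignVector n} {𝒯 T₀} → System c 𝒯 → Gating 𝒯 → 𝒯 T₀ → SE (Cov 𝒯)
gating⇒SE {c = c} = go (<-wellFounded (zeros c))
  where
  go : ∀ {c 𝒯 T₀} → Acc _<_ (zeros c) → System c 𝒯 → Gating 𝒯 → 𝒯 T₀ → SE (Cov 𝒯)
  go (acc rs) sys gate t₀ = Elimination.strong-elimination sys gate t₀ (λ lt → go (rs lt))

-- Isometric sets of topes

-- The one-step form of isometry: iterating it produces a path inside 𝒯 whose length is the Hamming
-- distance.
Isometric : ∀ {n} → Topes n → Set
Isometric 𝒯 = ∀ S T → 𝒯 S → 𝒯 T → S ≢ T → ∃[ i ] (S ! i ≢ T ! i × 𝒯 (flip i S))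

isometric-∩ : ∀ {n} {𝒯 C : Topes n} → BetweenClosed C → Isometric 𝒯 → Isometric (𝒯 ∩ C)
isometric-∩ bc iso S T (s , cs) (t , ct) S≢T with iso S T s t S≢T
... | i , Si≢Ti , s′ = i , Si≢Ti , s′ ,
  bc S T (flip i S) cs ct (λ j eq → flip-≢ (λ { refl → Si≢Ti eq }) S)

flip-≔ : ∀ {n} (g : Fin n) (S : Vec Sign n) {s} → flip g S [ g ]≔ s ≡ S [ g ]≔ s
flip-≔ zero    (_ ∷ S) = refl
flip-≔ (suc g) (s ∷ S) = cong (s ∷_) (flip-≔ g S)

flip-≔-comm : ∀ {n} {g i : Fin n} (S : Vec Sign n) {s} → i ≢ g → flip i S [ g ]≔ s ≡ flip i (S [ g ]≔ s)
flip-≔-comm {g = zero}  {zero}  S       i≢g = contradiction refl i≢g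
flip-≔-comm {g = zero}  {suc i} (_ ∷ S) i≢g = refl
flip-≔-comm {g = suc g} {zero}  (_ ∷ S) i≢g = refl
flip-≔-comm {g = suc g} {suc i} (s ∷ S) i≢g = cong (s ∷_) (flip-≔-comm S (i≢g ∘ cong suc))

isometric-Con : ∀ {n} {𝒯 : Topes n} {g} → Isometric 𝒯 → Isometric (Con g 𝒯)
isometric-Con {𝒯 = 𝒯} {g} iso _ _ (S , s , refl) (T , t , refl) S′≢T′
  with iso S T s t (λ { refl → S′≢T′ refl })
... | i , Si≢Ti , s′ with i Fin.≟ g
... | no i≢g = i , (λ eq → Si≢Ti (trans (off-≔′ g S i i≢g) (trans eq (off-≔ g T i i≢g)))) ,
  flip i S , s′ , flip-≔-comm S i≢g
-- A flip at g is invisible after contraction, so a second step is taken. It cannot go back along g,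
-- where the first step reached agreement with T.
... | yes refl with iso (flip g S) T s′ t (λ { refl → S′≢T′ (sym (flip-≔ g S)) })
... | j , neq , s″ = j ,
  (λ eq → neq (trans (flip-≢ j≢g S) (trans (off-≔′ g S j j≢g) (trans eq (off-≔ g T j j≢g))))) ,
  flip j (flip g S) , s″ , trans (flip-≔-comm (flip g S) j≢g) (cong (flip j) (flip-≔ g S))
  where
  j≢g : j ≢ g
  j≢g refl = neq (trans (flip-≡ g S) (sym (≢⇒opposite Si≢Ti)))

-- The shapes of 𝓠⁻ on the zero coordinates of c, with v = ω: first Q⁻*, where u = flip f ω, and
-- then Q⁻⁻, where the neighbours to be deleted are those not in 𝒯.

record Punctured {n} (c : SignVector n) (𝒯 : Topes n) : Set where
  field
    ω            : Vec Sign n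
    c≼ω          : c ≼ ω
    antipode∉    : ¬ 𝒯 (c ▷ - ω)
    f            : Fin n
    f-zero       : c ! f ≡ nothing
    neighbour∉   : ¬ 𝒯 (flip f ω)
    others       : (𝒯 ω × (∀ {V} → c ≼ V → V ≢ c ▷ - ω → V ≢ flip f ω → 𝒯 V)) ⊎
                   (¬ 𝒯 ω × (∀ {V} → c ≼ V → V ≢ c ▷ - ω → V ≢ ω →
                              (∀ {b} → c ! b ≡ nothing → V ≢ flip b ω) → 𝒯 V))
    {zeros₄}     : Vec (Fin n) 4
    zeros₄-zero  : VecAll.All (λ i → c ! i ≡ nothing) zeros₄
    zeros₄-distinct : Unique zeros₄

-- Minimal non-gated sets of topes

symmetric-At : ∀ {n} {𝒯 : Topes n} {X f s} → X ! f ≡ just s → Symmetric 𝒯 X → Symmetric (𝒯 ∩ At f s) X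
symmetric-At {X = X} Xf (symmetric {P} p X≼P fl) =
  symmetric (p , X≼P Xf) X≼P (λ { {T} (t , _) X≼T → fl t X≼T , ▷-just X Xf })

-- A tope S may lie on the wrong side of g although its contraction is in the face, so the flips are
-- demanded for all S whose contraction is in the face.
symmetric-Con : ∀ {n} {𝒯 : Topes n} {X} g → Symmetric 𝒯 X →
  (∀ {S} → 𝒯 S → (X [ g ]≔ just plus) ≼ (S [ g ]≔ plus) → 𝒯 (X ▷ - S)) →
  Symmetric (Con g 𝒯) (X [ g ]≔ just plus)
symmetric-Con {𝒯 = 𝒯} {X} g (symmetric {P} p X≼P _) flips =
  symmetric (Con-intro {𝒯 = 𝒯} p) (≼-≔-≔ X g {P} X≼P) flips′
  where
  X′ = X [ g ]≔ just plus
  flips′ : ∀ {T} → Con g 𝒯 T → X′ ≼ T → Con g 𝒯 (X′ ▷ - T)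
  flips′ (S , s , refl) X′≼ = X ▷ - S , flips s X′≼ ,
    ▷-≔ X X′ (- S) (- (S [ g ]≔ plus)) (off-≔′ g X) (lookup∘update g X _) (-‿off S (S [ g ]≔ plus) (off-≔′ g S))

-- T is a tope whose gate U in the symmetric face of X is missing. `gate-Con` speaks only of
-- coordinates that vary on 𝒯, since a pc-contraction contracts the class of an existing edge.
module MinimalNonGated {n} {c : SignVector n} {𝒯 : Topes n} (sys : System c 𝒯) (iso : Isometric 𝒯)
  (gate-At : ∀ {f s} → c ! f ≡ nothing → Gating (𝒯 ∩ At f s))
  (gate-Con : ∀ {g} → c ! g ≡ nothing → ∀ {R S} → 𝒯 R → 𝒯 S → R ! g ≢ S ! g → Gating (Con g 𝒯))
  {X T} (sym-X : Symmetric 𝒯 X) (t : 𝒯 T) (U∉ : ¬ 𝒯 (X ▷ T))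
  where

  open System sys
  open Symmetric sym-X

  U : Vec Sign n
  U = X ▷ T

  X≼U : X ≼ U
  X≼U = ≼-▷ X T

  X-base : ∀ {i s} → c ! i ≡ just s → X ! i ≡ just s
  X-base = symmetric-base sys sym-X

  zero-base : ∀ {i} → X ! i ≡ nothing → c ! i ≡ nothing
  zero-base {i} Xi with zero? c i
  ... | inj₁ ci       = ci
  ... | inj₂ (_ , ci) = contradiction (X-base ci) (nothing≢just Xi)

  gate-in : ∀ {f s S} → c ! f ≡ nothing → X ! f ≡ just s → S ! f ≡ s → 𝒯 S → 𝒯 (X ▷ S)
  gate-in cf Xf Sf s = proj₁ (gate-At cf (symmetric-At Xf sym-X) (s , Sf))

  T-opposite : ∀ {f s} → c ! f ≡ nothing → X ! f ≡ just s → T ! f ≡ opposite s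
  T-opposite {f} {s} cf Xf with s Sign.≟ T ! f
  ... | yes eq = contradiction (gate-in cf Xf (sym eq) t) U∉
  ... | no s≢  = ≢⇒opposite s≢

  crossing : ∃[ f ] (c ! f ≡ nothing × ∃[ s ] X ! f ≡ just s)
  crossing with Fin.any? (λ f → is-nothing? (c ! f) ×-dec ¬? (is-nothing? (X ! f)))
  ... | yes (f , cf , Xf≢) = f , cf , ≢nothing Xf≢
  ... | no none = contradiction (subst 𝒯 (sym (≼⇒▷≡ X X≼T)) t) U∉
    where
    X≼T : X ≼ T
    X≼T {i} Xi with zero? c i
    ... | inj₁ ci       = contradiction (i , ci , just≢nothing Xi) none
    ... | inj₂ (r , ci) = trans (base t ci) (just-injective (trans (sym (X-base ci)) Xi))

  module Across {f s} (cf : c ! f ≡ nothing) (Xf : X ! f ≡ just s) where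

    -- Contract a second coordinate g. The gate of T in the contraction comes from a tope R on the
    -- side of X at f, so R has a gate within that side; this gate is U.
    only-f : ∀ {g r} → c ! g ≡ nothing → X ! g ≡ just r → g ≡ f
    only-f {g} {r} cg Xg with g Fin.≟ f
    ... | yes g≡f = g≡f
    ... | no g≢f  = contradiction (escape (gate-Con cg point∈ t
        (λ eq → opposite≢ (trans (sym (T-opposite cg Xg)) (trans (sym eq) (point≽ Xg)))) sym-X′ (Con-intro {𝒯 = 𝒯} t))) U∉
      where
      X′ : SignVector n
      X′ = X [ g ]≔ just plus
      X′f : X′ ! f ≡ just s
      X′f = trans (off-≔ g X f (g≢f ∘ sym)) Xf
      sym-X′ : Symmetric (Con g 𝒯) X′
      sym-X′ = symmetric-Con g sym-X λ {S} s∈ X′≼ → subst 𝒯 (▷-idem- X S)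
        (flips (gate-in cf Xf (trans (off-≔′ g S f (g≢f ∘ sym)) (X′≼ X′f)) s∈) (≼-▷ X S))
      escape : Con g 𝒯 (X′ ▷ (T [ g ]≔ plus)) → 𝒯 U
      escape (R , r∈ , eq) = subst 𝒯 (lookup-ext at) (gate-in cf Xf Rf r∈)
        where
        R-at : ∀ {i} → i ≢ g → R ! i ≡ (X′ ▷ (T [ g ]≔ plus)) ! i
        R-at i≢g = trans (off-≔′ g R _ i≢g) (cong (_! _) eq)
        Rf : R ! f ≡ s
        Rf = trans (R-at (g≢f ∘ sym)) (▷-just X′ X′f)
        at : ∀ i → (X ▷ R) ! i ≡ U ! i
        at i with zero? X i
        ... | inj₂ (_ , Xi) = trans (▷-just X Xi) (sym (▷-just X Xi))
        ... | inj₁ Xi = trans (▷-nothing X Xi) (trans (R-at i≢g)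
              (trans (▷-nothing X′ (trans (off-≔ g X i i≢g) Xi))
                (trans (off-≔ g T i i≢g) (sym (▷-nothing X Xi)))))
          where
          i≢g : i ≢ g
          i≢g refl = nothing≢just Xi Xg

    -- After contracting b, the gate of T is the image of U, so U or its neighbour along b is
    -- present; U is missing.
    nbrs : ∀ {b} → X ! b ≡ nothing → 𝒯 (flip b U)
    nbrs {b} Xb = finish (gate-Con (zero-base Xb) point∈ (flips point∈ point≽)
        (λ eq → opposite≢ (trans (sym (trans (▷-nothing X Xb) (lookup-- point b))) (sym eq))) sym-X′ (Con-intro {𝒯 = 𝒯} t))
      where
      X′ : SignVector n
      X′ = X [ b ]≔ just plus
      sym-X′ : Symmetric (Con b 𝒯) X′
      sym-X′ = symmetric-Con b sym-X λ {S} s∈ X′≼ → flips s∈ λ {i} Xi →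
        let i≢b = λ { refl → nothing≢just Xb Xi } in
        trans (off-≔′ b S i i≢b) (X′≼ (trans (off-≔ b X i i≢b) Xi))
      finish : Con b 𝒯 (X′ ▷ (T [ b ]≔ plus)) → 𝒯 (flip b U)
      finish (R , r∈ , eq) = Sum.[_,_]′ (λ { refl → contradiction r∈ U∉ }) (λ { refl → r∈ })
        (≡-or-flip {g = b} {R} {U} λ i i≢b → trans (off-≔′ b R i i≢b) (trans (cong (_! i) eq)
          (▷-cong {X = X′} {X} {T [ b ]≔ plus} {T} (off-≔ b X i i≢b) (off-≔ b T i i≢b))))

    Ū : Vec Sign n
    Ū = X ▷ - U

    Ū∉ : ¬ 𝒯 Ū
    Ū∉ ū = U∉ (subst 𝒯 (trans (▷-involutive X U) (≼⇒▷≡ X X≼U)) (flips ū (≼-▷ X (- U))))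

    Ū-opposite : ∀ {i} → X ! i ≡ nothing → Ū ! i ≡ opposite (U ! i)
    Ū-opposite {i} Xi = trans (▷-nothing X Xi) (lookup-- U i)

    differ-off-X : ∀ {V W} → X ≼ V → X ≼ W → V ≢ W → ∃[ b ] (X ! b ≡ nothing × V ! b ≢ W ! b)
    differ-off-X X≼V X≼W V≢W with differ V≢W
    ... | b , neq with zero? X b
    ... | inj₁ Xb       = b , Xb , neq
    ... | inj₂ (_ , Xb) = contradiction (trans (X≼V Xb) (sym (X≼W Xb))) neq

    ≢Ū⇒agree : ∀ {V} → X ≼ V → V ≢ Ū → ∃[ m ] (X ! m ≡ nothing × V ! m ≡ U ! m)
    ≢Ū⇒agree {V} X≼V V≢Ū with differ-off-X {V} {Ū} X≼V (≼-▷ X (- U)) V≢Ū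
    ... | m , Xm , neq = m , Xm , opposite-pair {r = Ū ! m} (neq ∘ sym) (λ eq → opposite≢ (trans (sym (Ū-opposite Xm)) eq))

    on-X : ∀ {V} → X ≼ V → V ≢ U → V ≢ Ū → 𝒯 V
    on-X {V} X≼V V≢U V≢Ū with ≢Ū⇒agree {V} X≼V V≢Ū
    ... | m , Xm , Vm = proj₁ (punctured-cube {c = X} {𝒯 ∩ At f s}
        (System.dec (system-At sys)) (gate-At cf) {U} X≼U (λ u → U∉ (proj₁ u)) flipped {V} X≼V V≢U Xm Vm)
      where
      flipped : ∀ {g} → X ! g ≡ nothing → (𝒯 ∩ At f s) (flip g U)
      flipped Xg = nbrs Xg , trans (flip-≢ (λ { refl → nothing≢just Xg Xf }) U) (X≼U Xf)

    X≼flip : ∀ {b V} → X ! b ≡ nothing → X ≼ V → X ≼ flip b V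
    X≼flip {b} {V} Xb X≼V Xi = trans (flip-≢ (λ { refl → nothing≢just Xb Xi }) V) (X≼V Xi)

    -- With f, the three coordinates obtained here give the dimension four of 𝓠⁻. Without an
    -- antipodal pair, an edge would be empty, and a square would be two opposite corners, which
    -- isometry forbids.
    dim₁ : ∃[ b ] X ! b ≡ nothing
    dim₁ with differ-off-X {point} {U} point≽ X≼U (λ { refl → U∉ point∈ })
    ... | b , Xb , _ = b , Xb

    dim₂ : ∀ {b₁} → X ! b₁ ≡ nothing → ∃[ b ] (X ! b ≡ nothing × b ≢ b₁)
    dim₂ {b₁} Xb₁ = second (≢Ū⇒agree {flip b₁ U} (X≼flip {b₁} {U} Xb₁ X≼U) (λ eq → Ū∉ (subst 𝒯 eq (nbrs Xb₁))))
      where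
      second : ∃[ m ] (X ! m ≡ nothing × flip b₁ U ! m ≡ U ! m) → ∃[ b ] (X ! b ≡ nothing × b ≢ b₁)
      second (b , Xb , eq) = b , Xb , λ { refl → opposite≢ (trans (sym (flip-≡ b₁ U)) eq) }

    dim₃ : ∀ {b₁ b₂} → X ! b₁ ≡ nothing → X ! b₂ ≡ nothing → b₂ ≢ b₁ →
           ∃[ b ] (X ! b ≡ nothing × b ≢ b₁ × b ≢ b₂)
    dim₃ {b₁} {b₂} Xb₁ Xb₂ b₂≢b₁ =
      third (≢Ū⇒agree {U₁₂} (X≼flip {b₂} {flip b₁ U} Xb₂ (X≼flip {b₁} {U} Xb₁ X≼U)) (λ eq → Ū∉ (subst 𝒯 eq U₁₂∈)))
      where
      U₁₂ : Vec Sign n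
      U₁₂ = flip b₂ (flip b₁ U)
      U₁₂∈ : 𝒯 U₁₂
      U₁₂∈ with iso (flip b₁ U) (flip b₂ U) (nbrs Xb₁) (nbrs Xb₂)
                (λ eq → opposite≢ (trans (sym (flip-≡ b₁ U)) (trans (cong (_! b₁) eq) (flip-≢ (b₂≢b₁ ∘ sym) U))))
      ... | i , neq , u with i Fin.≟ b₁ | i Fin.≟ b₂
      ... | yes refl | _        = contradiction (subst 𝒯 (flip-involutive b₁ U) u) U∉
      ... | no _     | yes refl = u
      ... | no i≢b₁  | no i≢b₂  = contradiction (trans (flip-≢ i≢b₁ U) (sym (flip-≢ i≢b₂ U))) neq
      third : ∃[ m ] (X ! m ≡ nothing × U₁₂ ! m ≡ U ! m) → ∃[ b ] (X ! b ≡ nothing × b ≢ b₁ × b ≢ b₂)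
      third (b , Xb , eq) = b , Xb ,
        (λ { refl → opposite≢ (trans (sym (trans (flip-≢ (b₂≢b₁ ∘ sym) (flip b₁ U)) (flip-≡ b₁ U))) eq) }) ,
        (λ { refl → opposite≢ (trans (sym (trans (flip-≡ b₂ (flip b₁ U)) (cong opposite (flip-≢ b₂≢b₁ U)))) eq) })

    zero≢f : ∀ {b} → X ! b ≡ nothing → b ≢ f
    zero≢f Xb refl = nothing≢just Xb Xf

    c≼U : c ≼ U
    c≼U ci = X≼U (X-base ci)

    T≡flip : T ≡ flip f U
    T≡flip = lookup-ext at
      where
      at : ∀ i → T ! i ≡ flip f U ! i
      at i with i Fin.≟ f
      ... | yes refl = trans (T-opposite cf Xf) (sym (trans (flip-≡ f U) (cong opposite (X≼U Xf))))
      ... | no i≢f with zero? X i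
      ... | inj₁ Xi = sym (trans (flip-≢ i≢f U) (▷-nothing X Xi))
      ... | inj₂ (_ , Xi) with zero? c i
      ... | inj₁ ci       = contradiction (only-f ci Xi) i≢f
      ... | inj₂ (_ , ci) = trans (base t ci) (sym (trans (flip-≢ i≢f U) (c≼U ci)))

    X≼⇐ : ∀ {V} → c ≼ V → V ! f ≡ s → X ≼ V
    X≼⇐ c≼V Vf {i} Xi with zero? c i
    ... | inj₂ (_ , ci) = trans (c≼V ci) (just-injective (trans (sym (X-base ci)) Xi))
    ... | inj₁ ci with only-f ci Xi
    ... | refl = trans Vf (just-injective (trans (sym Xf) Xi))

    -- As in punctured-cube, a missing V closest to U spans with U a symmetric face; here the gate is
    -- taken in the restriction to the coordinate b.

    far-side : ∀ V → Acc _<_ (ham U V) → c ≼ V → V ! f ≢ s → ∀ {b b′} → X ! b ≡ nothing → X ! b′ ≡ nothing →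
               b ≢ b′ → V ! b ≡ U ! b → V ! b′ ≡ U ! b′ → 𝒯 V
    far-side V (acc rs) c≼V Vf {b} {b′} Xb Xb′ b≢b′ Vb Vb′ with dec V
    ... | yes v = v
    ... | no V∉ = contradiction (subst 𝒯 (agree-gate U V Vb′)
        (proj₁ (gate-At (zero-base Xb) (symmetric-At (agree-just U V (sym Vb)) face)
          (nbrs Xb′ , flip-≢ b≢b′ U)))) U∉
      where
      face : Symmetric 𝒯 (agree U V)
      face = missing-pair-symmetric U∉ V∉ (subst 𝒯 T≡flip t)
        (agree-≼-flip U V (λ eq → Vf (trans (sym eq) (X≼U Xf)))) rest
        where
        rest : ∀ W → agree U V ≼ W → W ≢ U → W ≢ V → 𝒯 W
        rest W Z≼W W≢U W≢V with W ! f Sign.≟ s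
        ... | yes Wf = on-X {W} (X≼⇐ {W} (≼-agree-≼ {c = c} U V W c≼U c≼V Z≼W) Wf) W≢U
          (λ { refl → opposite≢ (trans (sym (Ū-opposite Xb)) (Z≼W (agree-just U V (sym Vb)))) })
        ... | no Wf≢ = far-side W (rs (agree-closer U V W Z≼W W≢V)) (≼-agree-≼ {c = c} U V W c≼U c≼V Z≼W)
          Wf≢ Xb Xb′ b≢b′ (Z≼W (agree-just U V (sym Vb))) (Z≼W (agree-just U V (sym Vb′)))

    ω : Vec Sign n
    ω = c ▷ - U

    ω-opposite : ∀ {i} → c ! i ≡ nothing → ω ! i ≡ opposite (U ! i)
    ω-opposite {i} ci = trans (▷-nothing c ci) (lookup-- U i)

    ωf≢s : ω ! f ≢ s
    ωf≢s eq = opposite≢ (trans (sym (trans (ω-opposite cf) (cong opposite (X≼U Xf)))) eq)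

    Ū≡flip : Ū ≡ flip f ω
    Ū≡flip = lookup-ext at
      where
      at : ∀ i → Ū ! i ≡ flip f ω ! i
      at i with i Fin.≟ f
      ... | yes refl = trans (▷-just X Xf) (sym (trans (flip-≡ f ω) (sym (≢⇒opposite ωf≢s))))
      ... | no i≢f with zero? X i
      ... | inj₁ Xi = trans (Ū-opposite Xi) (sym (trans (flip-≢ i≢f ω) (ω-opposite (zero-base Xi))))
      ... | inj₂ (_ , Xi) with zero? c i
      ... | inj₁ ci       = contradiction (only-f ci Xi) i≢f
      ... | inj₂ (_ , ci) = trans (▷-just X (X-base ci)) (sym (trans (flip-≢ i≢f ω) (▷-just c ci)))

    ω-at : ∀ {V} → c ≼ V → V ! f ≢ s → ∀ {i} → (X ! i ≡ nothing → V ! i ≢ U ! i) → V ! i ≡ ω ! i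
    ω-at c≼V Vf {i} opp with zero? c i | i Fin.≟ f | zero? X i
    ... | inj₂ (_ , ci) | _        | _             = trans (c≼V ci) (sym (▷-just c ci))
    ... | inj₁ _        | yes refl | _             = opposite-pair {r = s} (Vf ∘ sym) (ωf≢s ∘ sym)
    ... | inj₁ ci       | no i≢f   | inj₂ (_ , Xi) = contradiction (only-f ci Xi) i≢f
    ... | inj₁ ci       | no _     | inj₁ Xi       = trans (≢⇒opposite (opp Xi ∘ sym)) (sym (ω-opposite ci))

    -- By `far-side`, a missing V agrees with U on at most one zero coordinate of X, and ω is the
    -- vertex that agrees with U on none.
    near-ω : ∀ {V} → c ≼ V → V ! f ≢ s → ¬ 𝒯 V → V ≡ ω ⊎ ∃[ b ] (X ! b ≡ nothing × V ≡ flip b ω)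
    near-ω {V} c≼V Vf V∉ with Fin.any? (λ b → is-nothing? (X ! b) ×-dec (V ! b Sign.≟ U ! b))
    ... | no none = inj₁ (lookup-ext λ i → ω-at {V} c≼V Vf (λ Xi eq → none (i , Xi , eq)))
    ... | yes (b , Xb , Vb) = Sum.map₂ (λ eq → b , Xb , eq) (≡-or-flip {g = b} {V} {ω} λ i i≢b →
      ω-at {V} c≼V Vf λ Xi eq → V∉ (far-side V (<-wellFounded _) c≼V Vf Xb Xi (i≢b ∘ sym) Vb eq))

    cU : c ▷ - ω ≡ U
    cU = trans (▷-involutive c U) (≼⇒▷≡ c c≼U)

    near-face : ∀ {V} → c ≼ V → V ! f ≡ s → V ≢ c ▷ - ω → V ≢ flip f ω → 𝒯 V
    near-face {V} c≼V Vf V≢U V≢q = on-X {V} (X≼⇐ {V} c≼V Vf)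
      (λ eq → V≢U (trans eq (sym cU))) (λ eq → V≢q (trans eq Ū≡flip))

    -- ω and R are at distance two, and one of their two common neighbours in the cube, `flip f ω` =
    -- Ū, is missing; isometry forces the other. The coordinate b′ ensures R ≠ U, so that R is
    -- present by `on-X`.
    neighbour-present : 𝒯 ω → ∀ {b b′} → X ! b ≡ nothing → X ! b′ ≡ nothing → b′ ≢ b → ¬ ¬ 𝒯 (flip b ω)
    neighbour-present ω∈ {b} {b′} Xb Xb′ b′≢b V∉ = absurd (iso ω R ω∈ R∈ ω≢R)
      where
      R : Vec Sign n
      R = flip f (flip b ω)
      Rf : R ! f ≡ s
      Rf = trans (flip-≡ f (flip b ω)) (trans (cong opposite (flip-≢ (zero≢f Xb ∘ sym) ω)) (sym (≢⇒opposite ωf≢s)))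
      R-at : ∀ {i} → i ≢ f → R ! i ≡ flip b ω ! i
      R-at i≢f = flip-≢ i≢f (flip b ω)
      c≼R : c ≼ R
      c≼R {i} ci = trans (R-at (λ { refl → nothing≢just cf ci }))
        (trans (flip-≢ (λ { refl → nothing≢just (zero-base Xb) ci }) ω) (▷-just c ci))
      R≢U : R ≢ U
      R≢U eq = opposite≢ (trans (sym (ω-opposite (zero-base Xb′)))
        (trans (sym (trans (R-at (zero≢f Xb′)) (flip-≢ b′≢b ω))) (cong (_! b′) eq)))
      Rb : R ! b ≡ opposite (ω ! b)
      Rb = trans (R-at (zero≢f Xb)) (flip-≡ b ω)
      R∈ : 𝒯 R
      R∈ = on-X {R} (X≼⇐ {R} c≼R Rf) R≢U (λ eq → opposite≢ (trans (sym Rb) (trans (cong (_! b) eq)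
        (trans (Ū-opposite Xb) (sym (ω-opposite (zero-base Xb)))))))
      ω≢R : ω ≢ R
      ω≢R eq = ωf≢s (trans (cong (_! f) eq) Rf)
      absurd : ¬ (∃[ i ] (ω ! i ≢ R ! i × 𝒯 (flip i ω)))
      absurd (i , neq , r) with i Fin.≟ f | i Fin.≟ b
      ... | yes refl | _        = Ū∉ (subst 𝒯 (sym Ū≡flip) r)
      ... | no _     | yes refl = V∉ r
      ... | no i≢f   | no i≢b   = neq (sym (trans (flip-≢ i≢f (flip b ω)) (flip-≢ i≢b ω)))

    others : (𝒯 ω × (∀ {V} → c ≼ V → V ≢ c ▷ - ω → V ≢ flip f ω → 𝒯 V)) ⊎
             (¬ 𝒯 ω × (∀ {V} → c ≼ V → V ≢ c ▷ - ω → V ≢ ω →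
                        (∀ {b} → c ! b ≡ nothing → V ≢ flip b ω) → 𝒯 V))
    others with dec ω
    ... | yes ω∈ = inj₁ (ω∈ , all)
      where
      all : ∀ {V} → c ≼ V → V ≢ c ▷ - ω → V ≢ flip f ω → 𝒯 V
      all {V} c≼V V≢U V≢q with V ! f Sign.≟ s
      ... | yes Vf = near-face {V} c≼V Vf V≢U V≢q
      ... | no Vf≢ = decidable-stable (dec V) λ V∉ → Sum.[_,_]′
        (λ { refl → V∉ ω∈ }) (λ { (b , Xb , refl) → let (_ , Xb′ , b′≢b) = dim₂ Xb in neighbour-present ω∈ Xb Xb′ b′≢b V∉ }) (near-ω {V} c≼V Vf≢ V∉)
    ... | no ω∉ = inj₂ (ω∉ , all)
      where
      all : ∀ {V} → c ≼ V → V ≢ c ▷ - ω → V ≢ ω → (∀ {b} → c ! b ≡ nothing → V ≢ flip b ω) → 𝒯 V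
      all {V} c≼V V≢U V≢ω V≢nbr with V ! f Sign.≟ s
      ... | yes Vf = near-face {V} c≼V Vf V≢U (V≢nbr cf)
      ... | no Vf≢ = decidable-stable (dec V) λ V∉ → Sum.[_,_]′
        V≢ω (λ { (b , Xb , eq) → V≢nbr (zero-base Xb) eq }) (near-ω {V} c≼V Vf≢ V∉)

    punctured : ∀ {b₁ b₂ b₃} → X ! b₁ ≡ nothing → X ! b₂ ≡ nothing → X ! b₃ ≡ nothing →
                b₂ ≢ b₁ → b₃ ≢ b₁ → b₃ ≢ b₂ → Punctured c 𝒯
    punctured Xb₁ Xb₂ Xb₃ b₂≢b₁ b₃≢b₁ b₃≢b₂ = record
      { ω = ω ; c≼ω = ≼-▷ c (- U) ; antipode∉ = U∉ ∘ subst 𝒯 cU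
      ; f = f ; f-zero = cf ; neighbour∉ = Ū∉ ∘ subst 𝒯 (sym Ū≡flip)
      ; others = others
      ; zeros₄-zero = cf VecAll.∷ zero-base Xb₁ VecAll.∷ zero-base Xb₂ VecAll.∷ zero-base Xb₃ VecAll.∷ VecAll.[]
      ; zeros₄-distinct = (zero≢f Xb₁ ∘ sym VecAll.∷ zero≢f Xb₂ ∘ sym VecAll.∷ zero≢f Xb₃ ∘ sym VecAll.∷ VecAll.[])
          VecAllPairs.∷ (b₂≢b₁ ∘ sym VecAll.∷ b₃≢b₁ ∘ sym VecAll.∷ VecAll.[])
          VecAllPairs.∷ (b₃≢b₂ ∘ sym VecAll.∷ VecAll.[]) VecAllPairs.∷ VecAll.[] VecAllPairs.∷ VecAllPairs.[]
      }

  result : Punctured c 𝒯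
  result = let (f , cf , s , Xf) = crossing
               open Across cf Xf
               (_ , Xb₁) = dim₁
               (_ , Xb₂ , b₂≢b₁) = dim₂ Xb₁
               (_ , Xb₃ , b₃≢b₁ , b₃≢b₂) = dim₃ Xb₁ Xb₂ b₂≢b₁
           in punctured Xb₁ Xb₂ Xb₃ b₂≢b₁ b₃≢b₁ b₃≢b₂

-- Graphs as sets of topes

infix 4 _∼_

_∼_ : ∀ {n} → Vec Sign n → Vec Sign n → Set
_∼_ {n} = Graph._~_ (Q n)

adjacent⇒flip : ∀ {n} (S T : Vec Sign n) → S ∼ T → ∃[ i ] T ≡ flip i S
adjacent⇒flip S T (i , Si≢Ti , unique) = i , lookup-ext at
  where
  at : ∀ j → T ! j ≡ flip i S ! j
  at j with j Fin.≟ i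
  ... | yes refl = trans (≢⇒opposite Si≢Ti) (sym (flip-≡ i S))
  ... | no j≢i   = trans (sym (decidable-stable (S ! j Sign.≟ T ! j) λ neq → j≢i (sym (unique neq))))
                         (sym (flip-≢ j≢i S))

flip-adjacent : ∀ {n} (i : Fin n) S → S ∼ flip i S
flip-adjacent i S = i , (λ eq → opposite≢ (trans (sym (flip-≡ i S)) (sym eq))) ,
  λ {j} neq → decidable-stable (i Fin.≟ j) (λ i≢j → neq (sym (flip-≢ (i≢j ∘ sym) S)))

-- An isomorphism of G with the subgraph of the cube induced by 𝒯, but with relevant membership
-- proofs, so that passing between vertices and topes takes no decision procedure.
record Model (G : Graph) {n} (𝒯 : Topes n) : Set where
  private module G = Graph G
  field
    φ          : Vertex G → Vec Sign n
    φ∈         : ∀ x → 𝒯 (φ x)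
    injective  : ∀ {x y} → φ x ≡ φ y → x ≡ y
    surjective : ∀ {T} → 𝒯 T → ∃[ x ] φ x ≡ T
    adjacent   : ∀ {x y} → (x G.~ y) ⇔ φ x ∼ φ y

  ~⇒flip : ∀ {x y} → x G.~ y → ∃[ i ] φ y ≡ flip i (φ x)
  ~⇒flip x~y = adjacent⇒flip _ _ (Equivalence.to adjacent x~y)

  flip⇒~ : ∀ {x y i} → φ y ≡ flip i (φ x) → x G.~ y
  flip⇒~ {x} {y} {i} eq = Equivalence.from adjacent (subst (φ x ∼_) (sym eq) (flip-adjacent i (φ x)))

ham-additive : ∀ {n} (S T U : Vec Sign n) → Between S T U → ham S U + ham U T ≡ ham S T
ham-additive []      []      []      _   = refl
ham-additive (s ∷ S) (t ∷ T) (u ∷ U) btw with s Sign.≟ t | s Sign.≟ u | u Sign.≟ t | ham-additive S T U (btw ∘ suc)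
... | yes s≡t | no s≢u   | _     | _  = contradiction (sym (btw zero s≡t)) s≢u
... | yes refl | yes refl | no neq | _  = contradiction refl neq
... | yes _ | yes _    | yes _   | eq = eq
... | no s≢t | yes refl | yes u≡t | _ = contradiction u≡t s≢t
... | no _  | yes _    | no _    | eq = trans (ℕ.+-suc _ _) (cong suc eq)
... | no _  | no _     | yes _   | eq = cong suc eq
... | no s≢t | no s≢u  | no u≢t  | _  = contradiction (opposite-pair s≢u s≢t) u≢t

ham-flip-≤ : ∀ {n} (i : Fin n) (S T : Vec Sign n) → ham S T ≤ suc (ham (flip i S) T)
ham-flip-≤ i S T with S ! i Sign.≟ T ! i
... | yes eq = ℕ.≤-trans (ℕ.m≤n+m (ham S T) 2) (ℕ.≤-reflexive (sym (cong suc (ham-flip′ i S T eq))))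
... | no neq   = ℕ.≤-reflexive (sym (ham-flip i S T neq))

module Walks (G : Graph) where
  open Metric G

  length-◅◅ : ∀ {x y z} (p : Walk x y) (q : Walk y z) → length (p ◅◅ q) ≡ length p + length q
  length-◅◅ ε       q = refl
  length-◅◅ (_ ◅ p) q = cong suc (length-◅◅ p q)

  start-On : ∀ {x y} (p : Walk x y) → x On p
  start-On ε       = refl
  start-On (_ ◅ p) = inj₁ refl

  middle-On : ∀ {x y z} (p : Walk x y) (q : Walk y z) → y On (p ◅◅ q)
  middle-On ε       q = start-On q
  middle-On (_ ◅ p) q = inj₂ (middle-On p q)

module Distances {G : Graph} {n} {𝒯 : Topes n} (iso : Isometric 𝒯) (M : Model G 𝒯) where
  open Metric G
  open Walks G
  open Model M

  d : Vertex G → Vertex G → ℕ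
  d x y = ham (φ x) (φ y)

  d≤length : ∀ {x y} (p : Walk x y) → d x y ≤ length p
  d≤length {x} ε = ℕ.≤-reflexive (ham-refl (φ x))
  d≤length {x} {y} (x~z ◅ p) with ~⇒flip x~z
  ... | i , eq = ℕ.≤-trans (ham-flip-≤ i (φ x) (φ y))
    (s≤s (subst (λ S → ham S (φ y) ≤ length p) eq (d≤length p)))

  d≡0 : ∀ {x y} → d x y ≡ 0 → x ≡ y
  d≡0 {x} {y} eq = injective (ham≡0 (φ x) (φ y) eq)

  toward : ∀ {x y k} → d x y ≡ suc k →
           ∃[ i ] (φ x ! i ≢ φ y ! i × ∃[ z ] (φ z ≡ flip i (φ x) × d z y ≡ k))
  toward {x} {y} dxy with iso (φ x) (φ y) (φ∈ x) (φ∈ y) x≢y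
    where
    x≢y : φ x ≢ φ y
    x≢y eq = contradiction (trans (sym dxy) (trans (cong (ham (φ x)) (sym eq)) (ham-refl (φ x)))) λ ()
  ... | i , neq , z∈ with surjective z∈
  ... | z , eq = i , neq , z , eq , ℕ.suc-injective
    (trans (cong (λ S → suc (ham S (φ y))) eq) (trans (ham-flip i (φ x) (φ y) neq) dxy))

  geodesic : ∀ {x y} k → d x y ≡ k → Σ (Walk x y) λ p → length p ≡ k
  geodesic zero    eq with d≡0 eq
  ... | refl = ε , refl
  geodesic {x} {y} (suc k) eq with toward {x} {y} eq
  ... | i , _ , z , φz , dzy with geodesic k dzy
  ... | p , len = flip⇒~ φz ◅ p , cong suc len

  tight⇒shortest : ∀ {x y} (p : Walk x y) → length p ≡ d x y → Shortest p
  tight⇒shortest p eq q = ℕ.≤-trans (ℕ.≤-reflexive eq) (d≤length q)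

  shortest⇒tight : ∀ {x y} (p : Walk x y) → Shortest p → length p ≡ d x y
  shortest⇒tight {x} {y} p short with geodesic (d x y) refl
  ... | q , len = ℕ.≤-antisym (ℕ.≤-trans (short q) (ℕ.≤-reflexive len)) (d≤length p)

  dist : ∀ {x y} → Dist x y (d x y)
  dist {x} {y} with geodesic (d x y) refl
  ... | p , len = p , tight⇒shortest p len , len

  dist⇒d : ∀ {x y k} → Dist x y k → k ≡ d x y
  dist⇒d (p , short , len) = trans (sym len) (shortest⇒tight p short)

  -- Flipping a coordinate where the ends agree would increase the distance to y, and the rest of
  -- the walk would be too short to reach it.
  tight-between : ∀ {x y z} (p : Walk x y) → length p ≡ d x y → z On p → Between (φ x) (φ y) (φ z)
  tight-between ε       _   refl        i _ = refl
  tight-between (e ◅ p) _   (inj₁ refl) i _ = refl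
  tight-between {x} {y} {z} (_◅_ {j = w} e p) len (inj₂ on) i eq with ~⇒flip e
  ... | j , φw = trans (tight-between p len′ on i (trans w-x eq)) w-x
    where
    closer : φ x ! j ≢ φ y ! j
    closer eq′ = ℕ.<-irrefl refl (ℕ.≤-trans
      (ℕ.≤-reflexive (cong suc (sym (trans (cong (λ S → ham S (φ y)) φw) (ham-flip′ j (φ x) (φ y) eq′)))))
      (ℕ.≤-trans (s≤s (d≤length p)) (ℕ.≤-trans (ℕ.≤-reflexive len) (ℕ.n≤1+n _))))
    len′ : length p ≡ d w y
    len′ = ℕ.suc-injective (trans len (sym (trans (cong (λ S → suc (ham S (φ y))) φw)
                                                   (ham-flip j (φ x) (φ y) closer))))
    w-x : φ w ! i ≡ φ x ! i
    w-x = trans (cong (_! i) φw) (flip-≢ (λ { refl → closer eq }) (φ x))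

  on⇒between : ∀ {x y z} (p : Walk x y) → Shortest p → z On p → Between (φ x) (φ y) (φ z)
  on⇒between p short = tight-between p (shortest⇒tight p short)

  between⇒on : ∀ {x y z} → Between (φ x) (φ y) (φ z) → Σ (Walk x y) λ p → Shortest p × z On p
  between⇒on {x} {y} {z} btw with geodesic (d x z) refl | geodesic (d z y) refl
  ... | p , lp | q , lq = p ◅◅ q , tight⇒shortest (p ◅◅ q)
    (trans (length-◅◅ p q) (trans (cong₂ _+_ lp lq) (ham-additive (φ x) (φ y) (φ z) btw))) , middle-On p q

  closed⇒convex : ∀ {C : Topes n} → BetweenClosed C → Convex (C ∘ φ)
  closed⇒convex bc {x} {y} cx cy p short {z} on = bc (φ x) (φ y) (φ z) cx cy (on⇒between p short on)

≼-closed : ∀ {n} (X : SignVector n) → BetweenClosed (X ≼_)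
≼-closed X S T U X≼S X≼T btw {i} eq = trans (btw i (trans (X≼S eq) (sym (X≼T eq)))) (X≼S eq)

-- Partial cubes

cube-model : ∀ n → Model (Q n) {n} (λ _ → ⊤)
cube-model n = record
  { φ = λ T → T ; φ∈ = λ _ → tt ; injective = λ eq → eq ; surjective = λ {T} _ → T , refl
  ; adjacent = mk⇔ (λ a → a) (λ a → a) }

cube-isometric : ∀ {n} → Isometric {n} (λ _ → ⊤)
cube-isometric S T _ _ S≢T = let (i , neq) = differ S≢T in i , neq , tt

model⇒partialCube : ∀ {G n} {𝒯 : Topes n} → Isometric 𝒯 → Model G 𝒯 → IsPartialCube G
model⇒partialCube {G} {n} iso M = n , φ , λ x y k → mk⇔
  (λ dist → subst (Metric.Dist (Q n) (φ x) (φ y)) (sym (Dst.dist⇒d dist)) Cube.dist)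
  (λ dist → subst (Metric.Dist G x y) (sym (Cube.dist⇒d dist)) Dst.dist)
  where
  open Model M
  module Dst = Distances iso M
  module Cube = Distances cube-isometric (cube-model n)

module PartialCubeModel {G : Graph} (fin : Finite G) (pc : IsPartialCube G) where
  open Metric G
  private
    module Fin↔ = Inverse (proj₂ fin)

  n : ℕ
  n = proj₁ pc
  φ : Vertex G → Vec Sign n
  φ = proj₁ (proj₂ pc)

  private
    module Cube = Distances cube-isometric (cube-model n)
    module QM = Metric (Q n)

    to-cube : ∀ {x y k} → Dist x y k → k ≡ ham (φ x) (φ y)
    to-cube {x} {y} {k} dist = Cube.dist⇒d (Equivalence.to (proj₂ (proj₂ pc) x y k) dist)

    from-cube : ∀ x y → Dist x y (ham (φ x) (φ y))
    from-cube x y = Equivalence.from (proj₂ (proj₂ pc) x y _) Cube.dist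

  topes : Topes n
  topes T = ∃[ x ] φ x ≡ T

  topes? : Decidable topes
  topes? T = map′ (λ { (j , eq) → Fin↔.from j , eq })
    (λ { (x , eq) → Fin↔.to x , trans (cong φ (Fin↔.strictlyInverseʳ x)) eq })
    (Fin.any? (λ j → φ (Fin↔.from j) ≟ᵛ T))

  private
    walk₀ : ∀ {x y} → Dist x y 0 → x ≡ y
    walk₀ (ε , _) = refl

    walk₁ : ∀ {x y} → Dist x y 1 → Graph._~_ G x y
    walk₁ ((e ◅ ε) , _) = e

    inj : ∀ {x y} → φ x ≡ φ y → x ≡ y
    inj {x} {y} eq = walk₀ (subst (Dist x y) (trans (cong (ham (φ x)) (sym eq)) (ham-refl (φ x))) (from-cube x y))

    edge-dist : ∀ {x y} → Graph._~_ G x y → Dist x y 1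
    edge-dist {x} {y} x~y = x~y ◅ ε , short , refl
      where
      short : Shortest (x~y ◅ ε)
      short ε       = contradiction x~y (Graph.~-irr G refl)
      short (_ ◅ q) = s≤s z≤n

    cube₁ : ∀ {S T : Vec Sign n} → ham S T ≡ 1 → S ∼ T
    cube₁ {S} {T} eq with Cube.geodesic {S} {T} 1 eq
    ... | (e ◅ ε) , _ = e

    cube₁′ : ∀ {S T : Vec Sign n} → S ∼ T → ham S T ≡ 1
    cube₁′ {S} {T} e with adjacent⇒flip S T e
    ... | i , refl = trans (sym (ham-flip i S (flip i S) (λ eq → opposite≢ (trans (sym (flip-≡ i S)) (sym eq)))))
      (cong suc (ham-refl (flip i S)))

  model : Model G topes
  model = record
    { φ = φ ; φ∈ = λ x → x , refl ; injective = inj ; surjective = λ t → t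
    ; adjacent = λ {x} {y} → mk⇔ (λ e → cube₁ {φ x} {φ y} (sym (to-cube (edge-dist e))))
        (λ e → walk₁ (subst (Dist x y) (cube₁′ {φ x} {φ y} e) (from-cube x y))) }

  isometric : Isometric topes
  isometric _ _ (x , refl) (y , refl) φx≢φy = first (from-cube x y)
    where
    first : ∀ {k} → Dist x y k → ∃[ i ] (φ x ! i ≢ φ y ! i × topes (flip i (φ x)))
    first (ε , _) = contradiction refl φx≢φy
    first dist@(_◅_ {j = z} e p , short , len) = step (Model.~⇒flip model e)
      where
      dist-p : Dist z y (length p)
      dist-p = p , (λ q → ℕ.≤-pred (short (e ◅ q))) , refl
      step : ∃[ i ] φ z ≡ flip i (φ x) → ∃[ i ] (φ x ! i ≢ φ y ! i × topes (flip i (φ x)))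
      step (i , φz) = i , closer , z , φz
        where
        closer : φ x ! i ≢ φ y ! i
        closer eq = ℕ.<-irrefl refl (ℕ.≤-trans (ℕ.≤-reflexive (cong suc (trans (sym
          (ham-flip′ i (φ x) (φ y) eq)) (trans (cong (λ S → ham S (φ y)) (sym φz)) (sym (to-cube dist-p))))))
          (ℕ.≤-trans (ℕ.≤-reflexive (trans len (to-cube dist))) (ℕ.n≤1+n _)))

-- Antipodal subgraphs are the symmetric faces

module Antipodality {G : Graph} {n} {𝒯 : Topes n} (iso : Isometric 𝒯) (M : Model G 𝒯) where
  open Metric G
  open Model M
  open Distances iso M

  -- Faces are convex, which bounds the hull from above; geodesics give the converse in
  -- `between-hull`. So the hull of two vertices consists of the topes in the face that they span.
  hull-in-face : ∀ {H x y} → IsConvexHull (λ z → z ≡ x ⊎ z ≡ y) H → ∀ {z} → H z → agree (φ x) (φ y) ≼ φ z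
  hull-in-face {H} {x} {y} hull {z} h = smallest (λ v → X ≼ φ v) (closed⇒convex (≼-closed X)) ends h
    where
    open IsConvexHull hull
    X : SignVector n
    X = agree (φ x) (φ y)
    ends : ∀ {z} → z ≡ x ⊎ z ≡ y → X ≼ φ z
    ends (inj₁ refl) = agree-≼ˡ (φ x) (φ y)
    ends (inj₂ refl) = agree-≼ (φ x) (φ y) (φ y) (λ i eq → sym eq)

  hull-between : ∀ {H x y} → IsConvexHull (λ z → z ≡ x ⊎ z ≡ y) H → ∀ {z} → H z → Between (φ x) (φ y) (φ z)
  hull-between {x = x} {y} hull {z} h = ≼-agree (φ x) (φ y) (φ z) (hull-in-face hull h)

  between-hull : ∀ {H x y} → IsConvexHull (λ z → z ≡ x ⊎ z ≡ y) H → ∀ {z} → Between (φ x) (φ y) (φ z) → H z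
  between-hull hull btw =
    let (p , short , on) = between⇒on btw in convex (contains (inj₁ refl)) (contains (inj₂ refl)) p short on
    where open IsConvexHull hull

  ag⇒gating : (∀ H → Antipodal H → Gated H) → Gating 𝒯
  ag⇒gating gated {X} (symmetric {P} p X≼P flips) {T} t = subst 𝒯 (lookup-ext gate-at) (φ∈ gate)
    where
    H : Pred (Vertex G) 0ℓ
    H v = X ≼ φ v
    antipode : ∀ {x} → H x → ∃[ y ] φ y ≡ X ▷ - φ x
    antipode {x} h = surjective (flips (φ∈ x) h)
    antipode-H : ∀ {x y} → φ y ≡ X ▷ - φ x → H y
    antipode-H {x} eq i = trans (cong (_! _) eq) (≼-▷ X (- φ x) i)
    opposite-at : ∀ {x y i} → φ y ≡ X ▷ - φ x → X ! i ≡ nothing → φ y ! i ≡ opposite (φ x ! i)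
    opposite-at {x} {i = i} eq Xi = trans (cong (_! i) eq) (trans (▷-nothing X Xi) (lookup-- (φ x) i))
    antipodal : Antipodal H
    antipodal = record
      { nonempty = proj₁ (surjective p) , λ eq → trans (cong (_! _) (proj₂ (surjective p))) (X≼P eq)
      ; antipode = λ {x} hx → let (y , eq) = antipode {x} hx ; hy = λ {i} {s} → antipode-H {x} {y} eq {i} {s} in y , hy , record
        { convex   = closed⇒convex (≼-closed X)
        ; contains = λ { (inj₁ refl) → hx ; (inj₂ refl) → hy }
        ; smallest = λ D conv ⊆D {z} hz → let (q , short , on) = between⇒on {x} {y} {z} (btw eq (λ {i} → hx {i}) (λ {i} → hz {i}))
                                        in conv (⊆D (inj₁ refl)) (⊆D (inj₂ refl)) q short on } }
      where
      btw : ∀ {x y z} → φ y ≡ X ▷ - φ x → H x → H z → Between (φ x) (φ y) (φ z)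
      btw {x} {y} {z} eq hx hz i xy with zero? X i
      ... | inj₁ Xi       = contradiction (trans (sym (opposite-at {x} {y} eq Xi)) (sym xy)) opposite≢
      ... | inj₂ (_ , Xi) = trans (hz Xi) (sym (hx Xi))
    v : Vertex G
    v = proj₁ (surjective t)
    gated-v : ∃[ g ] (H g × (∀ {y} → H y → Σ (Walk v y) λ q → Shortest q × g On q))
    gated-v = gated H antipodal v
    gate : Vertex G
    gate = proj₁ gated-v
    gate-H : H gate
    gate-H = proj₁ (proj₂ gated-v)
    between-gate : ∀ {y} → H y → Between (φ v) (φ y) (φ gate)
    between-gate hy = let (q , short , on) = proj₂ (proj₂ gated-v) hy in on⇒between q short on
    gate-at : ∀ i → φ gate ! i ≡ (X ▷ T) ! i
    gate-at i with zero? X i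
    ... | inj₂ (_ , Xi) = trans (gate-H Xi) (sym (▷-just X Xi))
    ... | inj₁ Xi with φ gate ! i Sign.≟ φ v ! i
    ... | yes eq = trans eq (trans (cong (_! i) (proj₂ (surjective t))) (sym (▷-nothing X Xi)))
    -- If the gate differed from v at a zero i of X, the antipode of the gate would agree with v at
    -- i, and no geodesic from v to that antipode could pass through the gate.
    ... | no neq   = contradiction (between-gate {proj₁ y} (λ {i} → antipode-H {gate} {proj₁ y} (proj₂ y) {i}) i
            (trans (≢⇒opposite neq) (sym (opposite-at {gate} {proj₁ y} (proj₂ y) Xi)))) neq
      where y = antipode {gate} (λ {i} → gate-H {i})

  gating⇒ag : Gating 𝒯 → ∀ H → Antipodal H → Gated H
  gating⇒ag gate H anti v = g , g∈H , λ {y} hy → between⇒on (btw hy)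
    where
    open Antipodal anti
    x : Vertex G
    x = proj₁ nonempty
    x∈ : H x
    x∈ = proj₂ nonempty
    y : Vertex G
    y = proj₁ (antipode x∈)
    hull : IsConvexHull (λ z → z ≡ x ⊎ z ≡ y) H
    hull = proj₂ (proj₂ (antipode x∈))
    X : SignVector n
    X = agree (φ x) (φ y)
    face⇒H : ∀ {z} → X ≼ φ z → H z
    face⇒H {z} X≼z = between-hull hull (≼-agree (φ x) (φ y) (φ z) X≼z)
    flips : ∀ {T} → 𝒯 T → X ≼ T → 𝒯 (X ▷ - T)
    flips {T} t X≼T with surjective t
    ... | z , refl with antipode (face⇒H {z} X≼T)
    ... | w , w∈ , hull′ = subst 𝒯 (lookup-ext at) (φ∈ w)
      where
      at : ∀ i → φ w ! i ≡ (X ▷ - φ z) ! i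
      at i with φ x ! i Sign.≟ φ y ! i
      ... | yes eq = trans (hull-in-face hull w∈ (agree-just (φ x) (φ y) eq)) (sym (▷-just X (agree-just (φ x) (φ y) eq)))
      -- The hull of z and w contains x and y, so agreement of z and w at i would force x and y to
      -- agree there.
      ... | no neq = trans (≢⇒opposite z≢w) (sym (trans (▷-nothing X (agree-nothing (φ x) (φ y) neq)) (lookup-- (φ z) i)))
        where
        z≢w : φ z ! i ≢ φ w ! i
        z≢w eq = neq (trans (hull-between hull′ x∈ i eq) (sym (hull-between hull′ (proj₁ (proj₂ (antipode x∈))) i eq)))
    gate-tope : 𝒯 (X ▷ φ v)
    gate-tope = gate (symmetric (φ∈ x) (agree-≼ˡ (φ x) (φ y)) flips) (φ∈ v)
    g : Vertex G
    g = proj₁ (surjective gate-tope)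
    φg : φ g ≡ X ▷ φ v
    φg = proj₂ (surjective gate-tope)
    g∈H : H g
    g∈H = face⇒H {g} (λ eq → trans (cong (_! _) φg) (≼-▷ X (φ v) eq))
    btw : ∀ {z} → H z → Between (φ v) (φ z) (φ g)
    btw {z} hz i eq with zero? X i
    ... | inj₁ Xi       = trans (cong (_! i) φg) (▷-nothing X Xi)
    ... | inj₂ (_ , Xi) = trans (cong (_! i) φg) (trans (▷-just X Xi) (trans (sym (hull-in-face hull hz Xi)) (sym eq)))

-- Θ-classes are the coordinates

flip-unique : ∀ {n} {i j : Fin n} {S} → flip i S ≡ flip j S → i ≡ j
flip-unique {i = i} {j} {S} eq with i Fin.≟ j
... | yes i≡j = i≡j
... | no i≢j  = contradiction (trans (sym (flip-≡ i S)) (trans (cong (_! i) eq) (flip-≢ i≢j S))) opposite≢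

flip-comm : ∀ {n} {i j : Fin n} S → i ≢ j → flip i (flip j S) ≡ flip j (flip i S)
flip-comm {i = i} {j} S i≢j = sym (updateAt-commutes j i (i≢j ∘ sym) S)

-- Since i ≠ j, flipping i changes the distances from S to U and to `flip j U` by the same amount.
ham-flip-flip : ∀ {n} {i j : Fin n} S U → i ≢ j →
                ham S U + ham (flip i S) (flip j U) ≡ ham S (flip j U) + ham (flip i S) U
ham-flip-flip {i = i} {j} S U i≢j with S ! i Sign.≟ U ! i
... | yes eq = begin
  ham S U + ham (flip i S) (flip j U)   ≡⟨ cong (ham S U +_) (ham-flip′ i S (flip j U) (trans eq (sym (flip-≢ i≢j U)))) ⟩
  ham S U + suc (ham S (flip j U))      ≡⟨ solve 2 (λ a b → a :+ (con 1 :+ b) := b :+ (con 1 :+ a)) refl (ham S U) (ham S (flip j U)) ⟩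
  ham S (flip j U) + suc (ham S U)      ≡⟨ cong (ham S (flip j U) +_) (ham-flip′ i S U eq) ⟨
  ham S (flip j U) + ham (flip i S) U   ∎
  where open ≡-Reasoning
        open +-*-Solver
... | no neq = begin
  ham S U + ham (flip i S) (flip j U)
    ≡⟨ cong (_+ ham (flip i S) (flip j U)) (ham-flip i S U neq) ⟨
  suc (ham (flip i S) U) + ham (flip i S) (flip j U)
    ≡⟨ solve 2 (λ a b → (con 1 :+ a) :+ b := (con 1 :+ b) :+ a) refl (ham (flip i S) U) (ham (flip i S) (flip j U)) ⟩
  suc (ham (flip i S) (flip j U)) + ham (flip i S) U
    ≡⟨ cong (_+ ham (flip i S) U) (ham-flip i S (flip j U) (λ eq → neq (trans eq (flip-≢ i≢j U)))) ⟩
  ham S (flip j U) + ham (flip i S) U   ∎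
  where open ≡-Reasoning
        open +-*-Solver

-- The two sums differ by exactly two, and which one is larger depends on whether S and U are on the
-- same side of i.
ham-flip-same : ∀ {n} (i : Fin n) S U →
                ham S U + ham (flip i S) (flip i U) ≢ ham S (flip i U) + ham (flip i S) U
ham-flip-same i S U eq with S ! i Sign.≟ U ! i
... | yes p = ℕ.m≢1+n+m _ {1} (trans eq (trans (cong₂ _+_ (sym (ham-flip i S (flip i U) Si≢)) (ham-flip′ i S U p))
      (solve 2 (λ a b → (con 1 :+ b) :+ (con 1 :+ a) := con 2 :+ (a :+ b)) refl (ham S U) (ham (flip i S) (flip i U)))))
  where
  open +-*-Solver
  Si≢ : S ! i ≢ flip i U ! i
  Si≢ q = opposite≢ (trans (sym (flip-≡ i U)) (trans (sym q) p))
... | no p = ℕ.m≢1+n+m _ {1} (trans (sym eq) (trans (cong₂ _+_ (sym (ham-flip i S U p))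
      (ham-flip′ i S (flip i U) (trans (sym (opposite-involutive (S ! i))) (trans (cong opposite (sym (≢⇒opposite p))) (sym (flip-≡ i U))))))
      (solve 2 (λ a b → (con 1 :+ b) :+ (con 1 :+ a) := con 2 :+ (a :+ b)) refl (ham S (flip i U)) (ham (flip i S) U))))
  where open +-*-Solver

-- A geodesic from S to T has to flip f somewhere. This is how a coordinate that varies on 𝒯 is
-- realised by a Θ-class.
crossing-edge : ∀ {n} {𝒯 : Topes n} → Isometric 𝒯 → ∀ {f S T} → 𝒯 S → 𝒯 T → S ! f ≢ T ! f →
                ∃[ R ] (𝒯 R × R ! f ≡ S ! f × 𝒯 (flip f R))
crossing-edge {n} {𝒯} iso {f} {S} {T} s t neq = go S (<-wellFounded _) s neq
  where
  go : ∀ R → Acc _<_ (ham R T) → 𝒯 R → R ! f ≢ T ! f → ∃[ R′ ] (𝒯 R′ × R′ ! f ≡ R ! f × 𝒯 (flip f R′))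
  go R (acc rs) r Rf≢ with iso R T r t (λ { refl → Rf≢ refl })
  ... | i , Ri≢ , r′ with i Fin.≟ f
  ... | yes refl = R , r , refl , r′
  ... | no i≢f with go (flip i R) (rs (ℕ.≤-reflexive (ham-flip i R T Ri≢))) r′
                      (λ eq → Rf≢ (trans (sym (flip-≢ (i≢f ∘ sym) R)) eq))
  ... | R′ , r″ , eq , fr = R′ , r″ , trans eq (flip-≢ (i≢f ∘ sym) R) , fr

module Classes {G : Graph} {n} {𝒯 : Topes n} (iso : Isometric 𝒯) (M : Model G 𝒯) where
  open Theta G
  open Metric G
  open Model M
  open Distances iso M
  private module Γ = Graph G

  coord : Edge → Fin n
  coord (edge a) = proj₁ (~⇒flip a)

  coord-flip : ∀ f → φ (Edge.head f) ≡ flip (coord f) (φ (Edge.tail f))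
  coord-flip (edge a) = proj₂ (~⇒flip a)

  coord-unique : ∀ {x y i} (e : x Γ.~ y) → φ y ≡ flip i (φ x) → coord (edge e) ≡ i
  coord-unique e eq = flip-unique (trans (sym (coord-flip (edge e))) eq)

  Θ⇒coord : ∀ f g → f Θ g → coord f ≡ coord g
  Θ⇒coord f@(edge {x} {y} a) g@(edge {u} {v} b) (_ , _ , _ , _ , xu , yv , xv , yu , neq)
    with coord f Fin.≟ coord g
  ... | yes eq = eq
  ... | no i≢j = contradiction (begin
    _ ≡⟨ cong₂ _+_ (dist⇒d xu) (dist⇒d yv) ⟩
    ham (φ x) (φ u) + ham (φ y) (φ v)
      ≡⟨ cong₂ (λ S T → ham (φ x) (φ u) + ham S T) (coord-flip f) (coord-flip g) ⟩
    ham (φ x) (φ u) + ham (flip (coord f) (φ x)) (flip (coord g) (φ u))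
      ≡⟨ ham-flip-flip (φ x) (φ u) i≢j ⟩
    ham (φ x) (flip (coord g) (φ u)) + ham (flip (coord f) (φ x)) (φ u)
      ≡⟨ cong₂ (λ T S → ham (φ x) T + ham S (φ u)) (coord-flip g) (coord-flip f) ⟨
    ham (φ x) (φ v) + ham (φ y) (φ u) ≡⟨ cong₂ _+_ (dist⇒d xv) (dist⇒d yu) ⟨
    _ ∎) neq
    where open ≡-Reasoning

  coord⇒Θ : ∀ f g → coord f ≡ coord g → f Θ g
  coord⇒Θ f@(edge {x} {y} a) g@(edge {u} {v} b) i≡j = _ , _ , _ , _ , dist , dist , dist , dist , λ eq →
    ham-flip-same (coord f) (φ x) (φ u) (begin
      ham (φ x) (φ u) + ham (flip (coord f) (φ x)) (flip (coord f) (φ u))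
        ≡⟨ cong₂ (λ S T → ham (φ x) (φ u) + ham S T) (coord-flip f) φv ⟨
      ham (φ x) (φ u) + ham (φ y) (φ v)   ≡⟨ eq ⟩
      ham (φ x) (φ v) + ham (φ y) (φ u)
        ≡⟨ cong₂ (λ T S → ham (φ x) T + ham S (φ u)) φv (coord-flip f) ⟩
      ham (φ x) (flip (coord f) (φ u)) + ham (flip (coord f) (φ x)) (φ u) ∎)
    where
    open ≡-Reasoning
    φv : φ v ≡ flip (coord f) (φ u)
    φv = trans (coord-flip g) (cong (λ i → flip i (φ u)) (sym i≡j))

  inClass⇒flip : ∀ {f x y} → InClass f x y → φ y ≡ flip (coord f) (φ x)
  inClass⇒flip {f} {x} (e , θ) = trans (coord-flip (edge e)) (cong (λ i → flip i (φ x)) (sym (Θ⇒coord f (edge e) θ)))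

  flip⇒inClass : ∀ {f x y} → φ y ≡ flip (coord f) (φ x) → InClass f x y
  flip⇒inClass {f} eq = flip⇒~ eq , coord⇒Θ f (edge (flip⇒~ eq)) (sym (coord-unique (flip⇒~ eq) eq))

  notInClass⇒same : ∀ {f x y} → NotInClass f x y → φ y ! coord f ≡ φ x ! coord f
  notInClass⇒same {f} {x} (e , ¬θ) = trans (cong (_! coord f) (coord-flip (edge e)))
    (flip-≢ (λ eq → ¬θ (coord⇒Θ f (edge e) eq)) (φ x))

  halfspace⇒sign : ∀ f {x} → Halfspace f x → φ x ! coord f ≡ φ (Edge.tail f) ! coord f
  halfspace⇒sign f = go
    where
    go : ∀ {x y} → Star (NotInClass f) x y → φ y ! coord f ≡ φ x ! coord f
    go ε       = refl
    go (s ◅ p) = trans (go p) (notInClass⇒same s)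

  -- A geodesic between vertices with equal signs at the coordinate of f never flips it, hence
  -- avoids the class.
  sign⇒halfspace : ∀ f {x} → φ x ! coord f ≡ φ (Edge.tail f) ! coord f → Halfspace f x
  sign⇒halfspace f {x} eq = go _ refl (sym eq)
    where
    go : ∀ {w} k → d w x ≡ k → φ w ! coord f ≡ φ x ! coord f → Star (NotInClass f) w x
    go zero    dwx _ with d≡0 dwx
    ... | refl = ε
    go {w} (suc k) dwx same with toward {w} {x} dwx
    ... | j , neq , z , φz , dzx =
      (flip⇒~ φz , λ θ → neq (subst (λ i → φ w ! i ≡ φ x ! i)
        (trans (Θ⇒coord f (edge (flip⇒~ φz)) θ) (coord-unique (flip⇒~ φz) φz)) same))
      ◅ go k dzx (trans (trans (cong (_! coord f) φz) (flip-≢ coord≢ (φ w))) same)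
      where
      coord≢ : coord f ≢ j
      coord≢ refl = neq same

-- Models of isomorphic and induced graphs

≅-sym : ∀ {G H} → G ≅ H → H ≅ G
≅-sym {G} {H} iso = record
  { bijection = mk↔ₛ′ from to I.strictlyInverseʳ I.strictlyInverseˡ
  ; adjacency = λ {x} {y} → mk⇔
      (λ e → Equivalence.from adjacency (subst₂ (Graph._~_ H) (sym (I.strictlyInverseˡ x)) (sym (I.strictlyInverseˡ y)) e))
      (λ e → subst₂ (Graph._~_ H) (I.strictlyInverseˡ x) (I.strictlyInverseˡ y) (Equivalence.to adjacency e))
  }
  where
  open _≅_ iso
  module I = Inverse bijection

model-≅ : ∀ {G H n} {𝒯 : Topes n} → H ≅ G → Model G 𝒯 → Model H 𝒯
model-≅ {G} {H} iso M = record
  { φ = φ ∘ to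
  ; φ∈ = φ∈ ∘ to
  ; injective = λ {x} {y} eq → trans (sym (I.strictlyInverseʳ x)) (trans (cong from (injective eq)) (I.strictlyInverseʳ y))
  ; surjective = λ t → let (x , eq) = surjective t in from x , trans (cong φ (I.strictlyInverseˡ x)) eq
  ; adjacent = mk⇔ (Equivalence.to adjacent ∘ Equivalence.to adjacency) (Equivalence.from adjacency ∘ Equivalence.from adjacent)
  }
  where
  open _≅_ iso
  open Model M
  module I = Inverse bijection

model-unique : ∀ {G H n} {𝒯 : Topes n} → Model G 𝒯 → Model H 𝒯 → G ≅ H
model-unique {G} {H} M N = record
  { bijection = mk↔ₛ′ there back
      (λ y → N.injective (trans (φ-there (back y)) (φ-back y)))
      (λ x → M.injective (trans (φ-back (there x)) (φ-there x)))
  ; adjacency = λ {x} {y} → mk⇔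
      (λ e → Equivalence.from N.adjacent (subst₂ _∼_ (sym (φ-there x)) (sym (φ-there y)) (Equivalence.to M.adjacent e)))
      (λ e → Equivalence.from M.adjacent (subst₂ _∼_ (φ-there x) (φ-there y) (Equivalence.to N.adjacent e)))
  }
  where
  module M = Model M
  module N = Model N
  there : Vertex G → Vertex H
  there x = proj₁ (N.surjective (M.φ∈ x))
  φ-there : ∀ x → N.φ (there x) ≡ M.φ x
  φ-there x = proj₂ (N.surjective (M.φ∈ x))
  back : Vertex H → Vertex G
  back y = proj₁ (M.surjective (N.φ∈ y))
  φ-back : ∀ y → M.φ (back y) ≡ N.φ y
  φ-back y = proj₂ (M.surjective (N.φ∈ y))

model-induced : ∀ {G n} {𝒯 C : Topes n} {P} → (M : Model G 𝒯) → Decidable C →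
                (∀ x → P x ⇔ C (Model.φ M x)) → Model (G [ P ]) (𝒯 ∩ C)
model-induced {C = C} {P} M C? P⇔C = record
  { φ = φ ∘ value
  ; φ∈ = λ { (x , irr p) → φ∈ x , recompute (C? (φ x)) (Equivalence.to (P⇔C x) p) }
  ; injective = λ eq → value-injective (injective eq)
  ; surjective = λ { (t , c) → let (x , eq) = surjective t in
      (x , irr (Equivalence.from (P⇔C x) (subst C (sym eq) c))) , eq }
  ; adjacent = adjacent
  }
  where
  open Model M

⟦_⟧ : ∀ {n} → Topes n → Graph
⟦_⟧ {n} 𝒯 = Q n [ 𝒯 ]

model-⟦⟧ : ∀ {n} {𝒯 : Topes n} → Decidable 𝒯 → Model ⟦ 𝒯 ⟧ 𝒯
model-⟦⟧ {n} {𝒯} 𝒯? = record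
  { φ = value
  ; φ∈ = λ { (T , irr t) → recompute (𝒯? T) t }
  ; injective = value-injective
  ; surjective = λ {T} t → (T , irr t) , refl
  ; adjacent = mk⇔ (λ e → e) (λ e → e)
  }

-- Restrictions

module Restriction {G : Graph} {n} {𝒯 : Topes n} (iso : Isometric 𝒯) (M : Model G 𝒯) where
  open Theta G
  open Model M
  open Classes iso M

  Signs : List Edge → Topes n
  Signs fs T = All (λ f → At (coord f) (φ (Edge.tail f) ! coord f) T) fs

  signs? : ∀ fs → Decidable (Signs fs)
  signs? fs T = All.all? (λ f → T ! coord f Sign.≟ _) fs

  signs-closed : ∀ fs → BetweenClosed (Signs fs)
  signs-closed []       S T U _        _        btw = []
  signs-closed (f ∷ fs) S T U (s ∷ ss) (t ∷ ts) btw = At-closed S T U s t btw ∷ signs-closed fs S T U ss ts btw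

  intersection⇔signs : ∀ fs x → Intersection fs x ⇔ Signs fs (φ x)
  intersection⇔signs fs x = mk⇔ (All.map (λ {f} → halfspace⇒sign f)) (All.map (λ {f} → sign⇒halfspace f))

  restriction-model : ∀ {H} → IsRestriction H → ∃[ fs ] Model H (𝒯 ∩ Signs fs)
  restriction-model (fs , _ , H≅) = fs , model-≅ H≅ (model-induced M (signs? fs) (intersection⇔signs fs))

  trivial-restriction : ∀ {C} → Decidable 𝒯 → Decidable C → (∀ {T} → 𝒯 T → C T) → IsRestriction ⟦ 𝒯 ∩ C ⟧
  trivial-restriction 𝒯? C? all = [] , [] , model-unique (model-⟦⟧ (λ T → 𝒯? T ×-dec C? T))
    (model-induced M C? (λ x → mk⇔ (λ _ → all (φ∈ x)) (λ _ → [])))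

  -- If f does not vary on 𝒯, no edge represents it and the empty intersection of halfspaces does
  -- the job. Otherwise a crossing edge is oriented with its tail on side s.
  At-restriction : Decidable 𝒯 → ∀ {f s S} → (𝒯 ∩ At f s) S → IsRestriction ⟦ 𝒯 ∩ At f s ⟧
  At-restriction 𝒯? {f} {s} {S} (s∈ , Sf) with anyTope? (λ T → 𝒯? T ×-dec ¬? (T ! f Sign.≟ s))
  ... | no none = trivial-restriction 𝒯? (λ T → T ! f Sign.≟ s)
          (λ {T} t → decidable-stable (T ! f Sign.≟ s) (λ neq → none (T , t , neq)))
  ... | yes (T , t , Tf≢) with crossing-edge iso {f} {S} {T} s∈ t (λ eq → Tf≢ (trans (sym eq) Sf))
  ... | R , r , Rf , r′ = via (surjective r) (surjective r′)
    where
    via : ∃[ x ] φ x ≡ R → ∃[ y ] φ y ≡ flip f R → IsRestriction ⟦ 𝒯 ∩ At f s ⟧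
    via (x , φx) (y , φy) = (e ∷ []) , ([] ∷ []) , model-unique (model-⟦⟧ (λ T → 𝒯? T ×-dec (T ! f Sign.≟ s)))
      (model-induced M (λ T → T ! f Sign.≟ s) (λ z → mk⇔
        (λ { (h ∷ []) → trans (subst (λ i → φ z ! i ≡ φ x ! i) coord≡f (halfspace⇒sign e h)) xf })
        (λ zf → sign⇒halfspace e (subst (λ i → φ z ! i ≡ φ x ! i) (sym coord≡f) (trans zf (sym xf))) ∷ [])))
      where
      y-flip : φ y ≡ flip f (φ x)
      y-flip = trans φy (cong (flip f) (sym φx))
      e : Edge
      e = edge (flip⇒~ {x} {y} y-flip)
      coord≡f : coord e ≡ f
      coord≡f = coord-unique (flip⇒~ {x} {y} y-flip) y-flip
      xf : φ x ! f ≡ s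
      xf = trans (cong (_! f) φx) (trans Rf Sf)

-- Contractions

module Contraction {G : Graph} {n} {𝒯 : Topes n} (iso : Isometric 𝒯) (M : Model G 𝒯) (f : Theta.Edge G) where
  open Theta G
  open Model M
  open Classes iso M
  private module Γ = Graph G

  g : Fin n
  g = coord f

  ψ : Vertex G → Vec Sign n
  ψ x = φ x [ g ]≔ plus

  class⇒ψ : ∀ {x y} → Star (InClass f) x y → ψ x ≡ ψ y
  class⇒ψ ε = refl
  class⇒ψ {x} (s ◅ p) = trans (sym (trans (cong (_[ g ]≔ plus) (inClass⇒flip s)) (flip-≔ g (φ x)))) (class⇒ψ p)

  ψ-off : ∀ {x y} → ψ x ≡ ψ y → AgreeOff g (φ x) (φ y)
  ψ-off {x} {y} eq i i≢g = trans (off-≔′ g (φ x) i i≢g) (trans (cong (_! i) eq) (off-≔ g (φ y) i i≢g))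

  ψ⇒class : ∀ {x y} → ψ x ≡ ψ y → Star (InClass f) x y
  ψ⇒class {x} {y} eq with ≡-or-flip {g = g} {φ x} {φ y} (ψ-off {x} {y} eq)
  ... | inj₁ same with injective same
  ... | refl = ε
  ψ⇒class {x} {y} eq | inj₂ φx = flip⇒inClass {f} (trans (sym (flip-involutive g (φ y))) (cong (flip g) (sym φx))) ◅ ε

  edge⇒ψ : ∀ {x y} → x Γ.~ y → ψ x ≢ ψ y → ψ x ∼ ψ y
  edge⇒ψ {x} {y} e neq with ~⇒flip e
  ... | j , φy = subst (ψ x ∼_) (sym ψy) (flip-adjacent j (ψ x))
    where
    j≢g : j ≢ g
    j≢g refl = neq (sym (trans (cong (_[ g ]≔ plus) φy) (flip-≔ g (φ x))))
    ψy : ψ y ≡ flip j (ψ x)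
    ψy = trans (cong (_[ g ]≔ plus) φy) (flip-≔-comm (φ x) j≢g)

  -- The chosen x and y may be on different sides of g, at distance two. The middle vertex of a
  -- geodesic between them then shares its image with x or with y and supplies the edge.
  ψ⇒edge : ∀ x y → ψ x ∼ ψ y →
           ∃[ x′ ] ∃[ y′ ] (ψ x′ ≡ ψ x × ψ y′ ≡ ψ y × x′ Γ.~ y′)
  ψ⇒edge x y adj with adjacent⇒flip (ψ x) (ψ y) adj
  ... | j , ψy = by-cases (≡-or-flip {g = g} {φ y} {flip j (φ x)} off)
    where
    j≢g : j ≢ g
    j≢g refl = opposite≢ (trans (sym (trans (cong (_! g) ψy) (flip-≡ g (ψ x))))
      (trans (lookup∘update g (φ y) plus) (sym (lookup∘update g (φ x) plus))))
    off : AgreeOff g (φ y) (flip j (φ x))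
    off i i≢g = begin
      φ y ! i                      ≡⟨ off-≔′ g (φ y) i i≢g ⟩
      ψ y ! i                      ≡⟨ cong (_! i) (trans ψy (sym (flip-≔-comm (φ x) j≢g))) ⟩
      (flip j (φ x) [ g ]≔ plus) ! i ≡⟨ off-≔ g (flip j (φ x)) i i≢g ⟩
      flip j (φ x) ! i             ∎
      where open ≡-Reasoning
    by-cases : φ y ≡ flip j (φ x) ⊎ φ y ≡ flip g (flip j (φ x)) →
               ∃[ x′ ] ∃[ y′ ] (ψ x′ ≡ ψ x × ψ y′ ≡ ψ y × x′ Γ.~ y′)
    by-cases (inj₁ eq) = x , y , refl , refl , flip⇒~ eq
    by-cases (inj₂ eq) = via (iso (φ x) (φ y) (φ∈ x) (φ∈ y) φx≢φy)
      where
      φx≢φy : φ x ≢ φ y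
      φx≢φy same = opposite≢ (trans (sym (trans (flip-≢ j≢g (flip j (φ x))) (flip-≡ j (φ x))))
        (trans (cong (_! j) (sym eq)) (cong (_! j) (sym same))))
      via : ∃[ i ] (φ x ! i ≢ φ y ! i × 𝒯 (flip i (φ x))) →
            ∃[ x′ ] ∃[ y′ ] (ψ x′ ≡ ψ x × ψ y′ ≡ ψ y × x′ Γ.~ y′)
      via (i , neq , t) with i Fin.≟ j | i Fin.≟ g | surjective t
      ... | yes refl | _ | y′ , φy′ = x , y′ , refl ,
        trans (cong (_[ g ]≔ plus) φy′) (sym (trans (cong (_[ g ]≔ plus) eq) (flip-≔ g (flip j (φ x))))) , flip⇒~ φy′
      ... | no _ | yes refl | x′ , φx′ = x′ , y , trans (cong (_[ g ]≔ plus) φx′) (flip-≔ g (φ x)) , refl ,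
        flip⇒~ (trans eq (trans (flip-comm (φ x) (j≢g ∘ sym)) (cong (flip j) (sym φx′))))
      ... | no i≢j | no i≢g | _ = contradiction
        (sym (trans (cong (_! i) eq) (trans (flip-≢ i≢g (flip j (φ x))) (flip-≢ i≢j (φ x))))) neq

  contraction-model : ∀ {H} → IsContraction f H → Model H (Con g 𝒯)
  contraction-model {H} con = record
    { φ = χ
    ; φ∈ = λ a → Con-intro {𝒯 = 𝒯} (φ∈ (pre a))
    ; injective = λ {a} {b} eq → trans (sym (π-pre a)) (trans (Equivalence.from identifies (ψ⇒class {pre a} {pre b} eq)) (π-pre b))
    ; surjective = λ { (S , s , refl) → let (x , φx) = surjective s in
        π x , trans (χ-π x) (cong (_[ g ]≔ plus) φx) }
    ; adjacent = λ {a} {b} → mk⇔ (to-edge a b) (from-edge a b)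
    }
    where
    open IsContraction con renaming (surjective to π-surjective)
    pre : H.Vertex → Vertex G
    pre a = proj₁ (π-surjective a)
    π-pre : ∀ a → π (pre a) ≡ a
    π-pre a = proj₂ (π-surjective a)
    χ : H.Vertex → Vec Sign n
    χ a = ψ (pre a)
    χ-π : ∀ x → χ (π x) ≡ ψ x
    χ-π x = class⇒ψ (Equivalence.to identifies (π-pre (π x)))
    to-edge : ∀ a b → a H.~ b → χ a ∼ χ b
    to-edge a b e with Equivalence.to adjacency e
    ... | a≢b , x , y , refl , refl , x~y = subst₂ _∼_ (sym (χ-π x)) (sym (χ-π y))
      (edge⇒ψ x~y (λ eq → a≢b (Equivalence.from identifies (ψ⇒class {x} {y} eq))))
    from-edge : ∀ a b → χ a ∼ χ b → a H.~ b
    from-edge a b adj with ψ⇒edge (pre a) (pre b) adj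
    ... | x , y , ψx , ψy , x~y = Equivalence.from adjacency
      ((λ { refl → Graph.~-irr (Q n) {χ a} refl adj }) , x , y , at x a ψx , at y b ψy , x~y)
      where
      at : ∀ x a → ψ x ≡ χ a → π x ≡ a
      at x a eq = trans (Equivalence.from identifies (ψ⇒class {x} {pre a} eq)) (π-pre a)

  model-contraction : ∀ {H} → Model H (Con g 𝒯) → IsContraction f H
  model-contraction {H} N = record
    { π = π
    ; surjective = λ a → onto a (N.φ∈ a)
    ; identifies = λ {x} {y} → mk⇔
        (λ eq → ψ⇒class {x} {y} (trans (sym (χ-π x)) (trans (cong N.φ eq) (χ-π y))))
        (λ p → N.injective (trans (χ-π x) (trans (class⇒ψ p) (sym (χ-π y)))))
    ; adjacency = λ {a} {b} → mk⇔ (to-edge a b) (from-edge a b)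
    }
    where
    module N = Model N
    π : Vertex G → Vertex H
    π x = proj₁ (N.surjective (Con-intro {𝒯 = 𝒯} (φ∈ x)))
    χ-π : ∀ x → N.φ (π x) ≡ ψ x
    χ-π x = proj₂ (N.surjective (Con-intro {𝒯 = 𝒯} (φ∈ x)))
    onto : ∀ a → Con g 𝒯 (N.φ a) → ∃[ x ] π x ≡ a
    onto a (S , s , eq) = let (x , φx) = surjective s in
      x , N.injective (trans (χ-π x) (trans (cong (_[ g ]≔ plus) φx) eq))
    to-edge : ∀ a b → Graph._~_ H a b → a ≢ b × ∃[ x ] ∃[ y ] (π x ≡ a × π y ≡ b × x Γ.~ y)
    to-edge a b e with onto a (N.φ∈ a) | onto b (N.φ∈ b)
    ... | x , refl | y , refl with ψ⇒edge x y (subst₂ _∼_ (χ-π x) (χ-π y) (Equivalence.to N.adjacent e))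
    ... | x′ , y′ , ψx , ψy , x~y = (λ eq → Graph.~-irr H eq e) , x′ , y′ ,
      N.injective (trans (χ-π x′) (trans ψx (sym (χ-π x)))) ,
      N.injective (trans (χ-π y′) (trans ψy (sym (χ-π y)))) , x~y
    from-edge : ∀ a b → a ≢ b × ∃[ x ] ∃[ y ] (π x ≡ a × π y ≡ b × x Γ.~ y) → Graph._~_ H a b
    from-edge _ _ (a≢b , x , y , refl , refl , x~y) = Equivalence.from N.adjacent
      (subst₂ _∼_ (sym (χ-π x)) (sym (χ-π y))
        (edge⇒ψ x~y (λ eq → a≢b (N.injective (trans (χ-π x) (trans eq (sym (χ-π y))))))))

-- Enumerations of decidable sets of coordinates

record Enumeration {n} (P : Fin n → Set) : Set where
  field
    {size} : ℕ
    ι      : Fin size → Fin n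
    ι∈     : ∀ j → P (ι j)
    ι-inj  : ∀ {i j} → ι i ≡ ι j → i ≡ j
    index  : ∀ {i} → P i → ∃[ j ] ι j ≡ i

enumerate : ∀ {n} {P : Fin n → Set} → (∀ i → Dec (P i)) → Enumeration P
enumerate {zero}  P? = record { size = 0 ; ι = λ () ; ι∈ = λ () ; ι-inj = λ { {()} } ; index = λ { {()} } }
enumerate {suc n} {P} P? with P? zero | enumerate (P? ∘ suc)
... | no ¬p | E = record
  { ι = suc ∘ ι ; ι∈ = ι∈ ; ι-inj = ι-inj ∘ Fin.suc-injective ; index = index′ }
  where
  open Enumeration E
  index′ : ∀ {i} → P i → ∃[ j ] suc (ι j) ≡ i
  index′ {zero}  p = contradiction p ¬p
  index′ {suc i} p = let (j , eq) = index p in j , cong suc eq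
... | yes p₀ | E = record
  { ι = ι′ ; ι∈ = ι′∈ ; ι-inj = ι′-inj ; index = index′ }
  where
  open Enumeration E
  ι′ : Fin (suc size) → Fin (suc n)
  ι′ zero    = zero
  ι′ (suc j) = suc (ι j)
  ι′∈ : ∀ j → P (ι′ j)
  ι′∈ zero    = p₀
  ι′∈ (suc j) = ι∈ j
  ι′-inj : ∀ {i j} → ι′ i ≡ ι′ j → i ≡ j
  ι′-inj {zero}  {zero}  _  = refl
  ι′-inj {suc i} {suc j} eq = cong suc (ι-inj (Fin.suc-injective eq))
  index′ : ∀ {i} → P i → ∃[ j ] ι′ j ≡ i
  index′ {zero}  p = zero , refl
  index′ {suc i} p = let (j , eq) = index p in suc j , cong suc eq

-- The face of c as a cube of dimension zeros c

module Expansion {n} (c : SignVector n) where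

  E : Enumeration (λ i → c ! i ≡ nothing)
  E = enumerate (λ i → is-nothing? (c ! i))

  open Enumeration E public renaming (size to dim)

  private
    value-at : ∀ {i} → Vec Sign dim → c ! i ≡ nothing ⊎ ∃[ s ] c ! i ≡ just s → Sign
    value-at w (inj₁ ci)      = w ! proj₁ (index ci)
    value-at w (inj₂ (s , _)) = s

  expand : Vec Sign dim → Vec Sign n
  expand w = tabulate (λ i → value-at w (zero? c i))

  compress : Vec Sign n → Vec Sign dim
  compress T = tabulate (λ j → T ! ι j)

  expand-ι : ∀ w j → expand w ! ι j ≡ w ! j
  expand-ι w j = trans (lookup∘tabulate _ (ι j)) (at (zero? c (ι j)))
    where
    at : (z : c ! ι j ≡ nothing ⊎ ∃[ s ] c ! ι j ≡ just s) → value-at w z ≡ w ! j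
    at (inj₁ ci)       = cong (w !_) (ι-inj (proj₂ (index ci)))
    at (inj₂ (s , ci)) = contradiction ci (nothing≢just (ι∈ j))

  ≼-expand : ∀ w → c ≼ expand w
  ≼-expand w {i} {s} ci = trans (lookup∘tabulate _ i) (at (zero? c i))
    where
    at : (z : c ! i ≡ nothing ⊎ ∃[ s ] c ! i ≡ just s) → value-at w z ≡ s
    at (inj₁ ci′)       = contradiction ci (nothing≢just ci′)
    at (inj₂ (r , ci′)) = just-injective (trans (sym ci′) ci)

  face-ext : ∀ {S T} → c ≼ S → c ≼ T → (∀ j → S ! ι j ≡ T ! ι j) → S ≡ T
  face-ext {S} {T} c≼S c≼T eq = lookup-ext at
    where
    at : ∀ i → S ! i ≡ T ! i
    at i with zero? c i
    ... | inj₂ (_ , ci) = trans (c≼S ci) (sym (c≼T ci))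
    ... | inj₁ ci with index ci
    ... | j , refl = eq j

  expand-compress : ∀ {T} → c ≼ T → expand (compress T) ≡ T
  expand-compress {T} c≼T = face-ext (≼-expand (compress T)) c≼T
    (λ j → trans (expand-ι (compress T) j) (lookup∘tabulate _ j))

  expand-injective : ∀ {v w} → expand v ≡ expand w → v ≡ w
  expand-injective {v} {w} eq = lookup-ext λ j →
    trans (sym (expand-ι v j)) (trans (cong (_! ι j) eq) (expand-ι w j))

  ≼-flip : ∀ {i T} → c ! i ≡ nothing → c ≼ T → c ≼ flip i T
  ≼-flip {i} {T} ci c≼T c′ = trans (flip-≢ (λ { refl → nothing≢just ci c′ }) T) (c≼T c′)

  expand-flip : ∀ j w → expand (flip j w) ≡ flip (ι j) (expand w)
  expand-flip j w = face-ext (≼-expand (flip j w)) (≼-flip {ι j} {expand w} (ι∈ j) (≼-expand w)) at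
    where
    at : ∀ k → expand (flip j w) ! ι k ≡ flip (ι j) (expand w) ! ι k
    at k with k Fin.≟ j
    ... | yes refl = trans (expand-ι (flip j w) j) (trans (flip-≡ j w)
                       (sym (trans (flip-≡ (ι j) (expand w)) (cong opposite (expand-ι w j)))))
    ... | no k≢j   = trans (expand-ι (flip j w) k) (trans (flip-≢ k≢j w)
                       (sym (trans (flip-≢ (k≢j ∘ ι-inj) (expand w)) (expand-ι w k))))

  expand-- : ∀ w → expand (- w) ≡ c ▷ - expand w
  expand-- w = face-ext (≼-expand (- w)) (≼-▷ c (- expand w)) λ j → begin
    expand (- w) ! ι j           ≡⟨ expand-ι (- w) j ⟩
    (- w) ! j                    ≡⟨ lookup-- w j ⟩
    opposite (w ! j)             ≡⟨ cong opposite (expand-ι w j) ⟨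
    opposite (expand w ! ι j)    ≡⟨ lookup-- (expand w) (ι j) ⟨
    (- expand w) ! ι j           ≡⟨ ▷-nothing c (ι∈ j) ⟨
    (c ▷ - expand w) ! ι j       ∎
    where open ≡-Reasoning

  expand-adjacent : ∀ {v w} → v ∼ w ⇔ expand v ∼ expand w
  expand-adjacent {v} {w} = mk⇔ there back
    where
    there : v ∼ w → expand v ∼ expand w
    there e with adjacent⇒flip v w e
    ... | j , refl = subst (expand v ∼_) (sym (expand-flip j v)) (flip-adjacent (ι j) (expand v))
    back : expand v ∼ expand w → v ∼ w
    back e with adjacent⇒flip (expand v) (expand w) e
    ... | i , eq with zero? c i
    ... | inj₂ (s , ci) = contradiction (trans (sym (flip-≡ i (expand v)))
            (trans (cong (_! i) (sym eq)) (trans (≼-expand w ci) (sym (≼-expand v ci))))) opposite≢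
    ... | inj₁ ci with index ci
    ... | j , refl = subst (v ∼_)
            (expand-injective (trans (expand-flip j v) (sym eq))) (flip-adjacent j v)

  subcube-model : ∀ {𝒯 P} → System c 𝒯 → (∀ w → P w ⇔ 𝒯 (expand w)) → Model (Q dim [ P ]) 𝒯
  subcube-model {𝒯} {P} sys P⇔ = record
    { φ = expand ∘ value
    ; φ∈ = λ { (w , irr p) → recompute (dec (expand w)) (Equivalence.to (P⇔ w) p) }
    ; injective = value-injective ∘ expand-injective
    ; surjective = λ {T} t → let eq = expand-compress {T} (base t) in
        (compress T , irr (Equivalence.from (P⇔ (compress T)) (subst 𝒯 (sym eq) t))) , eq
    ; adjacent = expand-adjacent
    }
    where
    open System sys

punctured⇒𝓠⁻ : ∀ {n} {c : SignVector n} {𝒯} → System c 𝒯 → Punctured c 𝒯 →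
               ∃[ X ] (𝓠⁻ X × Model X 𝒯)
punctured⇒𝓠⁻ {n} {c} {𝒯} sys pun = by-cases others
  where
  open System sys
  open Punctured pun
  open Expansion c
  v : Vec Sign dim
  v = compress ω
  expand-v : expand v ≡ ω
  expand-v = expand-compress {ω} c≼ω
  expand-v⁻ : expand (- v) ≡ c ▷ - ω
  expand-v⁻ = trans (expand-- v) (cong (λ T → c ▷ - T) expand-v)
  expand-nbr : ∀ j → expand (flip j v) ≡ flip (ι j) ω
  expand-nbr j = trans (expand-flip j v) (cong (flip (ι j)) expand-v)
  4≤dim : 4 ≤ dim
  4≤dim = Fin.injective⇒≤ {f = λ a → proj₁ (place a)} λ {a} {b} eq → Unique.lookup-injective zeros₄-distinct a b
    (trans (sym (proj₂ (place a))) (trans (cong ι eq) (proj₂ (place b))))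
    where
    place : ∀ a → ∃[ j ] ι j ≡ zeros₄ ! a
    place a = index (VecAll.lookup zeros₄-zero (∈-lookup a zeros₄))
  j₀ : Fin dim
  j₀ = proj₁ (index f-zero)
  expand-u : expand (flip j₀ v) ≡ flip f ω
  expand-u = trans (expand-nbr j₀) (cong (λ i → flip i ω) (proj₂ (index f-zero)))

  missing : ∀ {w U} → expand U ≡ w → ¬ 𝒯 w → ∀ {V} → 𝒯 (expand V) → V ≢ U
  missing eq w∉ t refl = w∉ (subst 𝒯 eq t)

  differs : ∀ {w U} → expand U ≡ w → ∀ {V} → V ≢ U → expand V ≢ w
  differs eq V≢U eq′ = V≢U (expand-injective (trans eq′ (sym eq)))

  by-cases : _ → ∃[ X ] (𝓠⁻ X × Model X 𝒯)
  by-cases (inj₁ (_ , all)) =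
    Q⁻* dim v (flip j₀ v) , q⁻* 4≤dim v (flip j₀ v) (flip-adjacent j₀ v) ,
    subcube-model sys λ w → mk⇔
      (λ { (w≢v⁻ , w≢u) → all (≼-expand w) (differs expand-v⁻ w≢v⁻) (differs expand-u w≢u) })
      (λ t → missing expand-v⁻ antipode∉ t , missing expand-u neighbour∉ t)
  by-cases (inj₂ (ω∉ , all)) =
    Q⁻⁻ dim v us , q⁻⁻ 4≤dim 1≤m m≤dim v us unique (VecAll.tabulate⁺ λ a → flip-adjacent (M.ι a) v) ,
    subcube-model sys λ w → mk⇔ (to w) (from w)
    where
    absent? : ∀ j → Dec (¬ 𝒯 (expand (flip j v)))
    absent? j = ¬? (dec (expand (flip j v)))
    module M = Enumeration (enumerate absent?)
    us : Vec (Vec Sign dim) M.size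
    us = tabulate (λ a → flip (M.ι a) v)
    1≤m : 1 ≤ M.size
    1≤m = nonempty (proj₁ (M.index {j₀} (neighbour∉ ∘ subst 𝒯 expand-u)))
      where
      nonempty : ∀ {m} → Fin m → 1 ≤ m
      nonempty {suc m} _ = s≤s z≤n
    m≤dim : M.size ≤ dim
    m≤dim = Fin.injective⇒≤ M.ι-inj
    unique = Unique.tabulate⁺ λ eq → M.ι-inj (flip-unique eq)
    to : ∀ w → w ≢ - v × w ≢ v × w ∉ us → 𝒯 (expand w)
    to w (w≢v⁻ , w≢v , w∉us) = decidable-stable (dec (expand w)) λ w∉ → w∉
      (all (≼-expand w) (differs expand-v⁻ w≢v⁻) (differs expand-v w≢v) (not-neighbour w∉))
      where
      not-neighbour : ¬ 𝒯 (expand w) → ∀ {b} → c ! b ≡ nothing → expand w ≢ flip b ω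
      not-neighbour w∉ cb eq with index cb
      ... | j , refl with expand-injective {w} {flip j v} (trans eq (sym (expand-nbr j)))
      ... | refl with M.index {j} w∉
      ... | a , refl = w∉us (∈-tabulate⁺ (λ a → flip (M.ι a) v) a)
    from : ∀ w → 𝒯 (expand w) → w ≢ - v × w ≢ v × w ∉ us
    from w t = missing expand-v⁻ antipode∉ t , missing expand-v ω∉ t , λ w∈ →
      let (a , eq) = VecAny.tabulate⁻ w∈ in M.ι∈ a (subst (𝒯 ∘ expand) eq t)

-- The members of 𝓠⁻ are not in AG

fresh : ∀ {m n} (is : Vec (Fin n) m) → m < n → ∃[ j ] (∀ a → j ≢ is ! a)
fresh {m} {n} is m<n with Fin.any? (λ j → Fin.all? (λ a → ¬? (j Fin.≟ is ! a)))
... | yes p = p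
... | no none = contradiction (Fin.injective⇒≤ {f = λ j → proj₁ (hit j)} inj) (ℕ.<⇒≱ m<n)
  where
  hit : ∀ j → ∃[ a ] j ≡ is ! a
  hit j with Fin.any? (λ a → j Fin.≟ is ! a)
  ... | yes p = p
  ... | no q  = contradiction (j , λ a eq → q (a , eq)) none
  inj : ∀ {i j} → proj₁ (hit i) ≡ proj₁ (hit j) → i ≡ j
  inj {i} {j} eq = trans (proj₂ (hit i)) (trans (cong (is !_) eq) (sym (proj₂ (hit j))))

module _ {n} (4≤n : 4 ≤ n) where

  fresh₃ : (i j k : Fin n) → ∃[ l ] (l ≢ i × l ≢ j × l ≢ k)
  fresh₃ i j k = let (l , p) = fresh (i ∷ j ∷ k ∷ []) 4≤n in l , p zero , p (suc zero) , p (suc (suc zero))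

  -- The facet opposite to v at i is a cube without the antipodal pair - v, u; the gate of - u would be - v.

  facet-not-gated : ∀ {𝒯 : Topes n} {v i} → ¬ 𝒯 (- v) → ¬ 𝒯 (flip i v) → 𝒯 (- (flip i v)) →
    (∀ {T} → T ! i ≢ v ! i → T ≢ - v → T ≢ flip i v → 𝒯 T) → ¬ Gating 𝒯
  facet-not-gated {𝒯} {v} {i} v⁻∉ u∉ u⁻∈ facet gate = v⁻∉ (subst 𝒯 (lookup-ext at) (gate face u⁻∈))
    where
    u : Vec Sign n
    u = flip i v
    X : SignVector n
    X = agree (- v) u
    v⁻i≡ui : (- v) ! i ≡ u ! i
    v⁻i≡ui = trans (lookup-- v i) (sym (flip-≡ i v))
    off : ∀ {k} → k ≢ i → (- v) ! k ≢ u ! k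
    off {k} k≢i eq = opposite≢ (trans (sym (lookup-- v k)) (trans eq (flip-≢ k≢i v)))
    Xi : X ! i ≡ just (opposite (v ! i))
    Xi = trans (agree-just (- v) u v⁻i≡ui) (cong just (lookup-- v i))
    at : ∀ k → (X ▷ - u) ! k ≡ (- v) ! k
    at k with k Fin.≟ i
    ... | yes refl = trans (▷-just X Xi) (sym (lookup-- v i))
    ... | no k≢i   = trans (▷-nothing X (agree-nothing (- v) u (off k≢i)))
      (trans (lookup-- u k) (trans (cong opposite (flip-≢ k≢i v)) (sym (lookup-- v k))))
    face : Symmetric 𝒯 X
    face with fresh₃ i i i
    ... | j , j≢i , _ with fresh₃ i j j
    ... | k , k≢i , k≢j , _ = missing-pair-symmetric {P = flip j u} v⁻∉ u∉
      (facet (λ eq → opposite≢ (trans (sym (trans (flip-≢ (j≢i ∘ sym) u) (flip-≡ i v))) eq))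
        (λ eq → off k≢i (trans (cong (_! k) (sym eq)) (flip-≢ k≢j u)))
        (λ eq → opposite≢ (trans (sym (flip-≡ j u)) (cong (_! j) eq))))
      (agree-≼ (- v) u (flip j u) flip-between)
      (λ W X≼W → facet (λ eq → opposite≢ (trans (sym (X≼W Xi)) eq)))
      where
      flip-between : Between (- v) u (flip j u)
      flip-between l eq with l Fin.≟ i
      ... | yes refl = trans (flip-≢ (j≢i ∘ sym) u) (sym eq)
      ... | no l≢i   = contradiction eq (off l≢i)

  -- If S cannot step towards T along i or j, then `two` shows that T is not the far corner of their
  -- square. Hence a third coordinate k separates S from T, and `three` makes the step along it
  -- possible.
  isometric-cube-minus : ∀ {𝒯 : Topes n} → Decidable 𝒯 →
    (∀ {S i j} → 𝒯 S → i ≢ j → ¬ 𝒯 (flip i S) → ¬ 𝒯 (flip j S) → ¬ 𝒯 (flip j (flip i S))) →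
    (∀ {S i j k} → 𝒯 S → i ≢ j → i ≢ k → j ≢ k → ¬ 𝒯 (flip i S) → ¬ 𝒯 (flip j S) → 𝒯 (flip k S)) →
    Isometric 𝒯
  isometric-cube-minus {𝒯} 𝒯? two three S T s t S≢T with differ S≢T
  ... | i , Si≢ with 𝒯? (flip i S)
  ... | yes s′ = i , Si≢ , s′
  ... | no i∉ with differ {S = flip i S} {T} (λ { refl → i∉ t })
  ... | j , j≢′ with 𝒯? (flip j S)
  ... | yes s′ = j , (λ eq → j≢′ (trans (flip-≢ j≢i S) eq)) , s′
    where
    j≢i : j ≢ i
    j≢i refl = j≢′ (trans (flip-≡ i S) (sym (≢⇒opposite Si≢)))
  ... | no j∉ with differ {S = flip j (flip i S)} {T} (λ { refl → two s (λ { refl → j≢′ (trans (flip-≡ i S) (sym (≢⇒opposite Si≢))) }) i∉ j∉ t })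
  ... | k , k≢′ = k , Sk≢ , three s (j≢i ∘ sym) (k≢i ∘ sym) (k≢j ∘ sym) i∉ j∉
    where
    j≢i : j ≢ i
    j≢i refl = j≢′ (trans (flip-≡ i S) (sym (≢⇒opposite Si≢)))
    k≢j : k ≢ j
    k≢j refl = k≢′ (trans (flip-≡ k (flip i S)) (sym (≢⇒opposite j≢′)))
    k≢i : k ≢ i
    k≢i refl = k≢′ (trans (flip-≢ k≢j (flip k S)) (trans (flip-≡ k S) (sym (≢⇒opposite Si≢))))
    Sk≢ : S ! k ≢ T ! k
    Sk≢ eq = k≢′ (trans (flip-≢ k≢j (flip i S)) (trans (flip-≢ k≢i S) eq))

  -- A neighbour of v has distance n - 1 ≥ 3 from -v, so the two cannot have S as a common
  -- neighbour.
  neighbours-antipode : ∀ {S v : Vec Sign n} {i j} → flip i S ≡ - v → ∀ l → flip j S ≢ flip l v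
  neighbours-antipode {S} {v} {i} {j} p l q with fresh₃ i j l
  ... | k , k≢i , k≢j , k≢l = opposite≢ (begin
    opposite (v ! k)  ≡⟨ lookup-- v k ⟨
    (- v) ! k         ≡⟨ cong (_! k) p ⟨
    flip i S ! k      ≡⟨ trans (flip-≢ k≢i S) (sym (flip-≢ k≢j S)) ⟩
    flip j S ! k      ≡⟨ cong (_! k) q ⟩
    flip l v ! k      ≡⟨ flip-≢ k≢l v ⟩
    v ! k             ∎)
    where open ≡-Reasoning

  antipode≢ : ∀ (v : Vec Sign n) i → - (flip i v) ≢ v
  antipode≢ v i eq with fresh₃ i i i
  ... | k , k≢i , _ = opposite≢ (trans (sym (trans (lookup-- (flip i v) k) (cong opposite (flip-≢ k≢i v)))) (cong (_! k) eq))

  antipode≢flip : ∀ (v : Vec Sign n) i l → - (flip i v) ≢ flip l v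
  antipode≢flip v i l eq with fresh₃ i l l
  ... | k , k≢i , k≢l , _ = opposite≢ (trans (sym (trans (lookup-- (flip i v) k) (cong opposite (flip-≢ k≢i v))))
    (trans (cong (_! k) eq) (flip-≢ k≢l v)))

  antipode≢antipode : ∀ (v : Vec Sign n) i → - (flip i v) ≢ - v
  antipode≢antipode v i eq = opposite≢ (trans (sym (flip-≡ i v)) (trans (sym (opposite-involutive (flip i v ! i)))
    (trans (cong opposite (trans (sym (lookup-- (flip i v) i)) (trans (cong (_! i) eq) (lookup-- v i)))) (opposite-involutive (v ! i)))))

  flips-equal : ∀ {S : Vec Sign n} {i j T} → flip i S ≡ T → flip j S ≡ T → i ≡ j
  flips-equal p q = flip-unique (trans p (sym q))

  module StarPunctured (v : Vec Sign n) (i : Fin n) where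

    P : Topes n
    P w = w ≢ - v × w ≢ flip i v

    P? : Decidable P
    P? w = ¬? (w ≟ᵛ - v) ×-dec ¬? (w ≟ᵛ flip i v)

    outside : ∀ {w} → ¬ P w → w ≡ - v ⊎ w ≡ flip i v
    outside {w} ¬p with w ≟ᵛ - v | w ≟ᵛ flip i v
    ... | yes p | _     = inj₁ p
    ... | no _  | yes q = inj₂ q
    ... | no p  | no q  = contradiction (p , q) ¬p

    no-two : ∀ {S j k} → j ≢ k → ¬ P (flip j S) → ¬ P (flip k S) → ⊥
    no-two j≢k a b with outside a | outside b
    ... | inj₁ p | inj₁ q = j≢k (flips-equal p q)
    ... | inj₂ p | inj₂ q = j≢k (flips-equal p q)
    ... | inj₁ p | inj₂ q = neighbours-antipode p i q
    ... | inj₂ p | inj₁ q = neighbours-antipode q i p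

    P-isometric : Isometric P
    P-isometric = isometric-cube-minus P? (λ {S} _ i≢j a b → contradiction b (no-two {S} i≢j a))
      (λ {S} _ i≢j _ _ a b → contradiction b (no-two {S} i≢j a))

    not-gated : ¬ Gating P
    not-gated = facet-not-gated (λ p → proj₁ p refl) (λ p → proj₂ p refl)
      (antipode≢antipode v i , antipode≢flip v i i) (λ _ p q → p , q)

  module NeighbourPunctured {m} (v : Vec Sign n) (us : Vec (Vec Sign n) m)
    (adj : VecAll.All (v ∼_) us) (i : Fin n) (u∈ : flip i v ∈ᵥ us) where

    P : Topes n
    P w = w ≢ - v × w ≢ v × w ∉ us

    P? : Decidable P
    P? w = ¬? (w ≟ᵛ - v) ×-dec ¬? (w ≟ᵛ v) ×-dec ¬? (DecMembership._∈?_ _≟ᵛ_ w us)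

    us⇒flip : ∀ {w} → w ∈ᵥ us → ∃[ l ] w ≡ flip l v
    us⇒flip w∈ = adjacent⇒flip v _ (VecAll.lookup adj w∈)

    outside : ∀ {w} → ¬ P w → w ≡ - v ⊎ w ≡ v ⊎ ∃[ l ] w ≡ flip l v
    outside {w} ¬p with w ≟ᵛ - v | w ≟ᵛ v | DecMembership._∈?_ _≟ᵛ_ w us
    ... | yes p | _     | _     = inj₁ p
    ... | no _  | yes q | _     = inj₂ (inj₁ q)
    ... | no _  | no _  | yes r = inj₂ (inj₂ (us⇒flip r))
    ... | no p  | no q  | no r  = contradiction (p , q , r) ¬p

    -- S is a neighbour of v, so its other neighbours have distance two from v; since n ≥ 4, none of
    -- them has been deleted.
    not-v : ∀ {S j k} → j ≢ k → flip j S ≡ v → ¬ P (flip k S) → ⊥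
    not-v {S} {j} {k} j≢k refl b with outside b
    ... | inj₂ (inj₁ q)       = j≢k (flips-equal {S} refl q)
    ... | inj₁ q with fresh₃ j k k
    ... | l , l≢j , l≢k , _ = opposite≢ (trans (sym (lookup-- (flip j S) l)) (trans (cong (_! l) (sym q))
            (trans (flip-≢ l≢k S) (sym (flip-≢ l≢j S)))))
    not-v {S} {j} {k} j≢k refl b | inj₂ (inj₂ (l , q)) with l Fin.≟ j
    ... | yes refl = opposite≢ (trans (sym (flip-≡ k S)) (cong (_! k) (trans q (flip-involutive l S))))
    ... | no l≢j   = opposite≢ (trans (sym (trans (flip-≢ (l≢j ∘ sym) (flip j S)) (flip-≡ j S)))
                       (trans (cong (_! j) (sym q)) (flip-≢ j≢k S)))

    -- -v is too far away and v is excluded by `not-v`, so both missing neighbours of S are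
    -- neighbours of v. As S is not v, it is the far corner of the square that they form with v.
    two-apart : ∀ {S j k} → P S → j ≢ k → ¬ P (flip j S) → ¬ P (flip k S) → S ≡ flip j (flip k v)
    two-apart {S} {j} {k} s j≢k a b with outside a | outside b
    ... | inj₁ p | inj₁ q              = contradiction (flips-equal p q) j≢k
    ... | inj₁ p | inj₂ (inj₂ (l , q)) = contradiction q (neighbours-antipode p l)
    ... | inj₂ (inj₂ (l , p)) | inj₁ q = contradiction p (neighbours-antipode q l)
    ... | inj₂ (inj₁ p) | _            = ⊥-elim (not-v j≢k p b)
    ... | _ | inj₂ (inj₁ q)            = ⊥-elim (not-v (j≢k ∘ sym) q a)
    ... | inj₂ (inj₂ (l , p)) | inj₂ (inj₂ (l′ , q)) =
      trans (sym (flip-involutive j S)) (cong (flip j) (trans p (cong (λ x → flip x v) l≡k)))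
      where
      S≡ : S ≡ flip k (flip l′ v)
      S≡ = trans (sym (flip-involutive k S)) (cong (flip k) q)
      Sk : S ! k ≡ flip l v ! k
      Sk = trans (sym (flip-≢ (j≢k ∘ sym) S)) (cong (_! k) p)
      l′≢k : l′ ≢ k
      l′≢k refl = proj₁ (proj₂ s) (trans S≡ (flip-involutive k v))
      l≡k : l ≡ k
      l≡k with k Fin.≟ l
      ... | yes eq = sym eq
      ... | no k≢l = contradiction (trans (sym (trans (flip-≡ k (flip l′ v)) (cong opposite (flip-≢ (l′≢k ∘ sym) v))))
                       (trans (cong (_! k) (sym S≡)) (trans Sk (flip-≢ k≢l v)))) opposite≢

    P-isometric : Isometric P
    P-isometric = isometric-cube-minus P? two three
      where
      two : ∀ {S j k} → P S → j ≢ k → ¬ P (flip j S) → ¬ P (flip k S) → ¬ P (flip k (flip j S))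
      two {S} {j} {k} s j≢k a b p = proj₁ (proj₂ p) (trans (cong (flip k ∘ flip j) (two-apart s j≢k a b))
        (trans (cong (flip k) (flip-involutive j (flip k v))) (flip-involutive k v)))
      three : ∀ {S j k l} → P S → j ≢ k → j ≢ l → k ≢ l → ¬ P (flip j S) → ¬ P (flip k S) → P (flip l S)
      three {S} {j} {k} {l} s j≢k j≢l k≢l a b = decidable-stable (P? (flip l S)) λ d → opposite≢ (begin
        opposite (v ! l)             ≡⟨ flip-≡ l v ⟨
        flip l v ! l                 ≡⟨ flip-≢ (j≢l ∘ sym) (flip l v) ⟨
        flip j (flip l v) ! l        ≡⟨ cong (_! l) (two-apart s j≢l a d) ⟨
        S ! l                        ≡⟨ cong (_! l) (two-apart s j≢k a b) ⟩
        flip j (flip k v) ! l        ≡⟨ flip-≢ (j≢l ∘ sym) (flip k v) ⟩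
        flip k v ! l                 ≡⟨ flip-≢ (k≢l ∘ sym) v ⟩
        v ! l                        ∎)
        where open ≡-Reasoning

    not-gated : ¬ Gating P
    not-gated = facet-not-gated (λ p → proj₁ p refl) (λ p → proj₂ (proj₂ p) u∈)
      (antipode≢antipode v i , antipode≢ v i , λ w∈ → let (l , eq) = us⇒flip w∈ in antipode≢flip v i l eq)
      (λ {T} Ti≢ T≢v⁻ T≢u → T≢v⁻ , (λ { refl → Ti≢ refl }) , λ T∈ → elsewhere {T} Ti≢ T≢u (us⇒flip T∈))
      where
      elsewhere : ∀ {T} → T ! i ≢ v ! i → T ≢ flip i v → ∃[ l ] T ≡ flip l v → ⊥
      elsewhere Ti≢ T≢u (l , refl) with i Fin.≟ l
      ... | yes refl = T≢u refl
      ... | no i≢l   = Ti≢ (flip-≢ i≢l v)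

𝓠⁻⇒¬AG : ∀ {X} → 𝓠⁻ X → ¬ (∀ H → Metric.Antipodal X H → Metric.Gated X H)
𝓠⁻⇒¬AG (q⁻* 4≤n v u v~u) gated with adjacent⇒flip v u v~u
... | i , refl = not-gated (Antipodality.ag⇒gating P-isometric (model-⟦⟧ P?) gated)
  where open StarPunctured 4≤n v i
𝓠⁻⇒¬AG (q⁻⁻ 4≤n (s≤s _) _ v us@(u ∷ _) _ adj) gated with adjacent⇒flip v u (VecAll.head adj)
... | i , refl = not-gated (Antipodality.ag⇒gating P-isometric (model-⟦⟧ P?) gated)
  where open NeighbourPunctured 4≤n v us adj i (VecAny.here refl)

-- Tope graphs of COMs

multiply : ∀ {n} (X : SignVector n) {i j s t} → X ! i ≡ just s → X ! j ≡ just t → X ! i · X ! j ≡ just (s *ₛ t)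
multiply X p q rewrite p | q = refl

product-sign : ∀ {n} (X : SignVector n) {i j r} → X ! i · X ! j ≡ just r →
               ∃[ s ] (X ! i ≡ just s × X ! j ≡ just (s *ₛ r))
product-sign X {i} {j} eq with X ! i | X ! j
product-sign X refl | just plus  | just t     = plus , refl , refl
product-sign X refl | just minus | just plus  = minus , refl , refl
product-sign X refl | just minus | just minus = minus , refl , refl

module TopeGraph {n} {L : Pred (SignVector n) 0ℓ} (L? : Decidable L) (com : IsCOM L)
                 {m} (R : Representatives L m) where
  open Representatives R

  𝒮 : Pred (SignVector m) 0ℓ
  𝒮 = simplification L R

  𝒮? : Decidable 𝒮
  𝒮? Y = anySignVector? (λ X → L? X ×-dec ≡-dec (Maybe.≡-dec Sign._≟_) Y (tabulate (λ i → X ! ι i)))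

  private
    project : SignVector n → SignVector m
    project X = tabulate (λ i → X ! ι i)

    at : ∀ X {Y} i → Y ≡ project X → Y ! i ≡ X ! ι i
    at X i refl = lookup∘tabulate _ i

  𝒮-FS : FS 𝒮
  𝒮-FS {X′} {Y′} (X , x , X≡) (Y , y , Y≡) = X ⊙ neg Y , IsCOM.FS com x y , lookup-ext λ i → begin
    (X′ ⊙ neg Y′) ! i                           ≡⟨ lookup-zipWith _<∣>_ i X′ (neg Y′) ⟩
    (X′ ! i) <∣> (neg Y′ ! i)                   ≡⟨ cong (X′ ! i <∣>_) (lookup-map i (Maybe.map opposite) Y′) ⟩
    (X′ ! i) <∣> Maybe.map opposite (Y′ ! i)    ≡⟨ cong₂ (λ a b → a <∣> Maybe.map opposite b) (at X i X≡) (at Y i Y≡) ⟩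
    (X ! ι i) <∣> Maybe.map opposite (Y ! ι i)  ≡⟨ cong (X ! ι i <∣>_) (lookup-map (ι i) (Maybe.map opposite) Y) ⟨
    (X ! ι i) <∣> (neg Y ! ι i)                 ≡⟨ lookup-zipWith _<∣>_ (ι i) X (neg Y) ⟨
    (X ⊙ neg Y) ! ι i                           ≡⟨ at (X ⊙ neg Y) i refl ⟨
    project (X ⊙ neg Y) ! i                     ∎
    where open ≡-Reasoning

  𝒮-SE : SE 𝒮
  𝒮-SE {X′} {Y′} (X , x , X≡) (Y , y , Y≡) {e} sep
    with IsCOM.SE com x y (trans (sym (cong₂ _·_ (at X e X≡) (at Y e Y≡))) sep)
  ... | Z , z , Ze , off = project Z , (Z , z , refl) , trans (at Z e refl) Ze , off′
    where
    off′ : ∀ {f} → ¬ Sep X′ Y′ f → project Z ! f ≡ (X′ ⊙ Y′) ! f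
    off′ {f} ¬sep = begin
      project Z ! f             ≡⟨ at Z f refl ⟩
      Z ! ι f                   ≡⟨ off (λ s → ¬sep (trans (cong₂ _·_ (at X f X≡) (at Y f Y≡)) s)) ⟩
      (X ⊙ Y) ! ι f             ≡⟨ lookup-zipWith _<∣>_ (ι f) X Y ⟩
      (X ! ι f) <∣> (Y ! ι f)   ≡⟨ cong₂ _<∣>_ (at X f X≡) (at Y f Y≡) ⟨
      (X′ ! f) <∣> (Y′ ! f)     ≡⟨ lookup-zipWith _<∣>_ f X′ Y′ ⟨
      (X′ ⊙ Y′) ! f             ∎
      where open ≡-Reasoning

  product : ∀ {i j} → i ≢ j → ∀ r → ∃[ W ] (𝒮 W × W ! i · W ! j ≡ just r)
  product {i} {j} i≢j r with distinct i≢j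
  product {i} {j} i≢j plus  | X , _ , x , _ , p , _ =
    project X , (X , x , refl) , trans (cong₂ _·_ (at X i refl) (at X j refl)) p
  product {i} {j} i≢j minus | _ , Y , _ , y , _ , q =
    project Y , (Y , y , refl) , trans (cong₂ _·_ (at Y i refl) (at Y j refl)) q

  topes : Topes m
  topes T = 𝒮 (map just T)

  topes? : Decidable topes
  topes? T = 𝒮? (map just T)

  𝒮-⊙ : ∀ {X Y} → 𝒮 X → 𝒮 Y → 𝒮 (X ⊙ Y)
  𝒮-⊙ = FS⇒⊙ {L = 𝒮} (λ {X} {Y} → 𝒮-FS {X} {Y})

  ▷-tope : ∀ {X T} → 𝒮 X → topes T → topes (X ▷ T)
  ▷-tope {X} {T} x t = subst 𝒮 (sym (map-just-▷ X T)) (𝒮-⊙ x t)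

  gating : Gating topes
  gating {X} (symmetric {P} p X≼P flips) t = ▷-tope
    (SymmetricFibre.symmetric-fibre {L = 𝒮} (λ {X} {Y} → 𝒮-FS {X} {Y}) (λ {X} {Y} → 𝒮-SE {X} {Y}) {X} {P} p X≼P
      (λ T t X≼T → flips t X≼T)) t

  sep-topes : ∀ {S T : Vec Sign m} {e} → S ! e ≢ T ! e → Sep (map just S) (map just T) e
  sep-topes {S} {T} {e} neq = Sep-intro {X = map just S} {map just T} (lookup-map e just S)
    (trans (lookup-map e just T) (cong just (≢⇒opposite neq)))

  module _ {S T : Vec Sign m} (s : topes S) (t : topes T) {e f : Fin m} (f≢e : f ≢ e)
           (Se≢ : S ! e ≢ T ! e) (Sf≢ : S ! f ≢ T ! f) where

    StrictlyBetween : Set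
    StrictlyBetween = ∃[ U ] (topes U × U ≢ S × U ≢ T × Between S T U)

    -- Let Z eliminate e between S and T. If Z is nonzero somewhere on their separator, composing it
    -- with the tope it disagrees with there works, since e keeps the sign of that tope. If Z
    -- vanishes on the whole separator, simplicity has to break the tie.
    strictly-between : StrictlyBetween
    strictly-between with 𝒮-SE s t (sep-topes {S} {T} Se≢)
    ... | Z , z , Ze , off = by-cases (Fin.any? (λ g → ¬? (S ! g Sign.≟ T ! g) ×-dec ¬? (is-nothing? (Z ! g))))
      where
      Z-same : ∀ {i} → S ! i ≡ T ! i → Z ! i ≡ just (S ! i)
      Z-same {i} eq = trans (off (¬Sep-≡ (map just S) (map just T)
          (trans (lookup-map i just S) (trans (cong just eq) (sym (lookup-map i just T))))))
        (⊙-just (map just S) (map just T) (lookup-map i just S))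
      between : ∀ V → Between S T (Z ▷ V)
      between V i eq = ▷-just Z (Z-same eq)
      by-cases : Dec (∃[ g ] (S ! g ≢ T ! g × Z ! g ≢ nothing)) → StrictlyBetween
      by-cases (yes (g , Sg≢ , Zg≢)) with ≢nothing Zg≢
      ... | r , Zg with r Sign.≟ S ! g
      ... | yes refl = Z ▷ T , ▷-tope z t ,
        (λ eq → Se≢ (trans (cong (_! e) (sym eq)) (▷-nothing Z Ze))) ,
        (λ eq → Sg≢ (trans (sym (▷-just Z Zg)) (cong (_! g) eq))) , between T
      ... | no r≢ = Z ▷ S , ▷-tope z s ,
        (λ eq → r≢ (trans (sym (▷-just Z Zg)) (cong (_! g) eq))) ,
        (λ eq → Se≢ (trans (sym (▷-nothing Z Ze)) (cong (_! e) eq))) , between S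
      -- S and T are opposite at both e and f, so their sign products there are equal. W is chosen
      -- with the other product, and thus `V ▷ S` is neither of them.
      by-cases (no none) with product (f≢e ∘ sym) (opposite (S ! e *ₛ S ! f))
      ... | W , w , prod with product-sign W prod
      ... | a , We , Wf = V ▷ S , ▷-tope (𝒮-⊙ z w) s , not-S , not-T ,
        (λ i eq → ▷-just V (⊙-just Z W (Z-same eq)))
        where
        V : SignVector m
        V = Z ⊙ W
        Zf : Z ! f ≡ nothing
        Zf with zero? Z f
        ... | inj₁ p       = p
        ... | inj₂ (_ , p) = contradiction (f , Sf≢ , just≢nothing p) none
        Ve : (V ▷ S) ! e ≡ a
        Ve = ▷-just V (trans (⊙-nothing Z W Ze) We)
        Vf : (V ▷ S) ! f ≡ a *ₛ opposite (S ! e *ₛ S ! f)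
        Vf = ▷-just V (trans (⊙-nothing Z W Zf) Wf)
        wrong : ∀ x y → y ≢ x *ₛ opposite (x *ₛ y)
        wrong plus  plus  ()
        wrong plus  minus ()
        wrong minus plus  ()
        wrong minus minus ()
        wrong′ : ∀ x y → opposite y ≢ opposite x *ₛ opposite (x *ₛ y)
        wrong′ plus  plus  ()
        wrong′ plus  minus ()
        wrong′ minus plus  ()
        wrong′ minus minus ()
        not-S : V ▷ S ≢ S
        not-S eq = wrong (S ! e) (S ! f) (trans (sym (cong (_! f) eq)) (trans Vf
          (cong (_*ₛ opposite (S ! e *ₛ S ! f)) (trans (sym Ve) (cong (_! e) eq)))))
        not-T : V ▷ S ≢ T
        not-T eq = wrong′ (S ! e) (S ! f) (trans (sym (≢⇒opposite Sf≢)) (trans (sym (cong (_! f) eq)) (trans Vf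
          (cong (_*ₛ opposite (S ! e *ₛ S ! f)) (trans (sym Ve) (trans (cong (_! e) eq) (≢⇒opposite Se≢)))))))

  -- T is replaced by topes strictly between S and T until a single coordinate separates it from S;
  -- the flip found there also leads towards the original T.
  isometric : Isometric topes
  isometric S T s t S≢T = go T (<-wellFounded _) t S≢T
    where
    go : ∀ T → Acc _<_ (ham S T) → topes T → S ≢ T → ∃[ i ] (S ! i ≢ T ! i × topes (flip i S))
    go T (acc rs) t S≢T with differ S≢T
    ... | e , Se≢ with Fin.any? (λ f → ¬? (f Fin.≟ e) ×-dec ¬? (S ! f Sign.≟ T ! f))
    ... | no none = e , Se≢ , subst topes (lookup-ext at-i) t
      where
      at-i : ∀ i → T ! i ≡ flip e S ! i
      at-i i with i Fin.≟ e
      ... | yes refl = trans (≢⇒opposite Se≢) (sym (flip-≡ e S))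
      ... | no i≢e   = trans (sym (decidable-stable (S ! i Sign.≟ T ! i) (λ neq → none (i , i≢e , neq)))) (sym (flip-≢ i≢e S))
    ... | yes (f , f≢e , Sf≢) with strictly-between {S} {T} s t f≢e Se≢ Sf≢
    ... | U , u , U≢S , U≢T , btw with differ {S = U} {T} U≢T
    ... | j , Uj≢Tj with go U (rs (ham-mono-< S T U (λ i eq → sym (btw i eq)) j Sj≢Tj Sj≡Uj)) u (U≢S ∘ sym)
      where
      Sj≢Tj : S ! j ≢ T ! j
      Sj≢Tj eq = Uj≢Tj (trans (btw j eq) eq)
      Sj≡Uj : S ! j ≡ U ! j
      Sj≡Uj = opposite-pair {r = T ! j} (Sj≢Tj ∘ sym) (Uj≢Tj ∘ sym)
    ... | i , Si≢Ui , s′ = i , (λ eq → Si≢Ui (sym (btw i eq))) , s′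

  ag : ∀ {G} → G ≅ topeGraph 𝒮 → AG G
  ag G≅ = model⇒partialCube isometric M , Antipodality.gating⇒ag isometric M gating
    where M = model-≅ G≅ (model-⟦⟧ topes?)

𝓖-COM⇒AG : ∀ {G} → 𝓖-COM G → AG G
𝓖-COM⇒AG (_ , _ , L? , com , _ , R , G≅) = TopeGraph.ag L? com R G≅

-- The COM of a graph in AG

zero-system : ∀ {n} {𝒯 : Topes n} → Decidable 𝒯 → System (replicate n nothing) 𝒯
zero-system 𝒯? = record { dec = 𝒯? ; base = λ _ {i} eq → contradiction eq (nothing≢just (lookup-replicate i nothing)) }

cov? : ∀ {n} {𝒯 : Topes n} → Decidable 𝒯 → Decidable (Cov 𝒯)
cov? 𝒯? X with anyTope? (λ T → 𝒯? T ×-dec ¬? (𝒯? (X ▷ T) ×-dec 𝒯? (X ▷ - T)))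
... | yes (T , t , ¬p) = no λ x → ¬p (x T t)
... | no none = yes λ T t → decidable-stable (𝒯? (X ▷ T) ×-dec 𝒯? (X ▷ - T)) (λ ¬p → none (T , t , ¬p))

Crossed : ∀ {n} → Topes n → Fin n → Set
Crossed 𝒯 e = ∃[ S ] (𝒯 S × ∃[ T ] (𝒯 T × S ! e ≢ T ! e))

crossed? : ∀ {n} {𝒯 : Topes n} → Decidable 𝒯 → ∀ e → Dec (Crossed 𝒯 e)
crossed? 𝒯? e = anyTope? (λ S → 𝒯? S ×-dec anyTope? (λ T → 𝒯? T ×-dec ¬? (S ! e Sign.≟ T ! e)))

module CovectorCOM {G : Graph} {n} {𝒯 : Topes (suc n)} (𝒯? : Decidable 𝒯) (iso : Isometric 𝒯) (gate : Gating 𝒯)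
                   (M : Model G 𝒯) {T₀} (t₀ : 𝒯 T₀) (E : Enumeration (Crossed 𝒯)) where
  open Model M

  com : IsCOM (Cov 𝒯)
  com = record
    { nonempty = map just T₀ , cov-tope {𝒯 = 𝒯} t₀
    ; FS = λ {X} {Y} x y → cov-FS {𝒯 = 𝒯} {X} {Y} x y
    ; SE = λ {X} {Y} x y → gating⇒SE (zero-system 𝒯?) gate t₀ {X} {Y} x y
    }

  open Enumeration E

  uncrossed : ∀ {e S T} → ¬ Crossed 𝒯 e → 𝒯 S → 𝒯 T → S ! e ≡ T ! e
  uncrossed {e} {S} {T} ¬cr s t = decidable-stable (S ! e Sign.≟ T ! e) (λ neq → ¬cr (S , s , T , t , neq))

  edge-at : ∀ {e} → Crossed 𝒯 e → ∃[ P ] (𝒯 P × 𝒯 (flip e P))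
  edge-at (S , s , T , t , neq) = let (P , p , _ , p′) = crossing-edge iso s t neq in P , p , p′

  -- The source of the sign 0 at e: the two ends of an edge form a symmetric face.
  edge-covector : ∀ {e P} → 𝒯 P → 𝒯 (flip e P) → Cov 𝒯 (agree P (flip e P))
  edge-covector {e} {P} p p′ = symmetric⇒cov gate (symmetric p (agree-≼ˡ P (flip e P)) (λ {T} _ _ → on-edge (- T)))
    where
    on-edge : ∀ V → 𝒯 (agree P (flip e P) ▷ V)
    on-edge V = Sum.[_,_]′ (λ eq → subst 𝒯 (sym eq) p) (λ eq → subst 𝒯 (sym eq) p′)
      (≡-or-flip {g = e} {agree P (flip e P) ▷ V} {P}
        (λ i i≢e → ≼-▷ (agree P (flip e P)) V (agree-just P (flip e P) (sym (flip-≢ i≢e P)))))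

  take-sign : ∀ {e P} → 𝒯 P → 𝒯 (flip e P) → ∀ s → ∃[ X ] (Cov 𝒯 X × X ! e ≡ just s)
  take-sign {e} {P} p p′ s with s Sign.≟ P ! e
  ... | yes refl = map just P , cov-tope {𝒯 = 𝒯} p , lookup-map e just P
  ... | no neq   = map just (flip e P) , cov-tope {𝒯 = 𝒯} p′ , trans (lookup-map e just (flip e P))
    (cong just (trans (flip-≡ e P) (sym (≢⇒opposite (neq ∘ sym)))))

  all-signs : ∀ j → TakesAllSigns (Cov 𝒯) (ι j)
  all-signs j nothing  = let (P , p , p′) = edge-at (ι∈ j) in
    agree P (flip (ι j) P) , edge-covector p p′ ,
    agree-nothing P (flip (ι j) P) (λ eq → opposite≢ (trans (sym (flip-≡ (ι j) P)) (sym eq)))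
  all-signs j (just s) = let (P , p , p′) = edge-at (ι∈ j) in take-sign p p′ s

  -- The ends of an edge in direction e differ at e but not at f, so their products of signs at e
  -- and f are opposite.
  non-parallel : ∀ {e f} → Crossed 𝒯 e → e ≢ f → NonParallel (Cov 𝒯) e f
  non-parallel {e} {f} cr e≢f = by-sign (P ! e *ₛ P ! f) refl
    where
    P : Vec Sign (suc n)
    P = proj₁ (edge-at cr)
    p : Cov 𝒯 (map just P)
    p = cov-tope {𝒯 = 𝒯} (proj₁ (proj₂ (edge-at cr)))
    p′ : Cov 𝒯 (map just (flip e P))
    p′ = cov-tope {𝒯 = 𝒯} (proj₂ (proj₂ (edge-at cr)))
    prod : map just P ! e · map just P ! f ≡ just (P ! e *ₛ P ! f)
    prod = multiply (map just P) (lookup-map e just P) (lookup-map f just P)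
    opp-* : ∀ x y → opposite x *ₛ y ≡ opposite (x *ₛ y)
    opp-* plus  _     = refl
    opp-* minus plus  = refl
    opp-* minus minus = refl
    prod′ : map just (flip e P) ! e · map just (flip e P) ! f ≡ just (opposite (P ! e *ₛ P ! f))
    prod′ = trans (multiply (map just (flip e P))
        (trans (lookup-map e just (flip e P)) (cong just (flip-≡ e P)))
        (trans (lookup-map f just (flip e P)) (cong just (flip-≢ (e≢f ∘ sym) P))))
      (cong just (opp-* (P ! e) (P ! f)))
    by-sign : ∀ r → P ! e *ₛ P ! f ≡ r → NonParallel (Cov 𝒯) e f
    by-sign plus  eq = map just P , map just (flip e P) , p , p′ ,
      trans prod (cong just eq) , trans prod′ (cong (just ∘ opposite) eq)
    by-sign minus eq = map just (flip e P) , map just P , p′ , p ,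
      trans prod′ (cong (just ∘ opposite) eq) , trans prod (cong just eq)

  not-self : ∀ {e} → ¬ NonParallel (Cov 𝒯) e e
  not-self {e} (_ , Y , _ , _ , _ , eq) with Y ! e
  not-self (_ , Y , _ , _ , _ , ()) | just plus
  not-self (_ , Y , _ , _ , _ , ()) | just minus

  crossed : ∀ {e} → TakesAllSigns (Cov 𝒯) e → Crossed 𝒯 e
  crossed takes = let (X , x , Xe) = takes (just plus) ; (Y , y , Ye) = takes (just minus) in
    X ▷ T₀ , proj₁ (x T₀ t₀) , Y ▷ T₀ , proj₁ (y T₀ t₀) ,
    λ eq → contradiction (trans (sym (▷-just X Xe)) (trans eq (▷-just Y Ye))) λ ()

  representatives : Representatives (Cov 𝒯) size
  representatives = record
    { ι = ι
    ; allSigns = all-signs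
    ; distinct = λ {i} i≢j → non-parallel (ι∈ i) (i≢j ∘ ι-inj)
    ; complete = λ takes → let (j , eq) = index (crossed takes) in
        j , λ np → not-self (subst (λ i → NonParallel (Cov 𝒯) i _) eq np)
    }

  restrict : Vec Sign (suc n) → Vec Sign size
  restrict T = tabulate (λ j → T ! ι j)

  restrict-ext : ∀ {S T} → 𝒯 S → 𝒯 T → restrict S ≡ restrict T → S ≡ T
  restrict-ext {S} {T} s t eq = lookup-ext at
    where
    at : ∀ i → S ! i ≡ T ! i
    at i with crossed? 𝒯? i
    ... | no ¬cr = uncrossed ¬cr s t
    ... | yes cr with index cr
    ... | j , refl = trans (sym (lookup∘tabulate _ j)) (trans (cong (_! j) eq) (lookup∘tabulate _ j))

  restrict-flip : ∀ j S → restrict (flip (ι j) S) ≡ flip j (restrict S)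
  restrict-flip j S = lookup-ext λ k → trans (lookup∘tabulate _ k) (at k)
    where
    at : ∀ k → flip (ι j) S ! ι k ≡ flip j (restrict S) ! k
    at k with k Fin.≟ j
    ... | yes refl = trans (flip-≡ (ι j) S) (sym (trans (flip-≡ j (restrict S)) (cong opposite (lookup∘tabulate _ j))))
    ... | no k≢j   = trans (flip-≢ (k≢j ∘ ι-inj) S) (sym (trans (flip-≢ k≢j (restrict S)) (lookup∘tabulate _ k)))

  topes : Topes size
  topes T = simplification (Cov 𝒯) representatives (map just T)

  restrict-adjacent : ∀ {S T} → 𝒯 S → 𝒯 T →
    S ∼ T ⇔ restrict S ∼ restrict T
  restrict-adjacent {S} {T} s t = mk⇔ there back
    where
    there : S ∼ T → restrict S ∼ restrict T
    there e with adjacent⇒flip S T e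
    ... | i , refl with index (S , s , flip i S , t , λ eq → opposite≢ (trans (sym (flip-≡ i S)) (sym eq)))
    ... | j , refl = subst (restrict S ∼_) (sym (restrict-flip j S)) (flip-adjacent j (restrict S))
    back : restrict S ∼ restrict T → S ∼ T
    back e with adjacent⇒flip (restrict S) (restrict T) e
    ... | j , eq = subst (S ∼_) (lookup-ext {u = flip (ι j) S} {T} at) (flip-adjacent (ι j) S)
      where
      at : ∀ i → flip (ι j) S ! i ≡ T ! i
      at i with crossed? 𝒯? i
      ... | no ¬cr = trans (flip-≢ (λ { refl → ¬cr (ι∈ j) }) S) (uncrossed ¬cr s t)
      ... | yes cr with index cr
      ... | k , refl = trans (sym (lookup∘tabulate _ k)) (trans (cong (_! k) (trans (restrict-flip j S) (sym eq))) (lookup∘tabulate _ k))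

  restricted-model : Model G topes
  restricted-model = record
    { φ = restrict ∘ φ
    ; φ∈ = λ x → map just (φ x) , cov-tope {𝒯 = 𝒯} (φ∈ x) , lookup-ext (λ j →
        trans (lookup-map j just (restrict (φ x))) (trans (cong just (lookup∘tabulate _ j))
          (sym (trans (lookup∘tabulate _ j) (lookup-map (ι j) just (φ x))))))
    ; injective = λ {x} {y} eq → injective (restrict-ext (φ∈ x) (φ∈ y) eq)
    ; surjective = λ {T} → λ { (X , x , eq) → let (v , φv) = surjective (proj₁ (x T₀ t₀)) in
        v , lookup-ext (λ j → trans (lookup∘tabulate _ j) (trans (cong (_! ι j) φv)
          (▷-just X (trans (sym (lookup∘tabulate _ j)) (trans (cong (_! j) (sym eq)) (lookup-map j just T)))))) }
    ; adjacent = λ {x} {y} → mk⇔ (Equivalence.to (restrict-adjacent (φ∈ x) (φ∈ y)) ∘ Equivalence.to adjacent)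
        (Equivalence.from adjacent ∘ Equivalence.from (restrict-adjacent (φ∈ x) (φ∈ y)))
    }

  𝓖-COM-member : 𝓖-COM G
  𝓖-COM-member = n , Cov 𝒯 , cov? 𝒯? , com , size , representatives ,
    model-unique restricted-model (model-⟦⟧ (TopeGraph.topes? (cov? 𝒯?) com representatives))

-- 𝓖-COM asks for a nonempty ground set, so a constant coordinate is added.

Padded : ∀ {n} → Topes n → Topes (suc n)
Padded 𝒯 (s ∷ T) = s ≡ plus × 𝒯 T

padded? : ∀ {n} {𝒯 : Topes n} → Decidable 𝒯 → Decidable (Padded 𝒯)
padded? 𝒯? (s ∷ T) = (s Sign.≟ plus) ×-dec 𝒯? T

padded-isometric : ∀ {n} {𝒯 : Topes n} → Isometric 𝒯 → Isometric (Padded 𝒯)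
padded-isometric iso (_ ∷ S) (_ ∷ T) (refl , s) (refl , t) neq =
  let (i , Si≢ , s′) = iso S T s t (neq ∘ cong (plus ∷_)) in suc i , Si≢ , refl , s′

padded-adjacent : ∀ {n} {S T : Vec Sign n} → S ∼ T ⇔ (plus ∷ S) ∼ (plus ∷ T)
padded-adjacent {n} {S} {T} = mk⇔ there back
  where
  there : S ∼ T → (plus ∷ S) ∼ (plus ∷ T)
  there e with adjacent⇒flip S T e
  ... | i , refl = flip-adjacent (suc i) (plus ∷ S)
  back : (plus ∷ S) ∼ (plus ∷ T) → S ∼ T
  back e with adjacent⇒flip (plus ∷ S) (plus ∷ T) e
  ... | suc i , refl = flip-adjacent i S

padded-model : ∀ {G n} {𝒯 : Topes n} → Model G 𝒯 → Model G (Padded 𝒯)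
padded-model M = record
  { φ = λ x → plus ∷ φ x
  ; φ∈ = λ x → refl , φ∈ x
  ; injective = λ eq → injective (∷-injectiveʳ eq)
  ; surjective = λ { {_ ∷ T} (refl , t) → let (x , eq) = surjective t in x , cong (plus ∷_) eq }
  ; adjacent = mk⇔ (Equivalence.to padded-adjacent ∘ Equivalence.to adjacent)
                   (Equivalence.from adjacent ∘ Equivalence.from padded-adjacent)
  }
  where
  open Model M

AG⇒𝓖-COM : ∀ {G} → Finite G → Nonempty G → AG G → 𝓖-COM G
AG⇒𝓖-COM {G} fin x₀ (pc , gated) = CovectorCOM.𝓖-COM-member (padded? topes?) iso
    (Antipodality.ag⇒gating iso M gated) M (Model.φ∈ M x₀) (enumerate (crossed? (padded? topes?)))
  where
  open PartialCubeModel fin pc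
  M : Model G (Padded topes)
  M = padded-model model
  iso : Isometric (Padded topes)
  iso = padded-isometric isometric

-- Pc-minors

gating-contraction : ∀ {n} {𝒯 : Topes n} {T₀ g} → Decidable 𝒯 → Gating 𝒯 → 𝒯 T₀ → Gating (Con g 𝒯)
gating-contraction 𝒯? gate t₀ = Elimination.gating-Con (zero-system 𝒯?) gate t₀
  (λ _ sys gate′ t → gating⇒SE sys gate′ t)

record GatedModel (G : Graph) : Set₁ where
  field
    {dimension} : ℕ
    {𝒯}         : Topes dimension
    𝒯?          : Decidable 𝒯
    isometric   : Isometric 𝒯
    gating      : Gating 𝒯
    model       : Model G 𝒯

gated-step : ∀ {G H} → GatedModel G → PcStep G H → GatedModel H
gated-step M (inj₁ restriction) = record
  { 𝒯? = λ T → 𝒯? T ×-dec signs? fs T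
  ; isometric = isometric-∩ (signs-closed fs) isometric
  ; gating = gating-∩ (signs-closed fs) gating
  ; model = proj₂ (restriction-model restriction)
  }
  where
  open GatedModel M
  open Restriction isometric model
  fs = proj₁ (restriction-model restriction)
gated-step M (inj₂ (f , contraction)) = record
  { 𝒯? = Con-dec 𝒯?
  ; isometric = isometric-Con isometric
  ; gating = gating-contraction 𝒯? gating (Model.φ∈ model (Theta.Edge.tail f))
  ; model = Contraction.contraction-model isometric model f contraction
  }
  where open GatedModel M

gated-minor : ∀ {G H} → GatedModel G → PcMinor G H → GatedModel H
gated-minor M ε       = M
gated-minor M (s ◅ p) = gated-minor (gated-step M s) p

AG⇒𝓕𝓠⁻ : ∀ {G} → Finite G → AG G → 𝓕 𝓠⁻ G
AG⇒𝓕𝓠⁻ {G} fin (pc , gated) = pc , no-minor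
  where
  open PartialCubeModel fin pc
  no-minor : ∀ X → 𝓠⁻ X → ¬ (∃[ H ] (PcMinor G H × H ≅ X))
  no-minor X x (H , minor , H≅X) = 𝓠⁻⇒¬AG x
    (Antipodality.gating⇒ag N.isometric (model-≅ (≅-sym H≅X) N.model) N.gating)
    where
    gated-model : GatedModel G
    gated-model = record
      { 𝒯? = topes? ; isometric = isometric
      ; gating = Antipodality.ag⇒gating isometric model gated ; model = model }
    module N = GatedModel (gated-minor gated-model minor)

module Excluded {G : Graph} (excluded : ∀ X → 𝓠⁻ X → ¬ (∃[ H ] (PcMinor G H × H ≅ X))) where

  -- The claim is made for every pc-minor H of G, so that the induction hypothesis covers the
  -- restrictions and contractions that `MinimalNonGated` consults.
  minors-gated : ∀ {n} {c : SignVector n} {𝒯 : Topes n} {H} → Acc _<_ (zeros c) → System c 𝒯 → Isometric 𝒯 →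
                 PcMinor G H → Model H 𝒯 → Gating 𝒯
  minors-gated {n} {c} {𝒯} {H} (acc rs) sys iso minor M {X} sym-X {T} t =
    decidable-stable (dec (X ▷ T)) (λ U∉ → absurd (MinimalNonGated.result sys iso gate-At gate-Con sym-X t U∉))
    where
    open System sys
    open Model M
    gate-At : ∀ {f s} → c ! f ≡ nothing → Gating (𝒯 ∩ At f s)
    -- The point of the symmetric face shows that side s of f is nonempty, as needed to realise it
    -- as a restriction.
    gate-At {f} {s} cf sym-Y = minors-gated (rs (zeros-≔ c s cf)) (system-At sys)
      (isometric-∩ At-closed iso)
      (minor ◅◅ inj₁ (Restriction.At-restriction iso M dec (Symmetric.point∈ sym-Y)) ◅ ε)
      (model-⟦⟧ (System.dec (system-At sys))) sym-Y
    gate-Con : ∀ {g} → c ! g ≡ nothing → ∀ {R S} → 𝒯 R → 𝒯 S → R ! g ≢ S ! g → Gating (Con g 𝒯)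
    gate-Con {g} cg r s neq = minors-gated (rs (zeros-≔ c plus cg)) (system-Con sys) (isometric-Con iso)
      (minor ◅◅ inj₂ (contracted (crossing-edge iso r s neq)) ◅ ε) model-Con
      where
      model-Con : Model ⟦ Con g 𝒯 ⟧ (Con g 𝒯)
      model-Con = model-⟦⟧ (Con-dec dec)
      contracted : ∃[ P ] (𝒯 P × P ! g ≡ _ × 𝒯 (flip g P)) → ∃[ f ] Theta.IsContraction H f ⟦ Con g 𝒯 ⟧
      contracted (P , p , _ , p′) = via (surjective p) (surjective p′)
        where
        via : ∃[ x ] φ x ≡ P → ∃[ y ] φ y ≡ flip g P → ∃[ f ] Theta.IsContraction H f ⟦ Con g 𝒯 ⟧
        via (x , φx) (y , φy) = f , Contraction.model-contraction iso M f
          (subst (λ i → Model ⟦ Con g 𝒯 ⟧ (Con i 𝒯)) (sym (Classes.coord-unique iso M e y-flip)) model-Con)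
          where
          y-flip : φ y ≡ flip g (φ x)
          y-flip = trans φy (cong (flip g) (sym φx))
          e : Graph._~_ H x y
          e = flip⇒~ y-flip
          f : Theta.Edge H
          f = Theta.edge e
    absurd : ¬ Punctured c 𝒯
    absurd pun = let (Y , y , N) = punctured⇒𝓠⁻ sys pun in excluded Y y (H , minor , model-unique M N)

𝓕𝓠⁻⇒AG : ∀ {G} → Finite G → 𝓕 𝓠⁻ G → AG G
𝓕𝓠⁻⇒AG fin (pc , excluded) = pc , Antipodality.gating⇒ag isometric model
  (Excluded.minors-gated excluded (<-wellFounded _) (zero-system topes?) isometric ε model)
  where open PartialCubeModel fin pc

mainTheorem1 : (G : Graph) → Finite G → Nonempty G →
    (𝓖-COM G ⇔ AG G) × (AG G ⇔ 𝓕 𝓠⁻ G)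
mainTheorem1 G fin x₀ =
  mk⇔ 𝓖-COM⇒AG (AG⇒𝓖-COM fin x₀) , mk⇔ (AG⇒𝓕𝓠⁻ fin) (𝓕𝓠⁻⇒AG fin)
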